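{- Let $L/K$ be a finite extension with maximal separable subextension $L_S/K$, and let $A=\mathrm{Aut}(L/K)$ with fixed field $L^A$. The following are equivalent: (a) $L/K$ is normal; (b) $s_K(L)=1$; (c) $r_K(L)=[L_S:K]$; (d) $l_K(L)=[L:K]$; (e) $[L:L_S]=[L^A:K]$; (f) $L^A/K$ is purely inseparable.
   Context: $K$ is any field (not necessarily perfect) with a fixed algebraic closure $\bar K$; all extensions are finite and contained in $\bar K$. $r_K(L)=|\mathrm{Aut}(L/K)|$; $s_K(L)$ is the number of distinct subfields of $\bar K$ isomorphic to $L$ over $K$; $l_K(L)=[L:L_S]\cdot r_K(L)$. The trivial extension $K/K$ counts as purely inseparable. -}

module Defs where

open import Algebra.Bundles using (CommutativeRing; RawRing)
open import Algebra.Morphism.Structures using (module RingMorphisms)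
import Algebra.Properties.Monoid.Sum as MonoidSum
open import Axiom.ExcludedMiddle using (ExcludedMiddle)
open import Data.Fin.Base using (Fin)
open import Data.List.Base using (List; []; _∷_; map; foldr)
open import Data.List.Relation.Unary.All using (All)
open import Data.Nat.Base as ℕ using (ℕ; zero; suc)
open import Data.Product.Base using (Σ; ∃; ∃-syntax; _×_; _,_; proj₁; proj₂)
open import Data.Sum.Base using (_⊎_)
open import Data.Vec.Functional using (Vector)
open import Function.Bundles using (Bijection)
open import Level using (Level; _⊔_; Setω) renaming (suc to lsuc)
open import Relation.Binary.Bundles using (Setoid)
import Relation.Binary.PropositionalEquality as ≡
import Relation.Binary.Reasoning.Setoid as SetoidReasoning
open import Relation.Nullary.Decidable.Core using (Dec; yes; no)
open import Relation.Nullary.Negation using (¬_)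
open import Relation.Unary using (Pred)

private
  variable
    a ℓ₁ c ℓ : Level

-- The theory is classical: bases, degrees and cardinalities need not exist
-- constructively, so results take excluded middle as an explicit hypothesis.

Classical : Setω
Classical = ∀ a → ExcludedMiddle a

-- For P characterising at most one number (a dimension, a cardinality): that
-- number, and 0 when there is none.

numberOr0 : {P : ℕ → Set a} → Dec (∃ P) → ℕ
numberOr0 (yes (n , _)) = n
numberOr0 (no _)        = 0

HasCardinality : Setoid a ℓ₁ → ℕ → Set (a ⊔ ℓ₁)
HasCardinality S n = Bijection S (≡.setoid (Fin n))

card : Classical → Setoid a ℓ₁ → ℕ
card {a} {ℓ₁} em S = numberOr0 (em (a ⊔ ℓ₁) {∃ (HasCardinality S)})

record Field (c ℓ : Level) : Set (lsuc (c ⊔ ℓ)) where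
  field
    commutativeRing : CommutativeRing c ℓ

  open CommutativeRing commutativeRing public

  field
    0≉1     : ¬ (0# ≈ 1#)
    inverse : ∀ x → ¬ (x ≈ 0#) → ∃[ y ] x * y ≈ 1#

-- A polynomial is its list of coefficients, constant term first; lists that
-- differ by trailing zeros denote the same polynomial, hence _≐_.

module Polynomials {c ℓ} (R : CommutativeRing c ℓ) where
  open CommutativeRing R

  Poly : Set c
  Poly = List Carrier

  coeff : Poly → ℕ → Carrier
  coeff []      _       = 0#
  coeff (a ∷ p) zero    = a
  coeff (a ∷ p) (suc n) = coeff p n

  infix  4 _≐_ _∣ₚ_
  infixl 6 _+ₚ_
  infixl 7 _*ₚ_ _·ₚ_

  _≐_ : Poly → Poly → Set ℓ
  p ≐ q = ∀ n → coeff p n ≈ coeff q n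

  _+ₚ_ : Poly → Poly → Poly
  []      +ₚ q       = q
  (a ∷ p) +ₚ []      = a ∷ p
  (a ∷ p) +ₚ (b ∷ q) = (a + b) ∷ (p +ₚ q)

  _·ₚ_ : Carrier → Poly → Poly
  a ·ₚ p = map (a *_) p

  _*ₚ_ : Poly → Poly → Poly
  []      *ₚ q = []
  (a ∷ p) *ₚ q = (a ·ₚ q) +ₚ (0# ∷ (p *ₚ q))

  _∣ₚ_ : Poly → Poly → Set (c ⊔ ℓ)
  p ∣ₚ f = ∃[ q ] f ≐ p *ₚ q

  eval : Poly → Carrier → Carrier
  eval p x = foldr (λ a r → a + x * r) 0# p

  Root : Poly → Carrier → Set ℓ
  Root p x = eval p x ≈ 0#

  X-_ : Carrier → Poly
  X- a = (- a) ∷ 1# ∷ []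

  ∏X- : List Carrier → Poly
  ∏X- = foldr (λ a p → (X- a) *ₚ p) (1# ∷ [])

  -- The zero polynomial is constant.
  Constant : Poly → Set ℓ
  Constant p = ∀ n → coeff p (suc n) ≈ 0#

  Monic : Poly → Set ℓ
  Monic p = ∃[ d ] coeff p d ≈ 1# × (∀ n → d ℕ.< n → coeff p n ≈ 0#)

  NoMultipleRoot : Poly → Set (c ⊔ ℓ)
  NoMultipleRoot p = ∀ a → ¬ ((X- a) *ₚ (X- a) ∣ₚ p)

record Subfield (Ω : Field c ℓ) : Set (lsuc (c ⊔ ℓ)) where
  open Field Ω
  field
    member   : Pred Carrier (c ⊔ ℓ)
    resp     : ∀ {x y} → x ≈ y → member x → member y
    0∈       : member 0#
    1∈       : member 1#
    +-closed : ∀ {x y} → member x → member y → member (x + y)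
    *-closed : ∀ {x y} → member x → member y → member (x * y)
    neg-closed : ∀ {x} → member x → member (- x)
    inv-closed : ∀ {x y} → x * y ≈ 1# → member x → member y

-- From here on Ω plays the role of the ambient algebraically closed field,
-- although nothing below requires it to be one.

module _ {Ω : Field c ℓ} where
  open Field Ω
  open Polynomials commutativeRing
  open MonoidSum +-monoid using (sum)

  infix 4 _∈_ _⊆_ _≅ₛ_ _∈_[X]

  _∈_ : Carrier → Subfield Ω → Set (c ⊔ ℓ)
  x ∈ F = Subfield.member F x

  _⊆_ : Subfield Ω → Subfield Ω → Set (c ⊔ ℓ)
  F ⊆ E = ∀ {x} → x ∈ F → x ∈ E

  -- equality of subfields as subsets of Ω
  _≅ₛ_ : Subfield Ω → Subfield Ω → Set (c ⊔ ℓ)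
  F ≅ₛ E = F ⊆ E × E ⊆ F

  Element : Subfield Ω → Set (c ⊔ ℓ)
  Element E = Σ Carrier (_∈ E)

  subfieldRing : Subfield Ω → RawRing (c ⊔ ℓ) ℓ
  subfieldRing E = record
    { Carrier = Element E
    ; _≈_     = λ x y → proj₁ x ≈ proj₁ y
    ; _+_     = λ x y → proj₁ x + proj₁ y , +-closed (proj₂ x) (proj₂ y)
    ; _*_     = λ x y → proj₁ x * proj₁ y , *-closed (proj₂ x) (proj₂ y)
    ; -_      = λ x → - proj₁ x , neg-closed (proj₂ x)
    ; 0#      = 0# , 0∈
    ; 1#      = 1# , 1∈
    }
    where open Subfield E

  record IsBasis (F E : Subfield Ω) {n : ℕ} (b : Vector Carrier n) : Set (c ⊔ ℓ) where
    field
      members     : ∀ i → b i ∈ E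
      spanning    : ∀ {x} → x ∈ E → Σ (Vector Carrier n) λ k →
                    (∀ i → k i ∈ F) × x ≈ sum (λ i → k i * b i)
      independent : ∀ (k : Vector Carrier n) → (∀ i → k i ∈ F) → sum (λ i → k i * b i) ≈ 0# →
                    ∀ i → k i ≈ 0#

  HasDegree : Subfield Ω → Subfield Ω → ℕ → Set (c ⊔ ℓ)
  HasDegree F E n = Σ (Vector Carrier n) (IsBasis F E)

  FiniteExtension : Subfield Ω → Subfield Ω → Set (c ⊔ ℓ)
  FiniteExtension F E = F ⊆ E × ∃ (HasDegree F E)

  -- degree em F E is [E : F]
  degree : Classical → Subfield Ω → Subfield Ω → ℕ
  degree em F E = numberOr0 (em (c ⊔ ℓ) {∃ (HasDegree F E)})

  _∈_[X] : Poly → Subfield Ω → Set (c ⊔ ℓ)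
  p ∈ F [X] = All (_∈ F) p

  Algebraic : Subfield Ω → Carrier → Set (c ⊔ ℓ)
  Algebraic F x = ∃[ p ] p ∈ F [X] × ¬ (p ≐ []) × Root p x

  record Irreducible (F : Subfield Ω) (f : Poly) : Set (c ⊔ ℓ) where
    field
      over        : f ∈ F [X]
      nonconstant : ¬ Constant f
      no-factors  : ∀ g h → g ∈ F [X] → h ∈ F [X] → f ≐ g *ₚ h →
                    Constant g ⊎ Constant h

  record IsMinimalPolynomial (F : Subfield Ω) (x : Carrier) (f : Poly) : Set (c ⊔ ℓ) where
    field
      irreducible : Irreducible F f
      monic       : Monic f
      root        : Root f x

  -- The roots of the minimal polynomial are taken in Ω, so this is
  -- separability provided Ω is algebraically closed.
  SeparableElement : Subfield Ω → Carrier → Set (c ⊔ ℓ)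
  SeparableElement F x = ∃[ f ] IsMinimalPolynomial F x f × NoMultipleRoot f

  SeparableExtension : Subfield Ω → Subfield Ω → Set (c ⊔ ℓ)
  SeparableExtension F E = F ⊆ E × (∀ {x} → x ∈ E → SeparableElement F x)

  PurelyInseparable : Subfield Ω → Subfield Ω → Set (c ⊔ ℓ)
  PurelyInseparable F E = F ⊆ E × (∀ {x} → x ∈ E → SeparableElement F x → x ∈ F)

  record IsMaximalSeparable (F E S : Subfield Ω) : Set (lsuc (c ⊔ ℓ)) where
    field
      separable : SeparableExtension F S
      inside    : S ⊆ E
      maximal   : ∀ M → SeparableExtension F M → M ⊆ E → M ⊆ S

  SplitsIn : Subfield Ω → Poly → Set (c ⊔ ℓ)
  SplitsIn E f = ∃[ k ] ∃[ as ] k ∈ E × All (_∈ E) as × f ≐ k ·ₚ ∏X- as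

  Normal : Subfield Ω → Subfield Ω → Set (c ⊔ ℓ)
  Normal F E = F ⊆ E × (∀ {x} → x ∈ E → Algebraic F x) ×
    (∀ f → Irreducible F f → ∀ {x} → x ∈ E → Root f x → SplitsIn E f)

  -- isomorphisms E → E′ that are the identity on F
  record Isomorphism (F E E′ : Subfield Ω) : Set (c ⊔ ℓ) where
    open RingMorphisms (subfieldRing E) (subfieldRing E′)
    field
      ⟦_⟧               : Element E → Element E′
      isRingIsomorphism : IsRingIsomorphism ⟦_⟧
      fixes             : ∀ x → proj₁ x ∈ F → proj₁ ⟦ x ⟧ ≈ proj₁ x

    open IsRingIsomorphism isRingIsomorphism public

  Aut : Subfield Ω → Subfield Ω → Setoid (c ⊔ ℓ) (c ⊔ ℓ)
  Aut F E = record
    { Carrier       = Isomorphism F E E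
    ; _≈_           = λ σ τ → ∀ x → proj₁ (⟦ σ ⟧ x) ≈ proj₁ (⟦ τ ⟧ x)
    ; isEquivalence = record
      { refl  = λ _ → refl
      ; sym   = λ p x → sym (p x)
      ; trans = λ p q x → trans (p x) (q x)
      }
    }
    where open Isomorphism

  -- Two pairs (subfield, isomorphism) count as one when the subfields coincide.
  IsomorphicSubfields : Subfield Ω → Subfield Ω → Setoid (lsuc (c ⊔ ℓ)) (c ⊔ ℓ)
  IsomorphicSubfields F E = record
    { Carrier       = Σ (Subfield Ω) (Isomorphism F E)
    ; _≈_           = λ M N → proj₁ M ≅ₛ proj₁ N
    ; isEquivalence = record
      { refl  = (λ z → z) , (λ z → z)
      ; sym   = λ p → proj₂ p , proj₁ p
      ; trans = λ p q → (λ z → proj₁ q (proj₁ p z)) , (λ z → proj₂ p (proj₂ q z))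
      }
    }

  r : Classical → Subfield Ω → Subfield Ω → ℕ
  r em F E = card em (Aut F E)

  s : Classical → Subfield Ω → Subfield Ω → ℕ
  s em F E = card em (IsomorphicSubfields F E)

  -- S is the maximal separable subextension of E/F
  l : Classical → (F E S : Subfield Ω) → ℕ
  l em F E S = degree em S E ℕ.* r em F E

  fixedField : Subfield Ω → Subfield Ω → Subfield Ω
  fixedField F E = record
    { member     = λ x → Σ (x ∈ E) λ x∈ → ∀ σ → proj₁ (⟦ σ ⟧ (x , x∈)) ≈ x
    ; resp       = λ x≈y (x∈ , fx) → resp x≈y x∈ , λ σ →
                     trans (⟦⟧-cong σ (sym x≈y)) (trans (fx σ) x≈y)
    ; 0∈         = 0∈ , 0#-homo
    ; 1∈         = 1∈ , 1#-homo
    ; +-closed   = λ (x∈ , fx) (y∈ , fy) → +-closed x∈ y∈ , λ σ →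
                     trans (+-homo σ _ _) (+-cong (fx σ) (fy σ))
    ; *-closed   = λ (x∈ , fx) (y∈ , fy) → *-closed x∈ y∈ , λ σ →
                     trans (*-homo σ _ _) (*-cong (fx σ) (fy σ))
    ; neg-closed = λ (x∈ , fx) → neg-closed x∈ , λ σ →
                     trans (-‿homo σ _) (-‿cong (fx σ))
    ; inv-closed = λ xy≈1 (x∈ , fx) → inv-closed xy≈1 x∈ , inv-fixed xy≈1 x∈ fx
    }
    where
    open Subfield E
    open Isomorphism
    open SetoidReasoning setoid

    inv-fixed : ∀ {x y} (xy≈1 : x * y ≈ 1#) (x∈ : x ∈ E) →
                (∀ (σ : Isomorphism F E E) → proj₁ (⟦ σ ⟧ (x , x∈)) ≈ x) →
                ∀ (σ : Isomorphism F E E) →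
                proj₁ (⟦ σ ⟧ (y , inv-closed xy≈1 x∈)) ≈ y
    inv-fixed {x} {y} xy≈1 x∈ fx σ = begin
      σy             ≈⟨ *-identityʳ σy ⟨
      σy * 1#        ≈⟨ *-congˡ xy≈1 ⟨
      σy * (x * y)   ≈⟨ *-assoc σy x y ⟨
      (σy * x) * y   ≈⟨ *-congʳ (*-congˡ (fx σ)) ⟨
      (σy * σx) * y  ≈⟨ *-congʳ (*-homo σ (y , y∈) (x , x∈)) ⟨
      σyx * y        ≈⟨ *-congʳ (⟦⟧-cong σ (trans (*-comm y x) xy≈1)) ⟩
      σ1 * y         ≈⟨ *-congʳ (1#-homo σ) ⟩
      1# * y         ≈⟨ *-identityˡ y ⟩
      y              ∎
      where
      y∈ : y ∈ E
      y∈ = inv-closed xy≈1 x∈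
      σx σy σyx σ1 : Carrier
      σx  = proj₁ (⟦ σ ⟧ (x , x∈))
      σy  = proj₁ (⟦ σ ⟧ (y , y∈))
      σyx = proj₁ (⟦ σ ⟧ (y * x , *-closed y∈ x∈))
      σ1  = proj₁ (⟦ σ ⟧ (1# , 1∈))

module _ (K Ω : Field c ℓ) where
  private
    module K = Field K
    module Ω = Field Ω
  open RingMorphisms K.rawRing Ω.rawRing

  image : (ι : K.Carrier → Ω.Carrier) → IsRingHomomorphism ι → Subfield Ω
  image ι hom = record
    { member     = λ x → ∃[ k ] ι k Ω.≈ x
    ; resp       = λ x≈y (k , p) → k , Ω.trans p x≈y
    ; 0∈         = K.0# , 0#-homo
    ; 1∈         = K.1# , 1#-homo
    ; +-closed   = λ (j , p) (k , q) → j K.+ k , Ω.trans (+-homo j k) (Ω.+-cong p q)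
    ; *-closed   = λ (j , p) (k , q) → j K.* k , Ω.trans (*-homo j k) (Ω.*-cong p q)
    ; neg-closed = λ (k , p) → K.- k , Ω.trans (-‿homo k) (Ω.-‿cong p)
    ; inv-closed = inv
    }
    where
    open IsRingHomomorphism hom
    open SetoidReasoning Ω.setoid

    inv : ∀ {x y} → x Ω.* y Ω.≈ Ω.1# → (∃[ k ] ι k Ω.≈ x) → ∃[ k ] ι k Ω.≈ y
    inv {x} {y} xy≈1 (k , ιk≈x) = k⁻¹ , (begin
      ι k⁻¹                   ≈⟨ Ω.*-identityʳ _ ⟨
      ι k⁻¹ Ω.* Ω.1#          ≈⟨ Ω.*-congˡ xy≈1 ⟨
      ι k⁻¹ Ω.* (x Ω.* y)     ≈⟨ Ω.*-assoc _ _ _ ⟨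
      (ι k⁻¹ Ω.* x) Ω.* y     ≈⟨ Ω.*-congʳ (Ω.*-congˡ ιk≈x) ⟨
      (ι k⁻¹ Ω.* ι k) Ω.* y   ≈⟨ Ω.*-congʳ (*-homo k⁻¹ k) ⟨
      ι (k⁻¹ K.* k) Ω.* y     ≈⟨ Ω.*-congʳ (⟦⟧-cong (K.trans (K.*-comm k⁻¹ k) kk⁻¹≈1)) ⟩
      ι K.1# Ω.* y            ≈⟨ Ω.*-congʳ 1#-homo ⟩
      Ω.1# Ω.* y              ≈⟨ Ω.*-identityˡ y ⟩
      y                       ∎)
      where
      k≉0 : ¬ (k K.≈ K.0#)
      k≉0 k≈0 = Ω.0≉1 (begin
        Ω.0#         ≈⟨ Ω.zeroˡ y ⟨
        Ω.0# Ω.* y   ≈⟨ Ω.*-congʳ 0#-homo ⟨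
        ι K.0# Ω.* y ≈⟨ Ω.*-congʳ (⟦⟧-cong k≈0) ⟨
        ι k Ω.* y    ≈⟨ Ω.*-congʳ ιk≈x ⟩
        x Ω.* y      ≈⟨ xy≈1 ⟩
        Ω.1#         ∎)

      k⁻¹ : K.Carrier
      k⁻¹ = proj₁ (K.inverse k k≉0)

      kk⁻¹≈1 : k K.* k⁻¹ K.≈ K.1#
      kk⁻¹≈1 = proj₂ (K.inverse k k≉0)

record AlgebraicClosure (K : Field c ℓ) : Set (lsuc (c ⊔ ℓ)) where
  field
    K̄ : Field c ℓ

  private
    module K = Field K
    module K̄ = Field K̄
  open RingMorphisms K.rawRing K̄.rawRing
  open Polynomials K̄.commutativeRing

  field
    ι                  : K.Carrier → K̄.Carrier
    isRingHomomorphism : IsRingHomomorphism ι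

  -- the copy of K inside K̄
  base : Subfield K̄
  base = image K K̄ ι isRingHomomorphism

  field
    algebraicallyClosed : ∀ p → ¬ Constant p → ∃[ x ] Root p x
    algebraic           : ∀ x → Algebraic base x

{-# OPTIONS --safe #-}
module Submission where

open import Defs
open import Algebra.Bundles using (CommutativeRing)
import Algebra.Construct.DirectProduct as DirectProduct
import Algebra.Properties.AbelianGroup as AbelianGroupProperties
import Algebra.Properties.CommutativeSemiring.Binomial as Binomial
import Algebra.Properties.CommutativeSemiring.Exp as CommutativeExp
import Algebra.Properties.Ring as RingProperties
import Algebra.Properties.Semiring.Exp as Exp
import Algebra.Properties.Semiring.Mult as Mult
import Algebra.Properties.Semiring.Mult.TCOptimised as OptimisedMult
import Algebra.Properties.Semiring.Sum as SemiringSum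
import Algebra.Solver.Ring as RingSolver
import Algebra.Solver.Ring.AlmostCommutativeRing as ACR
open import Data.Empty using (⊥-elim)
open import Data.Fin.Base as Fin using (Fin; zero; suc; punchIn; punchOut; combine; remQuot; _↑ˡ_; _↑ʳ_; toℕ; fromℕ; inject₁)
import Data.Fin.Properties as Fin
open import Data.Integer.Base as ℤ using (ℤ; +_; -[1+_]; _⊖_)
import Data.Integer.Properties as ℤ
open import Data.List.Base using (List; []; _∷_; _∷ʳ_; map; length; replicate)
open import Data.List.Membership.Propositional using () renaming (_∈_ to _∈ₗ_)
import Data.List.Properties as List
open import Data.List.Relation.Unary.All as All using (All; []; _∷_)
import Data.List.Relation.Unary.All.Properties as All
open import Data.List.Relation.Unary.Any as Any using (Any; here; there)
open import Data.Maybe.Base using (Maybe; just; nothing)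
open import Data.Nat.Base as ℕ using (ℕ; zero; suc; s≤s; z≤n)
open import Data.Nat.Combinatorics using (_C_; nC1≡n; nCn≡1; nCk+nC[k+1]≡[n+1]C[k+1])
open import Data.Nat.Combinatorics.Specification using (k>n⇒nCk≡0)
open import Data.Nat.Divisibility as ℕ using (_∣_; divides; ∣⇒≤)
open import Data.Nat.Induction using (<-rec)
open import Data.Nat.Primality using (Prime; euclidsLemma; prime?; ¬prime⇒composite; prime⇒nonZero)
import Data.Nat.Properties as ℕ
open import Data.Product.Base using (Σ; ∃; ∃-syntax; _×_; _,_; proj₁; proj₂)
open import Data.Sum.Base using (_⊎_; inj₁; inj₂)
open import Data.Unit.Polymorphic.Base using (⊤)
open import Data.Vec.Functional using (Vector) renaming (_∷_ to _∷ᵛ_)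
open import Function.Base using (_∘_)
open import Function.Bundles using (Bijection; _⇔_; mk⇔)
open import Function.Construct.Composition using (_⇔-∘_)
open import Level using (Level; _⊔_) renaming (suc to lsuc)
open import Relation.Binary.Bundles using (Setoid)
open import Relation.Binary.PropositionalEquality as ≡ using (_≡_)
import Relation.Binary.Reasoning.Setoid as SetoidReasoning
open import Relation.Nullary.Decidable.Core using (Dec; yes; no)
open import Relation.Nullary.Negation using (¬_; contradiction)
open import Relation.Unary using (Pred)

-- Every x ∈ L has a power x^q ∈ Lₛ with q a power of the characteristic exponent,
-- so a K-embedding of L is determined on Lₛ. Aut(L/K) therefore acts faithfully on
-- Lₛ, with fixed field Lₛ ∩ Lᴬ. If Lᴬ/K is purely inseparable, that field is K and
-- Artin's theorem gives r = [Lₛ : K]. If r = [Lₛ : K], there is no room for a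
-- further embedding of Lₛ, by Dedekind's independence of homomorphisms; so every
-- K-embedding of L is an automorphism, and since every root of an irreducible
-- polynomial with a root in L is the image of that root under some embedding, L/K
-- is normal; the same embeddings show that s = 1 forces normality. If L/K is
-- normal, every K-embedding of L has image L, so s = 1, and an element of Lᴬ has no
-- other conjugate, so it lies in K when it is separable. Artin's theorem on L,
-- [L : Lᴬ] = r, and the tower law turn r = [Lₛ : K] into the other two numerical
-- conditions.
--
-- Separability is handled through Frobenius: in characteristic p, x is separable
-- over K iff x ∈ K(xᵖ).

-- With integer coefficients the ring solver can see that terms cancel, although
-- equality in R is not computable.

-- Maximality of `Lₛ` is a statement about subextensions, so a separable element x of `L` is known
-- to lie in `Lₛ` only after K(x)/K has been shown to be separable. Dimensions are counted for this,
-- not embeddings: if x is separable then K(x) = K(xᵖ), and this bounds [K(x) : K(yᵖ)] by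
-- [K(x) : K(y)], which forces y ∈ K(yᵖ) for every y in K(x). In the other direction an inseparable
-- x has x ∉ K(xᵖ), so [K(xᵖ) : K] is strictly smaller than [K(x) : K], and descent on this degree
-- ends in a separable power. The prime p is never assumed: inseparability of some element produces
-- it, so characteristic zero needs no separate treatment.
--
-- Embeddings are built without quotient rings. A partial embedding is its graph, a subring of Ω ×
-- Ω, and adjoining a pair (x, y) to the graph extends the embedding by x ↦ y. A polynomial over the
-- product ring carries a polynomial together with its transported copy, so one division serves
-- both.

module IntegerCoefficients {c ℓ} (R : CommutativeRing c ℓ) where
  open CommutativeRing R
  open RingProperties ring
  open AbelianGroupProperties +-abelianGroup using (⁻¹-∙-comm)
  open OptimisedMult semiring renaming (_×_ to _×ₙ_)
  open SetoidReasoning setoid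

  ι : ℤ → Carrier
  ι (+ n)      = n ×ₙ 1#
  ι -[1+ n ]   = - (suc n ×ₙ 1#)

  cancel-1 : ∀ a b → (1# + a) + - (1# + b) ≈ a + - b
  cancel-1 a b = begin
    (1# + a) + - (1# + b)     ≈⟨ +-cong (+-comm 1# a) (sym (⁻¹-∙-comm 1# b)) ⟩
    (a + 1#) + (- 1# + - b)   ≈⟨ +-assoc a 1# _ ⟩
    a + (1# + (- 1# + - b))   ≈⟨ +-congˡ (+-assoc 1# _ _) ⟨
    a + ((1# + - 1#) + - b)   ≈⟨ +-congˡ (+-congʳ (-‿inverseʳ 1#)) ⟩
    a + (0# + - b)            ≈⟨ +-congˡ (+-identityˡ _) ⟩
    a + - b                   ∎

  ι-⊖ : ∀ m n → ι (m ⊖ n) ≈ m ×ₙ 1# + - (n ×ₙ 1#)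
  ι-⊖ zero    zero    = sym (trans (+-identityˡ _) -0#≈0#)
  ι-⊖ zero    (suc n) = sym (+-identityˡ _)
  ι-⊖ (suc m) zero    = sym (trans (+-congˡ -0#≈0#) (+-identityʳ _))
  ι-⊖ (suc m) (suc n) = begin
    ι (suc m ⊖ suc n)                  ≡⟨ ≡.cong ι (ℤ.[1+m]⊖[1+n]≡m⊖n m n) ⟩
    ι (m ⊖ n)                          ≈⟨ ι-⊖ m n ⟩
    m ×ₙ 1# + - (n ×ₙ 1#)                ≈⟨ cancel-1 _ _ ⟨
    (1# + m ×ₙ 1#) + - (1# + n ×ₙ 1#)    ≈⟨ +-cong (1+× m 1#) (-‿cong (1+× n 1#)) ⟨
    suc m ×ₙ 1# + - (suc n ×ₙ 1#)        ∎

  ι-+ : ∀ m n → ι (m ℤ.+ n) ≈ ι m + ι n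
  ι-+ (+ m)    (+ n)    = ×-homo-+ 1# m n
  ι-+ (+ m)    -[1+ n ] = ι-⊖ m (suc n)
  ι-+ -[1+ m ] (+ n)    = trans (ι-⊖ n (suc m)) (+-comm _ _)
  ι-+ -[1+ m ] -[1+ n ] = begin
    - (suc (suc (m ℕ.+ n)) ×ₙ 1#)          ≡⟨ ≡.cong (λ k → - (k ×ₙ 1#)) (≡.cong suc (ℕ.+-suc m n)) ⟨
    - ((suc m ℕ.+ suc n) ×ₙ 1#)            ≈⟨ -‿cong (×-homo-+ 1# (suc m) (suc n)) ⟩
    - (suc m ×ₙ 1# + suc n ×ₙ 1#)           ≈⟨ ⁻¹-∙-comm _ _ ⟨
    - (suc m ×ₙ 1#) + - (suc n ×ₙ 1#)       ∎

  ι-neg : ∀ m → ι (ℤ.- m) ≈ - ι m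
  ι-neg (+ zero)  = sym -0#≈0#
  ι-neg (+ suc n) = refl
  ι-neg -[1+ n ]  = sym (-‿involutive _)

  ι-*-nat : ∀ m n → ι (+ m ℤ.* + n) ≈ ι (+ m) * ι (+ n)
  ι-*-nat m n = trans (reflexive (≡.cong ι (≡.sym (ℤ.pos-* m n)))) (×1-homo-* m n)

  ι-* : ∀ m n → ι (m ℤ.* n) ≈ ι m * ι n
  ι-* (+ m)    (+ n)    = ι-*-nat m n
  ι-* (+ m)    -[1+ n ] = begin
    ι (+ m ℤ.* -[1+ n ])         ≡⟨ ≡.cong ι (ℤ.neg-distribʳ-* (+ m) (+ suc n)) ⟨
    ι (ℤ.- (+ m ℤ.* + suc n))    ≈⟨ ι-neg (+ m ℤ.* + suc n) ⟩
    - ι (+ m ℤ.* + suc n)        ≈⟨ -‿cong (ι-*-nat m (suc n)) ⟩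
    - (ι (+ m) * ι (+ suc n))    ≈⟨ -‿distribʳ-* _ _ ⟩
    ι (+ m) * ι -[1+ n ]         ∎
  ι-* -[1+ m ] (+ n)    = begin
    ι (-[1+ m ] ℤ.* + n)         ≡⟨ ≡.cong ι (ℤ.neg-distribˡ-* (+ suc m) (+ n)) ⟨
    ι (ℤ.- (+ suc m ℤ.* + n))    ≈⟨ ι-neg (+ suc m ℤ.* + n) ⟩
    - ι (+ suc m ℤ.* + n)        ≈⟨ -‿cong (ι-*-nat (suc m) n) ⟩
    - (ι (+ suc m) * ι (+ n))    ≈⟨ -‿distribˡ-* _ _ ⟩
    ι -[1+ m ] * ι (+ n)         ∎
  ι-* -[1+ m ] -[1+ n ] = begin
    ι (+ suc m ℤ.* + suc n)      ≈⟨ ι-*-nat (suc m) (suc n) ⟩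
    ι (+ suc m) * ι (+ suc n)    ≈⟨ -‿involutive _ ⟨
    - - (ι (+ suc m) * ι (+ suc n)) ≈⟨ -‿cong (-‿distribʳ-* _ _) ⟩
    - (ι (+ suc m) * ι -[1+ n ]) ≈⟨ -‿distribˡ-* _ _ ⟩
    ι -[1+ m ] * ι -[1+ n ]      ∎

  ι-homomorphism : ℤ.+-*-rawRing ACR.-Raw-AlmostCommutative⟶ ACR.fromCommutativeRing R
  ι-homomorphism = record
    { ⟦_⟧    = ι
    ; +-homo = ι-+
    ; *-homo = ι-*
    ; -‿homo = ι-neg
    ; 0-homo = refl
    ; 1-homo = refl
    }

  -- In positive characteristic distinct integers can have equal images. Answering `nothing` for
  -- them is sound, as the solver only asks for a semi-decision.
  ι-≟ : ∀ m n → Maybe (ι m ≈ ι n)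
  ι-≟ m n with m ℤ.≟ n
  ... | yes m≡n = just (reflexive (≡.cong ι m≡n))
  ... | no _    = nothing

  open RingSolver ℤ.+-*-rawRing (ACR.fromCommutativeRing R) ι-homomorphism ι-≟ public
    using (solve; con; _:=_; _:+_; _:*_; _:-_; :-_)

numberOr0-satisfies : ∀ {a} {P : ℕ → Set a} (d : Dec (∃ P)) → ∃ P → P (numberOr0 d)
numberOr0-satisfies (yes (_ , p)) _ = p
numberOr0-satisfies (no ¬p)       p = contradiction p ¬p

-- Classical reasoning in a field.

module ClassicalField (em : Classical) {c ℓ : Level} (Ω : Field c ℓ) where
  open Field Ω hiding (zero)
  open RingProperties ring public
  open IntegerCoefficients commutativeRing public using (solve; con; _:=_; _:+_; _:*_; _:-_; :-_)
  open SetoidReasoning setoid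

  infix 4 _≟_ _≉0

  _≟_ : ∀ x y → Dec (x ≈ y)
  x ≟ y = em ℓ

  stable : ∀ {p} {P : Set p} → ¬ ¬ P → P
  stable {p} {P} ¬¬p with em p {P}
  ... | yes q = q
  ... | no ¬q = ⊥-elim (¬¬p ¬q)

  counterexample : ∀ {a p} {A : Set a} {P : A → Set p} → ¬ (∀ x → P x) → ∃[ x ] ¬ P x
  counterexample ¬∀ = stable λ ¬∃ → ¬∀ λ x → stable λ ¬p → ¬∃ (x , ¬p)

  _≉0 : Carrier → Set ℓ
  x ≉0 = ¬ x ≈ 0#

  1≉0 : 1# ≉0
  1≉0 = 0≉1 ∘ sym

  _⁻¹[_] : ∀ x → x ≉0 → Carrier
  x ⁻¹[ x≉0 ] = proj₁ (inverse x x≉0)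

  inverseˡ : ∀ {x} (x≉0 : x ≉0) → x ⁻¹[ x≉0 ] * x ≈ 1#
  inverseˡ x≉0 = trans (*-comm _ _) (proj₂ (inverse _ x≉0))

  *-cancel-0ˡ : ∀ {x y} → x ≉0 → x * y ≈ 0# → y ≈ 0#
  *-cancel-0ˡ {x} {y} x≉0 xy≈0 = begin
    y                      ≈⟨ *-identityˡ y ⟨
    1# * y                 ≈⟨ *-congʳ (inverseˡ x≉0) ⟨
    (x ⁻¹[ x≉0 ] * x) * y  ≈⟨ *-assoc _ _ _ ⟩
    x ⁻¹[ x≉0 ] * (x * y)  ≈⟨ *-congˡ xy≈0 ⟩
    x ⁻¹[ x≉0 ] * 0#       ≈⟨ zeroʳ _ ⟩
    0#                     ∎

  x-y≈0⇒x≈y : ∀ {x y} → x - y ≈ 0# → x ≈ y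
  x-y≈0⇒x≈y {x} {y} p = begin
    x            ≈⟨ solve 2 (λ x y → x := (x :- y) :+ y) refl x y ⟩
    (x - y) + y  ≈⟨ +-congʳ p ⟩
    0# + y       ≈⟨ +-identityˡ y ⟩
    y            ∎

  x≈y⇒x-y≈0 : ∀ {x y} → x ≈ y → x - y ≈ 0#
  x≈y⇒x-y≈0 {x} {y} p = trans (+-congʳ p) (-‿inverseʳ y)

-- Linear algebra over subfields: systems, bases, degrees, the tower law.

module LinearAlgebra (em : Classical) {c ℓ : Level} (Ω : Field c ℓ) where
  open Field Ω hiding (zero)
  open ClassicalField em Ω
  open SemiringSum semiring
  open SetoidReasoning setoid

  sum-linear : ∀ {n} a (f g : Vector Carrier n) → sum (λ i → f i + a * g i) ≈ sum f + a * sum g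
  sum-linear a f g = trans (∑-distrib-+ f (λ i → a * g i)) (+-congˡ (sym (*-distribˡ-sum a g)))

  sum-≈0 : ∀ {n} {f : Vector Carrier n} → (∀ i → f i ≈ 0#) → sum f ≈ 0#
  sum-≈0 {n} f≈0 = trans (sum-cong-≋ f≈0) (sum-replicate-zero n)

  -- Associativity of row vector times matrix times column vector.
  sum-assoc : ∀ {m n} (a : Vector Carrier m) (A : Fin m → Fin n → Carrier) (v : Vector Carrier n) →
              sum (λ i → a i * sum (λ j → A i j * v j)) ≈ sum (λ j → sum (λ i → a i * A i j) * v j)
  sum-assoc {m} {n} a A v = begin
    sum (λ i → a i * sum (λ j → A i j * v j))
      ≈⟨ sum-cong-≋ {m} (λ i → trans (*-distribˡ-sum (a i) (λ j → A i j * v j)) (sum-cong-≋ {n} λ j → sym (*-assoc (a i) (A i j) (v j)))) ⟩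
    sum (λ i → sum (λ j → (a i * A i j) * v j))
      ≈⟨ ∑-comm (λ i j → (a i * A i j) * v j) ⟩
    sum (λ j → sum (λ i → (a i * A i j) * v j))
      ≈⟨ sum-cong-≋ (λ j → *-distribʳ-sum (v j) (λ i → a i * A i j)) ⟨
    sum (λ j → sum (λ i → a i * A i j) * v j) ∎

  sum-++ : ∀ m {n} (f : Vector Carrier (m ℕ.+ n)) → sum f ≈ sum (f ∘ (_↑ˡ n)) + sum (f ∘ (m ↑ʳ_))
  sum-++ zero    f = sym (+-identityˡ _)
  sum-++ (suc m) f = trans (+-congˡ (sum-++ m (f ∘ suc))) (sym (+-assoc _ _ _))

  sum-combine : ∀ m {n} (f : Vector Carrier (m ℕ.* n)) → sum f ≈ sum {m} (λ i → sum {n} (λ j → f (combine i j)))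
  sum-combine zero        f = refl
  sum-combine (suc m) {n} f = trans (sum-++ n f) (+-congˡ (sum-combine m (f ∘ (n ↑ʳ_))))

  module _ (F : Subfield Ω) where
    open Subfield F

    sub-closed : ∀ {x y} → x ∈ F → y ∈ F → x - y ∈ F
    sub-closed x∈ y∈ = +-closed x∈ (neg-closed y∈)

    ⁻¹-closed : ∀ {x} (x≉0 : x ≉0) → x ∈ F → x ⁻¹[ x≉0 ] ∈ F
    ⁻¹-closed x≉0 x∈ = inv-closed (proj₂ (inverse _ x≉0)) x∈

    sum-closed : ∀ {n} {f : Vector Carrier n} → (∀ i → f i ∈ F) → sum f ∈ F
    sum-closed {zero}  f∈ = 0∈
    sum-closed {suc n} f∈ = +-closed (f∈ zero) (sum-closed (f∈ ∘ suc))

    Span : ∀ {n} → Vector Carrier n → Carrier → Set (c ⊔ ℓ)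
    Span {n} v x = Σ (Vector Carrier n) λ k → (∀ i → k i ∈ F) × x ≈ sum (λ i → k i * v i)

    Independent : ∀ {n} → Vector Carrier n → Set (c ⊔ ℓ)
    Independent {n} v = ∀ (k : Vector Carrier n) → (∀ i → k i ∈ F) → sum (λ i → k i * v i) ≈ 0# →
                        ∀ i → k i ≈ 0#

    Dependent : ∀ {n} → Vector Carrier n → Set (c ⊔ ℓ)
    Dependent {n} v = Σ (Vector Carrier n) λ k → (∀ i → k i ∈ F) × (∃[ i ] k i ≉0) × sum (λ i → k i * v i) ≈ 0#

    independent⇒¬dependent : ∀ {n} {v : Vector Carrier n} → Independent v → ¬ Dependent v
    independent⇒¬dependent ind (k , k∈ , (i , ki≉0) , eq) = ki≉0 (ind k k∈ eq i)

    ¬dependent⇒independent : ∀ {n} {v : Vector Carrier n} → ¬ Dependent v → Independent v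
    ¬dependent⇒independent ¬dep k k∈ eq i = stable λ ki≉0 → ¬dep (k , k∈ , (i , ki≉0) , eq)

    -- Gaussian elimination. A pivot in the first column clears that column from the other rows and
    -- leaves one equation and one unknown fewer, so `n < m` is preserved.
    homogeneous-solution : ∀ n {m} (A : Fin n → Fin m → Carrier) → (∀ i j → A i j ∈ F) → n ℕ.< m →
      Σ (Vector Carrier m) λ k → (∀ j → k j ∈ F) × (∃[ j ] k j ≉0) ×
      (∀ i → sum (λ j → A i j * k j) ≈ 0#)
    -- There are no equations, so any nonzero vector will do.
    homogeneous-solution zero    {suc m} A A∈ _ = (λ _ → 1#) , (λ _ → 1∈) , (zero , 1≉0) , λ ()
    homogeneous-solution (suc n) {suc m} A A∈ (s≤s n<m) with em ℓ {∃[ i ] A i zero ≉0}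
    -- The first column vanishes, so the first unit vector is a solution.
    ... | no ¬∃ = (1# ∷ᵛ λ _ → 0#) , (λ { zero → 1∈ ; (suc j) → 0∈ }) , (zero , 1≉0) ,
      λ i → trans (+-cong (trans (*-identityʳ _) (stable λ ≉0 → ¬∃ (i , ≉0))) (sum-≈0 λ j → zeroʳ (A i (suc j)))) (+-identityʳ 0#)
    ... | yes (p , Ap≉0) = k , k∈ , (suc (proj₁ k′≉0) , proj₂ k′≉0) , solves
      where
      b = A p zero ⁻¹[ Ap≉0 ]
      b∈ = ⁻¹-closed Ap≉0 (A∈ p zero)
      A′ : Fin n → Fin m → Carrier
      A′ i j = A (punchIn p i) (suc j) + - (A (punchIn p i) zero * b) * A p (suc j)
      A′∈ : ∀ i j → A′ i j ∈ F
      A′∈ i j = +-closed (A∈ _ _) (*-closed (neg-closed (*-closed (A∈ _ _) b∈)) (A∈ _ _))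
      rec = homogeneous-solution n A′ A′∈ n<m
      k′ = proj₁ rec
      k′∈ = proj₁ (proj₂ rec)
      k′≉0 = proj₁ (proj₂ (proj₂ rec))
      S : Fin (suc n) → Carrier
      S i = sum (λ j → A i (suc j) * k′ j)
      k : Vector Carrier (suc m)
      -- Back substitution: this head makes the pivot row `p` vanish.
      k = - (b * S p) ∷ᵛ k′
      k∈ : ∀ j → k j ∈ F
      k∈ zero    = neg-closed (*-closed b∈ (sum-closed λ j → *-closed (A∈ p (suc j)) (k′∈ j)))
      k∈ (suc j) = k′∈ j
      eliminated : ∀ i → S (punchIn p i) + - (A (punchIn p i) zero * b) * S p ≈ 0#
      eliminated i = begin
        S (punchIn p i) + a * S p
          ≈⟨ sum-linear a (λ j → A (punchIn p i) (suc j) * k′ j) (λ j → A p (suc j) * k′ j) ⟨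
        sum (λ j → A (punchIn p i) (suc j) * k′ j + a * (A p (suc j) * k′ j))
          ≈⟨ sum-cong-≋ (λ j → solve 4 (λ x a y z → x :* z :+ a :* (y :* z) := (x :+ a :* y) :* z) refl
               (A (punchIn p i) (suc j)) a (A p (suc j)) (k′ j)) ⟩
        sum (λ j → A′ i j * k′ j) ≈⟨ proj₂ (proj₂ (proj₂ rec)) i ⟩
        0# ∎
        where a = - (A (punchIn p i) zero * b)
      solves : ∀ i → A i zero * - (b * S p) + S i ≈ 0#
      solves i with p Fin.≟ i
      ... | yes ≡.refl = begin
        A p zero * - (b * S p) + S p ≈⟨ solve 3 (λ a b s → a :* (:- (b :* s)) :+ s := (:- (b :* a)) :* s :+ s) refl (A p zero) b (S p) ⟩
        - (b * A p zero) * S p + S p ≈⟨ +-congʳ (*-congʳ (-‿cong (inverseˡ Ap≉0))) ⟩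
        - 1# * S p + S p             ≈⟨ solve 1 (λ s → (:- con (+ 1)) :* s :+ s := con (+ 0)) refl (S p) ⟩
        0#                           ∎
      ... | no p≢i = ≡.subst (λ i → A i zero * - (b * S p) + S i ≈ 0#) (Fin.punchIn-punchOut p≢i)
        (trans (solve 4 (λ a b s t → a :* (:- (b :* s)) :+ t := t :+ (:- (a :* b)) :* s) refl _ b (S p) _)
               (eliminated (punchOut p≢i)))

    -- The coordinates of the `w j` form an n × m matrix with fewer rows than columns; a nonzero
    -- vector of its kernel is the relation.
    exchange : ∀ {n m} (v : Vector Carrier n) (w : Vector Carrier m) → (∀ j → Span v (w j)) → n ℕ.< m → Dependent w
    exchange {n} v w w∈ n<m with homogeneous-solution n (λ i j → proj₁ (w∈ j) i) (λ i j → proj₁ (proj₂ (w∈ j)) i) n<m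
    ... | k , k∈ , k≉0 , eqs = k , k∈ , k≉0 , (begin
      sum (λ j → k j * w j)
        ≈⟨ sum-cong-≋ (λ j → *-congˡ (proj₂ (proj₂ (w∈ j)))) ⟩
      sum (λ j → k j * sum (λ i → proj₁ (w∈ j) i * v i))
        ≈⟨ sum-assoc k (λ j → proj₁ (w∈ j)) v ⟩
      sum (λ i → sum (λ j → k j * proj₁ (w∈ j) i) * v i)
        ≈⟨ sum-≈0 (λ i → trans (*-congʳ (trans (sum-cong-≋ λ j → *-comm (k j) _) (eqs i))) (zeroˡ (v i))) ⟩
      0# ∎)

    independent≤spanning : ∀ {n m} (v : Vector Carrier n) (w : Vector Carrier m) →
                           Independent w → (∀ j → Span v (w j)) → m ℕ.≤ n
    independent≤spanning v w ind w∈ = ℕ.≮⇒≥ λ n<m → independent⇒¬dependent {v = w} ind (exchange v w w∈ n<m)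

    -- The coefficient of `x` cannot vanish, as a relation among the `v i` alone would remain; so
    -- the relation can be solved for `x`.
    dependent-∷ᵛ⇒span : ∀ {n x} {v : Vector Carrier n} → Independent v → Dependent (x ∷ᵛ v) → Span v x
    dependent-∷ᵛ⇒span {n} {x} {v} ind (k , k∈ , (i , ki≉0) , eq) with k zero ≟ 0#
    ... | yes k₀≈0 = contradiction (all0 i) ki≉0
      where
      rest : sum (λ i → k (suc i) * v i) ≈ 0#
      rest = trans (sym (trans (+-congʳ (trans (*-congʳ k₀≈0) (zeroˡ x))) (+-identityˡ _))) eq
      all0 : ∀ i → k i ≈ 0#
      all0 zero    = k₀≈0
      all0 (suc i) = ind (k ∘ suc) (k∈ ∘ suc) rest i
    ... | no k₀≉0 = (λ i → - b * k (suc i)) , (λ i → *-closed (neg-closed (⁻¹-closed k₀≉0 (k∈ zero))) (k∈ (suc i))) , (begin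
      x                                  ≈⟨ *-identityˡ x ⟨
      1# * x                             ≈⟨ *-congʳ (inverseˡ k₀≉0) ⟨
      (b * k zero) * x                   ≈⟨ solve 4 (λ b k x t → b :* k :* x := b :* (k :* x :+ t) :+ (:- b) :* t) refl b (k zero) x t ⟩
      b * (k zero * x + t) + - b * t     ≈⟨ +-congʳ (*-congˡ eq) ⟩
      b * 0# + - b * t                   ≈⟨ trans (+-congʳ (zeroʳ b)) (+-identityˡ _) ⟩
      - b * t                            ≈⟨ *-distribˡ-sum (- b) (λ i → k (suc i) * v i) ⟩
      sum (λ i → - b * (k (suc i) * v i)) ≈⟨ sum-cong-≋ (λ i → sym (*-assoc (- b) (k (suc i)) (v i))) ⟩
      sum (λ i → - b * k (suc i) * v i)  ∎)
      where
      b = k zero ⁻¹[ k₀≉0 ]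
      t = sum (λ i → k (suc i) * v i)

    span-+ : ∀ {n x y} {v : Vector Carrier n} → Span v x → Span v y → Span v (x + y)
    span-+ {v = v} (k , k∈ , p) (h , h∈ , q) = (λ i → k i + h i) , (λ i → +-closed (k∈ i) (h∈ i)) ,
      trans (+-cong p q) (trans (sym (∑-distrib-+ (λ i → k i * v i) (λ i → h i * v i))) (sum-cong-≋ λ i → sym (distribʳ (v i) (k i) (h i))))

    span-* : ∀ {n a x} {v : Vector Carrier n} → a ∈ F → Span v x → Span v (a * x)
    span-* {a = a} {v = v} a∈ (k , k∈ , p) = (λ i → a * k i) , (λ i → *-closed a∈ (k∈ i)) ,
      trans (*-congˡ p) (trans (*-distribˡ-sum a (λ i → k i * v i)) (sum-cong-≋ λ i → sym (*-assoc a (k i) (v i))))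

  module _ {F E : Subfield Ω} where
    open IsBasis

    -- A basis is grown greedily by any vector not yet spanned. The number `g` counts the steps
    -- left; when it reaches 0 the family has `suc N` members and contradicts the bound.
    unspanned⇒extend : ∀ N → (∀ (w : Vector Carrier (suc N)) → (∀ i → w i ∈ E) → Dependent F w) →
                       ∀ g {n} (v : Vector Carrier n) → (∀ i → v i ∈ E) → Independent F v → n ℕ.+ g ≡ suc N →
                       ∃ (HasDegree F E)
    unspanned⇒extend N bound zero {n} v v∈ ind n+0≡ with ≡.trans (≡.sym (ℕ.+-identityʳ n)) n+0≡
    ... | ≡.refl = contradiction (bound v v∈) (independent⇒¬dependent F {v = v} ind)
    unspanned⇒extend N bound (suc g) {n} v v∈ ind n+g≡ with em (c ⊔ ℓ) {∃[ x ] x ∈ E × ¬ Span F v x}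
    ... | no ¬∃ = n , v , record { members = v∈ ; independent = ind ; spanning = λ x∈ → stable λ ¬s → ¬∃ (_ , x∈ , ¬s) }
    ... | yes (x , x∈ , ¬s) = unspanned⇒extend N bound g (x ∷ᵛ v)
      (λ { zero → x∈ ; (suc i) → v∈ i })
      (¬dependent⇒independent F {v = x ∷ᵛ v} λ dep → ¬s (dependent-∷ᵛ⇒span F {v = v} ind dep))
      (≡.trans (≡.sym (ℕ.+-suc n g)) n+g≡)

    bounded⇒degree : ∀ N → (∀ (w : Vector Carrier (suc N)) → (∀ i → w i ∈ E) → Dependent F w) → ∃ (HasDegree F E)
    bounded⇒degree N bound = unspanned⇒extend N bound (suc N) {0} (λ ()) (λ ()) (λ _ _ _ ()) ≡.refl

    degree≤spanning : ∀ {m n} → HasDegree F E m → (v : Vector Carrier n) → (∀ {x} → x ∈ E → Span F v x) → m ℕ.≤ n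
    degree≤spanning (u , U) v span = independent≤spanning F v u (independent U) λ j → span (members U j)

    degree-unique : ∀ {m n} → HasDegree F E m → HasDegree F E n → m ≡ n
    degree-unique d@(u , U) d′@(v , V) = ℕ.≤-antisym (degree≤spanning d v (spanning V)) (degree≤spanning d′ u (spanning U))

    -- The empty family does not span 1.
    degree>0 : ∀ {n} → HasDegree F E n → 0 ℕ.< n
    degree>0 {zero}  (v , V) = contradiction (proj₂ (proj₂ (spanning V (Subfield.1∈ E)))) 1≉0
    degree>0 {suc n} _       = s≤s z≤n

    hasDegree-degree : ∃ (HasDegree F E) → HasDegree F E (degree em F E)
    hasDegree-degree = numberOr0-satisfies (em (c ⊔ ℓ))

    degree-≡ : ∀ {n} → HasDegree F E n → degree em F E ≡ n
    degree-≡ d = degree-unique (hasDegree-degree (_ , d)) d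

  module _ {F A B : Subfield Ω} where
    open IsBasis

    span⊆ : ∀ {n} {v : Vector Carrier n} → F ⊆ A → (∀ i → v i ∈ A) → ∀ {x} → Span F v x → x ∈ A
    span⊆ F⊆A v∈ (k , k∈ , eq) = Subfield.resp A (sym eq) (sum-closed A λ i → Subfield.*-closed A (F⊆A (k∈ i)) (v∈ i))

    -- Dimension count: for x in `B`, x and the basis of `A` are m + 1 > n vectors of `B`, hence
    -- dependent, and x falls into the span of that basis.
    degree-≤⇒⊆ : F ⊆ A → A ⊆ B → ∀ {m n} → HasDegree F A m → HasDegree F B n → n ℕ.≤ m → B ⊆ A
    degree-≤⇒⊆ F⊆A A⊆B (u , U) (v , V) n≤m {x} x∈ = span⊆ F⊆A (members U) (dependent-∷ᵛ⇒span F {v = u} (independent U)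
      (exchange F v (x ∷ᵛ u) (λ { zero → spanning V x∈ ; (suc j) → spanning V (A⊆B (members U j)) }) (s≤s n≤m)))

    -- The basis consists of the products u i * v j, with `remQuot` decoding an index into the pair
    -- (i, j). Collecting the terms with the same v j gives coefficients in `A`, so independence is
    -- used first for `v` and then for `u`.
    tower : F ⊆ A → A ⊆ B → ∀ {m n} → HasDegree F A m → HasDegree A B n → HasDegree F B (m ℕ.* n)
    tower F⊆A A⊆B {m} {n} (u , U) (v , V) = w , record { members = λ i → Subfield.*-closed B (A⊆B (members U _)) (members V _) ; spanning = sp ; independent = ind }
      where
      w : Vector Carrier (m ℕ.* n)
      w i = u (proj₁ (remQuot {m} n i)) * v (proj₂ (remQuot {m} n i))

      w-combine : ∀ i j → w (combine i j) ≡ u i * v j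
      w-combine i j = ≡.cong (λ p → u (proj₁ p) * v (proj₂ p)) (Fin.remQuot-combine {m} {n} i j)

      double-sum : ∀ (k : Vector Carrier (m ℕ.* n)) →
                   sum (λ i → k i * w i) ≈ sum {n} (λ j → sum {m} (λ i → k (combine i j) * u i) * v j)
      double-sum k = begin
        sum (λ i → k i * w i)                                     ≈⟨ sum-combine m (λ i → k i * w i) ⟩
        sum {m} (λ i → sum {n} (λ j → k (combine i j) * w (combine i j)))
          ≈⟨ sum-cong-≋ {m} (λ i → sum-cong-≋ {n} λ j → trans (*-congˡ (reflexive (w-combine i j))) (sym (*-assoc _ _ _))) ⟩
        sum {m} (λ i → sum {n} (λ j → (k (combine i j) * u i) * v j)) ≈⟨ ∑-comm {m} {n} (λ i j → (k (combine i j) * u i) * v j) ⟩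
        sum {n} (λ j → sum {m} (λ i → (k (combine i j) * u i) * v j)) ≈⟨ sum-cong-≋ {n} (λ j → *-distribʳ-sum (v j) (λ i → k (combine i j) * u i)) ⟨
        sum {n} (λ j → sum {m} (λ i → k (combine i j) * u i) * v j) ∎

      sp : ∀ {x} → x ∈ B → Span F w x
      sp {x} x∈ = k , (λ i → proj₁ (proj₂ (hs (proj₂ (remQuot {m} n i)))) _) , (begin
        x                                                           ≈⟨ proj₂ (proj₂ V-span) ⟩
        sum {n} (λ j → proj₁ V-span j * v j)                        ≈⟨ sum-cong-≋ {n} (λ j → *-congʳ (trans (proj₂ (proj₂ (hs j)))
                                                                        (sum-cong-≋ {m} λ i → *-congʳ (reflexive (≡.sym (k-combine i j)))))) ⟩
        sum {n} (λ j → sum {m} (λ i → k (combine i j) * u i) * v j) ≈⟨ double-sum k ⟨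
        sum (λ i → k i * w i)                                       ∎)
        where
        V-span = spanning V x∈
        hs : ∀ j → Span F u (proj₁ V-span j)
        hs j = spanning U (proj₁ (proj₂ V-span) j)
        k : Vector Carrier (m ℕ.* n)
        k i = proj₁ (hs (proj₂ (remQuot {m} n i))) (proj₁ (remQuot {m} n i))
        k-combine : ∀ i j → k (combine i j) ≡ proj₁ (hs j) i
        k-combine i j = ≡.cong (λ p → proj₁ (hs (proj₂ p)) (proj₁ p)) (Fin.remQuot-combine {m} {n} i j)

      ind : Independent F w
      ind k k∈ eq i = ≡.subst (λ i → k i ≈ 0#) (Fin.combine-remQuot {m} n i)
        (independent U (λ i → k (combine i _)) (λ i → k∈ _)
          (independent V (λ j → sum {m} (λ i → k (combine i j) * u i))
            (λ j → sum-closed A {m} λ i → Subfield.*-closed A (F⊆A (k∈ _)) (members U i))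
            (trans (sym (double-sum k)) eq) (proj₂ (remQuot {m} n i)))
          (proj₁ (remQuot {m} n i)))

  -- Any n + 1 elements of `E` satisfy a relation over `K`, which is also a relation over `F`. This
  -- is the source of finiteness for every intermediate degree below.
  subextension-degree : ∀ {K F E L : Subfield Ω} {n} → K ⊆ F → E ⊆ L → HasDegree K L n → ∃ (HasDegree F E)
  subextension-degree {K} {n = n} K⊆F E⊆L (v , V) = bounded⇒degree n λ w w∈ →
    let k , k∈ , rest = exchange K v w (λ j → IsBasis.spanning V (E⊆L (w∈ j))) (ℕ.n<1+n n)
    in k , (λ i → K⊆F (k∈ i)) , rest

-- Polynomials over a commutative ring: evaluation, derivative, division.

length-∷ʳ : ∀ {a} {A : Set a} (xs : List A) x → length (xs ∷ʳ x) ≡ suc (length xs)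
length-∷ʳ xs x = ≡.trans (List.length-++ xs) (ℕ.+-comm (length xs) 1)

unsnoc : ∀ {a} {A : Set a} (x : A) xs → ∃[ ys ] ∃[ y ] x ∷ xs ≡ ys ∷ʳ y
unsnoc x []        = [] , x , ≡.refl
unsnoc x (x′ ∷ xs) with unsnoc x′ xs
... | ys , y , eq = x ∷ ys , y , ≡.cong (x ∷_) eq

module PolynomialProperties {c ℓ : Level} (R : CommutativeRing c ℓ) where
  open CommutativeRing R hiding (zero)
  open Polynomials R
  open RingProperties ring
  open Exp semiring using (_^_)
  open Mult semiring using () renaming (_×_ to _×ₙ_)
  open IntegerCoefficients R using (solve; con; _:=_; _:+_; _:*_; _:-_; :-_)
  open SetoidReasoning setoid

  eval-congʳ : ∀ p {x y} → x ≈ y → eval p x ≈ eval p y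
  eval-congʳ []      x≈y = refl
  eval-congʳ (a ∷ p) x≈y = +-congˡ (*-cong x≈y (eval-congʳ p x≈y))

  eval-+ₚ : ∀ p q x → eval (p +ₚ q) x ≈ eval p x + eval q x
  eval-+ₚ []      q       x = sym (+-identityˡ _)
  eval-+ₚ (a ∷ p) []      x = sym (+-identityʳ _)
  eval-+ₚ (a ∷ p) (b ∷ q) x = begin
    (a + b) + x * eval (p +ₚ q) x           ≈⟨ +-congˡ (*-congˡ (eval-+ₚ p q x)) ⟩
    (a + b) + x * (eval p x + eval q x)     ≈⟨ solve 5 (λ a b x p q → (a :+ b) :+ x :* (p :+ q) := (a :+ x :* p) :+ (b :+ x :* q)) refl a b x _ _ ⟩
    (a + x * eval p x) + (b + x * eval q x) ∎

  eval-·ₚ : ∀ a p x → eval (a ·ₚ p) x ≈ a * eval p x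
  eval-·ₚ a []      x = sym (zeroʳ a)
  eval-·ₚ a (b ∷ p) x = trans (+-congˡ (*-congˡ (eval-·ₚ a p x)))
    (solve 4 (λ a b x p → a :* b :+ x :* (a :* p) := a :* (b :+ x :* p)) refl a b x _)

  eval-*ₚ : ∀ p q x → eval (p *ₚ q) x ≈ eval p x * eval q x
  eval-*ₚ []      q x = sym (zeroˡ _)
  eval-*ₚ (a ∷ p) q x = begin
    eval ((a ·ₚ q) +ₚ (0# ∷ p *ₚ q)) x              ≈⟨ eval-+ₚ (a ·ₚ q) _ x ⟩
    eval (a ·ₚ q) x + (0# + x * eval (p *ₚ q) x)    ≈⟨ +-cong (eval-·ₚ a q x) (+-congˡ (*-congˡ (eval-*ₚ p q x))) ⟩
    a * eval q x + (0# + x * (eval p x * eval q x)) ≈⟨ solve 4 (λ a x p q → a :* q :+ (con (+ 0) :+ x :* (p :* q)) := (a :+ x :* p) :* q) refl a x _ _ ⟩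
    (a + x * eval p x) * eval q x                   ∎

  eval-X- : ∀ a x → eval (X- a) x ≈ x - a
  eval-X- a x = solve 2 (λ a x → (:- a) :+ x :* (con (+ 1) :+ x :* con (+ 0)) := x :- a) refl a x

  eval-∷ʳ : ∀ p a x → eval (p ∷ʳ a) x ≈ eval p x + a * x ^ length p
  eval-∷ʳ []      a x = solve 2 (λ a x → a :+ x :* con (+ 0) := con (+ 0) :+ a :* con (+ 1)) refl a x
  eval-∷ʳ (b ∷ p) a x = trans (+-congˡ (*-congˡ (eval-∷ʳ p a x)))
    (solve 5 (λ a b x p xⁿ → b :+ x :* (p :+ a :* xⁿ) := (b :+ x :* p) :+ a :* (x :* xⁿ)) refl a b x _ _)

  coeff-+ₚ : ∀ p q n → coeff (p +ₚ q) n ≈ coeff p n + coeff q n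
  coeff-+ₚ []      q       n       = sym (+-identityˡ _)
  coeff-+ₚ (a ∷ p) []      n       = sym (+-identityʳ _)
  coeff-+ₚ (a ∷ p) (b ∷ q) zero    = refl
  coeff-+ₚ (a ∷ p) (b ∷ q) (suc n) = coeff-+ₚ p q n

  coeff-·ₚ : ∀ a p n → coeff (a ·ₚ p) n ≈ a * coeff p n
  coeff-·ₚ a []      n       = sym (zeroʳ a)
  coeff-·ₚ a (b ∷ p) zero    = refl
  coeff-·ₚ a (b ∷ p) (suc n) = coeff-·ₚ a p n

  coeff-≥ : ∀ p {n} → length p ℕ.≤ n → coeff p n ≡ 0#
  coeff-≥ []      _         = ≡.refl
  coeff-≥ (a ∷ p) (s≤s l≤n) = coeff-≥ p l≤n

  coeff-∷ʳ : ∀ p a → coeff (p ∷ʳ a) (length p) ≡ a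
  coeff-∷ʳ []      a = ≡.refl
  coeff-∷ʳ (b ∷ p) a = coeff-∷ʳ p a

  ≐-zero-eval : ∀ p → p ≐ [] → ∀ x → eval p x ≈ 0#
  ≐-zero-eval []      _   x = refl
  ≐-zero-eval (a ∷ p) p≐0 x = trans (+-cong (p≐0 0) (trans (*-congˡ (≐-zero-eval p (p≐0 ∘ suc) x)) (zeroʳ x))) (+-identityˡ 0#)

  eval-cong : ∀ p q → p ≐ q → ∀ x → eval p x ≈ eval q x
  eval-cong []      q       p≐q x = sym (≐-zero-eval q (sym ∘ p≐q) x)
  eval-cong (a ∷ p) []      p≐q x = ≐-zero-eval (a ∷ p) p≐q x
  eval-cong (a ∷ p) (b ∷ q) p≐q x = +-cong (p≐q 0) (*-congˡ (eval-cong p q (p≐q ∘ suc) x))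

  eval-constant : ∀ p → Constant p → ∀ x → eval p x ≈ coeff p 0
  eval-constant []      _ x = refl
  eval-constant (a ∷ p) k x = trans (+-congˡ (trans (*-congˡ (≐-zero-eval p k x)) (zeroʳ x))) (+-identityʳ a)

  -- The product rule on a + X p gives p + X p′.
  derivative : Poly → Poly
  derivative []      = []
  derivative (a ∷ p) = p +ₚ (0# ∷ derivative p)

  coeff-derivative : ∀ p n → coeff (derivative p) n ≈ suc n ×ₙ coeff p (suc n)
  coeff-derivative []      n       = sym (zeros (suc n))
    where
    zeros : ∀ n → n ×ₙ 0# ≈ 0#
    zeros zero    = refl
    zeros (suc n) = trans (+-identityˡ _) (zeros n)
  coeff-derivative (a ∷ p) zero    = coeff-+ₚ p (0# ∷ derivative p) 0
  coeff-derivative (a ∷ p) (suc n) = trans (coeff-+ₚ p (0# ∷ derivative p) (suc n)) (+-congˡ (coeff-derivative p n))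

  eval-derivative-∷ : ∀ a p x → eval (derivative (a ∷ p)) x ≈ eval p x + x * eval (derivative p) x
  eval-derivative-∷ a p x = trans (eval-+ₚ p (0# ∷ derivative p) x) (+-congˡ (+-identityˡ _))

  eval-derivative-+ₚ : ∀ p q x → eval (derivative (p +ₚ q)) x ≈ eval (derivative p) x + eval (derivative q) x
  eval-derivative-+ₚ []      q       x = sym (+-identityˡ _)
  eval-derivative-+ₚ (a ∷ p) []      x = sym (+-identityʳ _)
  eval-derivative-+ₚ (a ∷ p) (b ∷ q) x = begin
    eval (derivative ((a + b) ∷ p +ₚ q)) x              ≈⟨ eval-derivative-∷ (a + b) (p +ₚ q) x ⟩
    eval (p +ₚ q) x + x * eval (derivative (p +ₚ q)) x  ≈⟨ +-cong (eval-+ₚ p q x) (*-congˡ (eval-derivative-+ₚ p q x)) ⟩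
    (eval p x + eval q x) + x * (p′ + q′)               ≈⟨ solve 5 (λ p q x p′ q′ → (p :+ q) :+ x :* (p′ :+ q′) := (p :+ x :* p′) :+ (q :+ x :* q′)) refl _ _ x p′ q′ ⟩
    (eval p x + x * p′) + (eval q x + x * q′)           ≈⟨ +-cong (eval-derivative-∷ a p x) (eval-derivative-∷ b q x) ⟨
    eval (derivative (a ∷ p)) x + eval (derivative (b ∷ q)) x ∎
    where
    p′ = eval (derivative p) x
    q′ = eval (derivative q) x

  eval-derivative-·ₚ : ∀ a p x → eval (derivative (a ·ₚ p)) x ≈ a * eval (derivative p) x
  eval-derivative-·ₚ a []      x = sym (zeroʳ a)
  eval-derivative-·ₚ a (b ∷ p) x = begin
    eval (derivative ((a * b) ∷ a ·ₚ p)) x             ≈⟨ eval-derivative-∷ (a * b) (a ·ₚ p) x ⟩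
    eval (a ·ₚ p) x + x * eval (derivative (a ·ₚ p)) x ≈⟨ +-cong (eval-·ₚ a p x) (*-congˡ (eval-derivative-·ₚ a p x)) ⟩
    a * eval p x + x * (a * eval (derivative p) x)     ≈⟨ solve 4 (λ a p x p′ → a :* p :+ x :* (a :* p′) := a :* (p :+ x :* p′)) refl a _ x _ ⟩
    a * (eval p x + x * eval (derivative p) x)         ≈⟨ *-congˡ (eval-derivative-∷ b p x) ⟨
    a * eval (derivative (b ∷ p)) x                    ∎

  eval-derivative-*ₚ : ∀ p q x → eval (derivative (p *ₚ q)) x ≈
                       eval (derivative p) x * eval q x + eval p x * eval (derivative q) x
  eval-derivative-*ₚ []      q x = solve 2 (λ q q′ → con (+ 0) := con (+ 0) :* q :+ con (+ 0) :* q′) refl _ _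
  eval-derivative-*ₚ (a ∷ p) q x = begin
    eval (derivative ((a ·ₚ q) +ₚ (0# ∷ p *ₚ q))) x
      ≈⟨ eval-derivative-+ₚ (a ·ₚ q) (0# ∷ p *ₚ q) x ⟩
    eval (derivative (a ·ₚ q)) x + eval (derivative (0# ∷ p *ₚ q)) x
      ≈⟨ +-cong (eval-derivative-·ₚ a q x) (eval-derivative-∷ 0# (p *ₚ q) x) ⟩
    a * q′ + (eval (p *ₚ q) x + x * eval (derivative (p *ₚ q)) x)
      ≈⟨ +-congˡ (+-cong (eval-*ₚ p q x) (*-congˡ (eval-derivative-*ₚ p q x))) ⟩
    a * q′ + (eval p x * eval q x + x * (p′ * eval q x + eval p x * q′))
      ≈⟨ solve 6 (λ a p q p′ q′ x → a :* q′ :+ (p :* q :+ x :* (p′ :* q :+ p :* q′)) := (p :+ x :* p′) :* q :+ (a :+ x :* p) :* q′) refl a _ _ p′ q′ x ⟩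
    (eval p x + x * p′) * eval q x + (a + x * eval p x) * q′
      ≈⟨ +-congʳ (*-congʳ (eval-derivative-∷ a p x)) ⟨
    eval (derivative (a ∷ p)) x * eval q x + eval (a ∷ p) x * q′ ∎
    where
    p′ = eval (derivative p) x
    q′ = eval (derivative q) x

  derivative-cong : ∀ p q → p ≐ q → derivative p ≐ derivative q
  derivative-cong p q p≐q n = trans (coeff-derivative p n) (trans (multiples (suc n) (p≐q (suc n))) (sym (coeff-derivative q n)))
    where
    multiples : ∀ n {x y} → x ≈ y → n ×ₙ x ≈ n ×ₙ y
    multiples zero    x≈y = refl
    multiples (suc n) x≈y = +-cong x≈y (multiples n x≈y)

  -- Pads as well as cuts, so a polynomial of degree below n gets a representative of length exactly
  -- n, the form in which `Minimal` states minimality.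
  truncate : ℕ → Poly → Poly
  truncate zero    _       = []
  truncate (suc n) []      = 0# ∷ truncate n []
  truncate (suc n) (a ∷ p) = a ∷ truncate n p

  length-truncate : ∀ n p → length (truncate n p) ≡ n
  length-truncate zero    _       = ≡.refl
  length-truncate (suc n) []      = ≡.cong suc (length-truncate n [])
  length-truncate (suc n) (a ∷ p) = ≡.cong suc (length-truncate n p)

  truncate-≐ : ∀ n p → (∀ k → n ℕ.≤ k → coeff p k ≈ 0#) → truncate n p ≐ p
  truncate-≐ zero    p       above k       = sym (above k z≤n)
  truncate-≐ (suc n) []      above zero    = refl
  truncate-≐ (suc n) []      above (suc k) = truncate-≐ n [] (λ _ _ → refl) k
  truncate-≐ (suc n) (a ∷ p) above zero    = refl
  truncate-≐ (suc n) (a ∷ p) above (suc k) = truncate-≐ n p (λ j n≤j → above (suc j) (s≤s n≤j)) k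

  -- Inverses are left out so that the notion also applies in Ω × Ω, which is not a field; there the
  -- predicate is the graph of an embedding.
  record IsSubring {s} (S : Pred Carrier s) : Set (c ⊔ ℓ ⊔ s) where
    field
      resp       : ∀ {x y} → x ≈ y → S x → S y
      0∈         : S 0#
      1∈         : S 1#
      +-closed   : ∀ {x y} → S x → S y → S (x + y)
      *-closed   : ∀ {x y} → S x → S y → S (x * y)
      neg-closed : ∀ {x} → S x → S (- x)

  module _ {t} {S : Pred Carrier t} (isSubring : IsSubring S) where
    open IsSubring isSubring

    +ₚ-closed : ∀ {p q} → All S p → All S q → All S (p +ₚ q)
    +ₚ-closed []       q∈       = q∈
    +ₚ-closed (a ∷ p∈) []       = a ∷ p∈
    +ₚ-closed (a ∷ p∈) (b ∷ q∈) = +-closed a b ∷ +ₚ-closed p∈ q∈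

    ·ₚ-closed : ∀ {a p} → S a → All S p → All S (a ·ₚ p)
    ·ₚ-closed a∈ []       = []
    ·ₚ-closed a∈ (b ∷ p∈) = *-closed a∈ b ∷ ·ₚ-closed a∈ p∈

    *ₚ-closed : ∀ {p q} → All S p → All S q → All S (p *ₚ q)
    *ₚ-closed []       q∈ = []
    *ₚ-closed (a ∷ p∈) q∈ = +ₚ-closed (·ₚ-closed a q∈) (0∈ ∷ *ₚ-closed p∈ q∈)

    eval-closed : ∀ {p x} → All S p → S x → S (eval p x)
    eval-closed []       x∈ = 0∈
    eval-closed (a ∷ p∈) x∈ = +-closed a (*-closed x∈ (eval-closed p∈ x∈))

    coeff-closed : ∀ {p} → All S p → ∀ n → S (coeff p n)
    coeff-closed []       n       = 0∈
    coeff-closed (a ∷ p∈) zero    = a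
    coeff-closed (a ∷ p∈) (suc n) = coeff-closed p∈ n

    ^-closed : ∀ {x} → S x → ∀ n → S (x ^ n)
    ^-closed x∈ zero    = 1∈
    ^-closed x∈ (suc n) = *-closed x∈ (^-closed x∈ n)

    truncate-closed : ∀ n {p} → All S p → All S (truncate n p)
    truncate-closed zero    _        = []
    truncate-closed (suc n) []       = 0∈ ∷ truncate-closed n []
    truncate-closed (suc n) (a ∷ p∈) = a ∷ truncate-closed n p∈

    derivative-closed : ∀ {p} → All S p → All S (derivative p)
    derivative-closed []       = []
    derivative-closed (a ∷ p∈) = +ₚ-closed p∈ (0∈ ∷ derivative-closed p∈)

    -- S[x]
    Adjoin : Carrier → Pred Carrier (c ⊔ ℓ ⊔ t)
    Adjoin x z = ∃[ p ] All S p × eval p x ≈ z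

    adjoin-isSubring : ∀ x → IsSubring (Adjoin x)
    adjoin-isSubring x = record
      { resp       = λ { y≈z (p , p∈ , e) → p , p∈ , trans e y≈z }
      ; 0∈         = [] , [] , refl
      ; 1∈         = 1# ∷ [] , 1∈ ∷ [] , trans (+-congˡ (zeroʳ x)) (+-identityʳ 1#)
      ; +-closed   = λ { (p , p∈ , e) (q , q∈ , e′) → p +ₚ q , +ₚ-closed p∈ q∈ , trans (eval-+ₚ p q x) (+-cong e e′) }
      ; *-closed   = λ { (p , p∈ , e) (q , q∈ , e′) → p *ₚ q , *ₚ-closed p∈ q∈ , trans (eval-*ₚ p q x) (*-cong e e′) }
      ; neg-closed = λ { (p , p∈ , e) → (- 1#) ·ₚ p , ·ₚ-closed (neg-closed 1∈) p∈ ,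
                         trans (eval-·ₚ (- 1#) p x) (trans (-1*x≈-x _) (-‿cong e)) }
      }

    adjoin-⊇ : ∀ {x a} → S a → Adjoin x a
    adjoin-⊇ {x} {a} a∈ = a ∷ [] , a∈ ∷ [] , trans (+-congˡ (zeroʳ x)) (+-identityʳ a)

    adjoin-∋ : ∀ x → Adjoin x x
    adjoin-∋ x = 0# ∷ 1# ∷ [] , 0∈ ∷ 1∈ ∷ [] , solve 1 (λ x → con (+ 0) :+ x :* (con (+ 1) :+ x :* con (+ 0)) := x) refl x

    -- The divisor `f ∷ʳ 1#` is monic, so nothing has to be inverted and coefficients stay in any
    -- subring. The remainder is padded to exactly the length of `f`.
    divide : ∀ f → All S f → ∀ g → All S g → ∃[ q ] ∃[ r ] All S q × All S r × length r ≡ length f ×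
             (∀ x → eval g x ≈ eval q x * eval (f ∷ʳ 1#) x + eval r x)
    divide f f∈ [] [] = [] , replicate (length f) 0# , [] , All.replicate⁺ (length f) 0∈ , List.length-replicate (length f) ,
      λ x → sym (trans (+-cong (zeroˡ _) (zeros (length f) x)) (+-identityˡ 0#))
      where
      zeros : ∀ n x → eval (replicate n 0#) x ≈ 0#
      zeros zero    x = refl
      zeros (suc n) x = trans (+-identityˡ _) (trans (*-congˡ (zeros n x)) (zeroʳ x))
    divide f f∈ (a ∷ g) (a∈ ∷ g∈) with divide f f∈ g g∈
    -- The list `a ∷ r` is a + X r, one entry too long for a remainder. Its last entry `b` becomes
    -- the new constant term of the quotient, and b times the divisor is subtracted.
    ... | q , r , q∈ , r∈ , len , eq with unsnoc a r
    ... | r′ , b , a∷r≡ = b ∷ q , r′ +ₚ ((- b) ·ₚ f) , b∈ ∷ q∈ , +ₚ-closed r′∈ (·ₚ-closed (neg-closed b∈) f∈) ,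
                     ≡.trans (length-+ₚ r′ _ (≡.trans len′ (≡.sym (List.length-map _ f)))) len′ , eq′
      where
      a∷r∈ : All S (r′ ∷ʳ b)
      a∷r∈ = ≡.subst (All S) a∷r≡ (a∈ ∷ r∈)
      r′∈ : All S r′
      r′∈ = proj₁ (All.∷ʳ⁻ a∷r∈)
      b∈ : S b
      b∈ = proj₂ (All.∷ʳ⁻ a∷r∈)
      len′ : length r′ ≡ length f
      len′ = ℕ.suc-injective (≡.trans (≡.sym (length-∷ʳ r′ b)) (≡.trans (≡.cong length (≡.sym a∷r≡)) (≡.cong suc len)))
      length-+ₚ : ∀ p q → length p ≡ length q → length (p +ₚ q) ≡ length p
      length-+ₚ []      []      _ = ≡.refl
      length-+ₚ (_ ∷ p) (_ ∷ q) e = ≡.cong suc (length-+ₚ p q (ℕ.suc-injective e))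
      eq′ : ∀ x → a + x * eval g x ≈ (b + x * eval q x) * eval (f ∷ʳ 1#) x + eval (r′ +ₚ ((- b) ·ₚ f)) x
      eq′ x = begin
        a + x * eval g x
          ≈⟨ +-congˡ (*-congˡ (eq x)) ⟩
        a + x * (Q * M + eval r x)
          ≈⟨ solve 5 (λ a x Q M r → a :+ x :* (Q :* M :+ r) := (a :+ x :* r) :+ x :* Q :* M) refl a x Q M (eval r x) ⟩
        eval (a ∷ r) x + x * Q * M
          ≡⟨ ≡.cong (λ p → eval p x + x * Q * M) a∷r≡ ⟩
        eval (r′ ∷ʳ b) x + x * Q * M
          ≈⟨ +-congʳ (trans (eval-∷ʳ r′ b x) (+-congˡ (*-congˡ (reflexive (≡.cong (x ^_) len′))))) ⟩
        (eval r′ x + b * xⁿ) + x * Q * M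
          ≈⟨ solve 7 (λ r b xⁿ x Q M f → (r :+ b :* xⁿ) :+ x :* Q :* M :=
               (x :* Q :* M :+ b :* (f :+ con (+ 1) :* xⁿ)) :+ (r :+ (:- b) :* f)) refl (eval r′ x) b xⁿ x Q M F ⟩
        (x * Q * M + b * (F + 1# * xⁿ)) + (eval r′ x + - b * F)
          ≈⟨ +-cong (+-congˡ (*-congˡ (sym (eval-∷ʳ f 1# x)))) (sym (trans (eval-+ₚ r′ _ x) (+-congˡ (eval-·ₚ (- b) f x)))) ⟩
        (x * Q * M + b * M) + eval (r′ +ₚ ((- b) ·ₚ f)) x
          ≈⟨ +-congʳ (solve 4 (λ x Q M b → x :* Q :* M :+ b :* M := (b :+ x :* Q) :* M) refl x Q M b) ⟩
        (b + x * Q) * M + eval (r′ +ₚ ((- b) ·ₚ f)) x ∎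
        where
        Q = eval q x
        M = eval (f ∷ʳ 1#) x
        F = eval f x
        xⁿ = x ^ length f

-- Polynomials over an algebraically closed field.

AlgebraicallyClosed : ∀ {c ℓ} → Field c ℓ → Set (c ⊔ ℓ)
AlgebraicallyClosed Ω = ∀ p → ¬ Constant p → ∃[ x ] Root p x
  where open Polynomials (Field.commutativeRing Ω)

module ClosedField (em : Classical) {c ℓ : Level} (Ω : Field c ℓ) (closed : AlgebraicallyClosed Ω) where
  open Field Ω hiding (zero)
  open ClassicalField em Ω
  open Polynomials commutativeRing
  open PolynomialProperties commutativeRing
  open SetoidReasoning setoid

  subfield-isSubring : (F : Subfield Ω) → IsSubring (_∈ F)
  subfield-isSubring F = record { Subfield F }

  HasTop : Poly → ℕ → Set ℓ
  HasTop p n = coeff p n ≈ 1# × (∀ m → n ℕ.< m → coeff p m ≈ 0#)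

  X-*-top : ∀ a p n → HasTop p n → HasTop ((X- a) *ₚ p) (suc n)
  X-*-top a p n (top , above) = trans (coeff-X-*-suc n) (trans (+-cong (trans (*-congˡ (above (suc n) (ℕ.n<1+n n))) (zeroʳ _)) top) (+-identityˡ 1#)) ,
    λ { (suc m) (s≤s n<m) → trans (coeff-X-*-suc m) (trans (+-cong (trans (*-congˡ (above (suc m) (ℕ.m<n⇒m<1+n n<m))) (zeroʳ _)) (above m n<m)) (+-identityˡ 0#)) }
    where
    coeff-X-*-suc : ∀ m → coeff ((X- a) *ₚ p) (suc m) ≈ - a * coeff p (suc m) + coeff p m
    coeff-X-*-suc m = begin
      coeff ((- a ·ₚ p) +ₚ (0# ∷ ((1# ·ₚ p) +ₚ (0# ∷ [])))) (suc m)
        ≈⟨ coeff-+ₚ (- a ·ₚ p) _ (suc m) ⟩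
      coeff (- a ·ₚ p) (suc m) + coeff ((1# ·ₚ p) +ₚ (0# ∷ [])) m
        ≈⟨ +-cong (coeff-·ₚ (- a) p (suc m)) (trans (coeff-+ₚ (1# ·ₚ p) _ m) (+-cong (trans (coeff-·ₚ 1# p m) (*-identityˡ _)) (zero-coeff m))) ⟩
      - a * coeff p (suc m) + (coeff p m + 0#)
        ≈⟨ +-congˡ (+-identityʳ _) ⟩
      - a * coeff p (suc m) + coeff p m ∎
      where
      zero-coeff : ∀ m → coeff (0# ∷ []) m ≈ 0#
      zero-coeff zero    = refl
      zero-coeff (suc m) = refl

  ∏X-top : ∀ as → HasTop (∏X- as) (length as)
  ∏X-top []       = refl , λ { (suc m) _ → refl }
  ∏X-top (a ∷ as) = X-*-top a (∏X- as) (length as) (∏X-top as)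

  eval-∏X-∷ : ∀ a as x → eval (∏X- (a ∷ as)) x ≈ (x - a) * eval (∏X- as) x
  eval-∏X-∷ a as x = trans (eval-*ₚ (X- a) (∏X- as) x) (*-congʳ (eval-X- a x))

  eval-∏X-[] : ∀ x → eval (∏X- []) x ≈ 1#
  eval-∏X-[] x = trans (+-congˡ (zeroʳ x)) (+-identityʳ 1#)

  any⇒root-∏X- : ∀ {x as} → Any (x ≈_) as → Root (∏X- as) x
  any⇒root-∏X- {x} {a ∷ as} (here x≈a)  = trans (eval-∏X-∷ a as x) (trans (*-congʳ (x≈y⇒x-y≈0 x≈a)) (zeroˡ _))
  any⇒root-∏X- {x} {a ∷ as} (there any) = trans (eval-∏X-∷ a as x) (trans (*-congˡ (any⇒root-∏X- any)) (zeroʳ _))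

  root-∏X-⇒any : ∀ {x} as → Root (∏X- as) x → Any (x ≈_) as
  root-∏X-⇒any {x} []       root = contradiction (trans (sym (eval-∏X-[] x)) root) 1≉0
  root-∏X-⇒any {x} (a ∷ as) root with x ≟ a
  ... | yes x≈a = here x≈a
  ... | no  x≉a = there (root-∏X-⇒any as (*-cancel-0ˡ (x≉a ∘ x-y≈0⇒x≈y) (trans (sym (eval-∏X-∷ a as x)) root)))

  -- A root of 1 + ∏ (X - z) differs from every z, as in Euclid's proof about primes; so Ω is
  -- infinite.
  fresh : ∀ zs → ∃[ x ] ¬ Any (x ≈_) zs
  -- The empty product would make that polynomial constant.
  fresh []          = 0# , λ ()
  fresh zs@(_ ∷ zs′) = x , λ any → 1≉0 (begin
    1#                                 ≈⟨ +-identityʳ 1# ⟨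
    1# + 0#                            ≈⟨ +-cong (sym (eval-∏X-[] x)) (sym (any⇒root-∏X- any)) ⟩
    eval (∏X- []) x + eval (∏X- zs) x  ≈⟨ eval-+ₚ (∏X- []) (∏X- zs) x ⟨
    eval f x                           ≈⟨ proj₂ root ⟩
    0#                                 ∎)
    where
    f = ∏X- [] +ₚ ∏X- zs
    nonconstant : ¬ Constant f
    nonconstant const = 1≉0 (begin
      1#                            ≈⟨ proj₁ (∏X-top zs) ⟨
      coeff (∏X- zs) (length zs)    ≈⟨ +-identityˡ _ ⟨
      0# + coeff (∏X- zs) (length zs) ≈⟨ coeff-+ₚ (∏X- []) (∏X- zs) (length zs) ⟨
      coeff f (length zs)           ≈⟨ const (length zs′) ⟩
      0#                            ∎)
    root = closed f nonconstant
    x = proj₁ root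

  -- (c ∷ p)(x) - (c ∷ p)(a) = x p(x) - a p(a) = (x - a) · quotient a p (x)
  quotient : Carrier → Poly → Poly
  quotient a []      = []
  quotient a (b ∷ p) = eval (b ∷ p) a ∷ quotient a p

  length-quotient : ∀ a p → length (quotient a p) ≡ length p
  length-quotient a []      = ≡.refl
  length-quotient a (b ∷ p) = ≡.cong suc (length-quotient a p)

  eval-quotient : ∀ a p x → x * eval p x - a * eval p a ≈ (x - a) * eval (quotient a p) x
  eval-quotient a []      x = solve 2 (λ a x → x :* con (+ 0) :- a :* con (+ 0) := (x :- a) :* con (+ 0)) refl a x
  eval-quotient a (b ∷ p) x = begin
    x * (b + x * eval p x) - a * (b + a * eval p a)
      ≈⟨ solve 5 (λ a b x p pₐ → x :* (b :+ x :* p) :- a :* (b :+ a :* pₐ) := (x :- a) :* (b :+ a :* pₐ) :+ x :* (x :* p :- a :* pₐ)) refl a b x _ _ ⟩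
    (x - a) * (b + a * eval p a) + x * (x * eval p x - a * eval p a)
      ≈⟨ +-congˡ (*-congˡ (eval-quotient a p x)) ⟩
    (x - a) * (b + a * eval p a) + x * ((x - a) * eval (quotient a p) x)
      ≈⟨ solve 5 (λ a b x pₐ q → (x :- a) :* (b :+ a :* pₐ) :+ x :* ((x :- a) :* q) := (x :- a) :* ((b :+ a :* pₐ) :+ x :* q)) refl a b x _ _ ⟩
    (x - a) * ((b + a * eval p a) + x * eval (quotient a p) x) ∎

  quotient-≐-[] : ∀ a p → quotient a p ≐ [] → p ≐ []
  quotient-≐-[] a []      _   = λ _ → refl
  quotient-≐-[] a (b ∷ p) q≐0 = λ { zero → b≈0 ; (suc n) → p≐0 n }
    where
    p≐0 : p ≐ []
    p≐0 = quotient-≐-[] a p (q≐0 ∘ suc)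
    b≈0 : b ≈ 0#
    b≈0 = trans (sym (trans (+-congˡ (trans (*-congˡ (≐-zero-eval p p≐0 a)) (zeroʳ a))) (+-identityʳ b))) (q≐0 0)

  -- A fresh point a is a root. The quotient by X - a is shorter and vanishes outside `a ∷ zs`, so
  -- it is zero by induction.
  almost-everywhere-0 : ∀ p zs → (∀ x → ¬ Any (x ≈_) zs → Root p x) → p ≐ []
  almost-everywhere-0 p = by-length (length p) p ≡.refl
    where
    by-length : ∀ n p → length p ≡ n → ∀ zs → (∀ x → ¬ Any (x ≈_) zs → Root p x) → p ≐ []
    by-length zero    []      _   zs roots = λ _ → refl
    by-length (suc n) (b ∷ p) len zs roots = λ { zero → b≈0 ; (suc n) → p≐0 n }
      where
      a = proj₁ (fresh zs)
      root-a = roots a (proj₂ (fresh zs))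
      p≐0 : p ≐ []
      p≐0 = quotient-≐-[] a p (by-length n (quotient a p) (≡.trans (length-quotient a p) (ℕ.suc-injective len)) (a ∷ zs)
        λ x x∉ → *-cancel-0ˡ (λ e → x∉ (here (x-y≈0⇒x≈y e))) (begin
          (x - a) * eval (quotient a p) x                ≈⟨ eval-quotient a p x ⟨
          x * eval p x - a * eval p a                    ≈⟨ solve 3 (λ b u v → u :- v := (b :+ u) :- (b :+ v)) refl b _ _ ⟩
          (b + x * eval p x) - (b + a * eval p a)        ≈⟨ +-cong (roots x (x∉ ∘ there)) (-‿cong root-a) ⟩
          0# - 0#                                        ≈⟨ -‿inverseʳ 0# ⟩
          0#                                             ∎))
      b≈0 : b ≈ 0#
      b≈0 = trans (sym (trans (+-congˡ (trans (*-congˡ (≐-zero-eval p p≐0 a)) (zeroʳ a))) (+-identityʳ b))) root-a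

  coeff-sub : ∀ p q n → coeff (p +ₚ (- 1# ·ₚ q)) n ≈ coeff p n - coeff q n
  coeff-sub p q n = trans (coeff-+ₚ p _ n) (+-congˡ (trans (coeff-·ₚ (- 1#) q n) (-1*x≈-x _)))

  eval-sub : ∀ p q x → eval (p +ₚ (- 1# ·ₚ q)) x ≈ eval p x - eval q x
  eval-sub p q x = trans (eval-+ₚ p _ x) (+-congˡ (trans (eval-·ₚ (- 1#) q x) (-1*x≈-x _)))

  -- Ω is infinite, so polynomial identities can be checked pointwise.
  ≐-ext : ∀ p q → (∀ x → eval p x ≈ eval q x) → p ≐ q
  ≐-ext p q p≗q n = x-y≈0⇒x≈y (trans (sym (coeff-sub p q n))
    (almost-everywhere-0 (p +ₚ (- 1# ·ₚ q)) [] (λ x _ → trans (eval-sub p q x) (x≈y⇒x-y≈0 (p≗q x))) n))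

  factor : ∀ b p a → Root (b ∷ p) a → b ∷ p ≐ (X- a) *ₚ quotient a p
  factor b p a root = ≐-ext (b ∷ p) ((X- a) *ₚ quotient a p) λ x → begin
    b + x * eval p x                                            ≈⟨ solve 3 (λ b u v → b :+ u := (u :- v) :+ (b :+ v)) refl b _ _ ⟩
    (x * eval p x - a * eval p a) + (b + a * eval p a)          ≈⟨ +-cong (eval-quotient a p x) root ⟩
    (x - a) * eval (quotient a p) x + 0#                        ≈⟨ trans (+-identityʳ _) (*-congʳ (sym (eval-X- a x))) ⟩
    eval (X- a) x * eval (quotient a p) x                       ≈⟨ eval-*ₚ (X- a) (quotient a p) x ⟨
    eval ((X- a) *ₚ quotient a p) x                             ∎

  linear-factor : ∀ f a → Root f a → ∃[ g ] f ≐ (X- a) *ₚ g × length g ≡ ℕ.pred (length f)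
  linear-factor []      a root = [] , ≐-ext [] ((X- a) *ₚ []) (λ x → sym (trans (eval-*ₚ (X- a) [] x) (zeroʳ _))) , ≡.refl
  linear-factor (b ∷ p) a root = quotient a p , factor b p a root , length-quotient a p

  split : ∀ f → ∃[ k ] ∃[ as ] f ≐ k ·ₚ ∏X- as
  split f = by-length (length f) f ℕ.≤-refl
    where
    constant-split : ∀ f → Constant f → ∃[ k ] ∃[ as ] f ≐ k ·ₚ ∏X- as
    constant-split f const = coeff f 0 , [] , ≐-ext f (coeff f 0 ·ₚ ∏X- []) λ x →
      trans (eval-constant f const x) (sym (trans (eval-·ₚ _ (∏X- []) x) (trans (*-congˡ (eval-∏X-[] x)) (*-identityʳ _))))

    by-length : ∀ n f → length f ℕ.≤ n → ∃[ k ] ∃[ as ] f ≐ k ·ₚ ∏X- as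
    by-length zero    []      _   = constant-split [] (λ _ → refl)
    by-length (suc n) []      _   = constant-split [] (λ _ → refl)
    by-length (suc n) (b ∷ p) (s≤s len≤) with em ℓ {Constant (b ∷ p)}
    ... | yes const = constant-split (b ∷ p) const
    ... | no ¬const with closed (b ∷ p) ¬const
    ... | a , root with by-length n (quotient a p) (≡.subst (ℕ._≤ n) (≡.sym (length-quotient a p)) len≤)
    ... | k , as , eq = k , a ∷ as , ≐-ext (b ∷ p) (k ·ₚ ∏X- (a ∷ as)) λ x → begin
      eval (b ∷ p) x                                ≈⟨ eval-cong (b ∷ p) ((X- a) *ₚ quotient a p) (factor b p a root) x ⟩
      eval ((X- a) *ₚ quotient a p) x               ≈⟨ eval-*ₚ (X- a) (quotient a p) x ⟩
      eval (X- a) x * eval (quotient a p) x         ≈⟨ *-congˡ (trans (eval-cong (quotient a p) (k ·ₚ ∏X- as) eq x) (eval-·ₚ k (∏X- as) x)) ⟩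
      eval (X- a) x * (k * eval (∏X- as) x)         ≈⟨ solve 3 (λ u k v → u :* (k :* v) := k :* (u :* v)) refl _ k _ ⟩
      k * (eval (X- a) x * eval (∏X- as) x)         ≈⟨ *-congˡ (eval-*ₚ (X- a) (∏X- as) x) ⟨
      k * eval (∏X- (a ∷ as)) x                     ≈⟨ eval-·ₚ k (∏X- (a ∷ as)) x ⟨
      eval (k ·ₚ ∏X- (a ∷ as)) x                    ∎

  split-leading≉0 : ∀ f k as → f ≐ k ·ₚ ∏X- as → ¬ f ≐ [] → k ≉0
  split-leading≉0 f k as eq f≉0 k≈0 = f≉0 λ n → trans (eq n) (trans (coeff-·ₚ k (∏X- as) n) (trans (*-congʳ k≈0) (zeroˡ _)))

  root⇒any : ∀ f k as → f ≐ k ·ₚ ∏X- as → k ≉0 → ∀ {y} → Root f y → Any (y ≈_) as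
  root⇒any f k as eq k≉0 {y} root = root-∏X-⇒any as (*-cancel-0ˡ k≉0
    (trans (sym (eval-·ₚ k (∏X- as) y)) (trans (sym (eval-cong f (k ·ₚ ∏X- as) eq y)) root)))

  -- The nonzero `p` has finitely many roots, and `q` vanishes at every other point.
  *ₚ-cancel-0ˡ : ∀ p q → ¬ p ≐ [] → (∀ x → eval p x * eval q x ≈ 0#) → q ≐ []
  *ₚ-cancel-0ˡ p q p≉0 pq≈0 with split p
  ... | k , as , eq = almost-everywhere-0 q as λ x x∉ →
    *-cancel-0ˡ (λ root → x∉ (root⇒any p k as eq (split-leading≉0 p k as eq p≉0) root)) (pq≈0 x)

  nonconstant⇒≉[] : ∀ {f} → ¬ Constant f → ¬ f ≐ []
  nonconstant⇒≉[] ¬const f≐0 = ¬const (f≐0 ∘ suc)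

  -- Only the constant k needs an argument: it is a coefficient of `f`, the one at index
  -- `length as`.
  splits-in : ∀ {F E : Subfield Ω} {f} → F ⊆ E → f ∈ F [X] → (∀ {y} → Root f y → y ∈ E) → SplitsIn E f
  splits-in {F} {E} {f} F⊆E f∈ roots∈ with split f
  ... | k , as , eq = k , as , Subfield.resp E leading (coeff-closed (subfield-isSubring E) (All.map F⊆E f∈) (length as)) , All.tabulate as∈ , eq
    where
    leading : coeff f (length as) ≈ k
    leading = trans (eq (length as)) (trans (coeff-·ₚ k (∏X- as) (length as)) (trans (*-congˡ (proj₁ (∏X-top as))) (*-identityʳ k)))
    as∈ : ∀ {a} → a ∈ₗ as → a ∈ E
    as∈ {a} a∈ = roots∈ (trans (eval-cong f (k ·ₚ ∏X- as) eq a) (trans (eval-·ₚ k (∏X- as) a)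
      (trans (*-congˡ (any⇒root-∏X- (Any.map reflexive a∈))) (zeroʳ k))))

  splits-in⇒root∈ : ∀ {E : Subfield Ω} {f} → ¬ f ≐ [] → SplitsIn E f → ∀ {y} → Root f y → y ∈ E
  splits-in⇒root∈ {E} {f} f≉0 (k , as , k∈ , as∈ , eq) root = pick as∈ (root⇒any f k as eq (split-leading≉0 f k as eq f≉0) root)
    where
    pick : ∀ {y as} → All (_∈ E) as → Any (y ≈_) as → y ∈ E
    pick (a∈ ∷ _)   (here y≈a)  = Subfield.resp E (sym y≈a) a∈
    pick (_  ∷ as∈) (there any) = pick as∈ any

-- Simple extensions and minimal polynomials.

least : Classical → ∀ {a} {P : ℕ → Set a} → ∃ P → ∃[ n ] P n × (∀ m → m ℕ.< n → ¬ P m)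
least em {a} {P} (n , pn) = <-rec (λ n → P n → ∃[ n ] P n × (∀ m → m ℕ.< n → ¬ P m)) step n pn
  where
  step : ∀ n → (∀ {m} → m ℕ.< n → P m → ∃[ n ] P n × (∀ m → m ℕ.< n → ¬ P m)) →
         P n → ∃[ n ] P n × (∀ m → m ℕ.< n → ¬ P m)
  step n rec pn with em a {∃[ m ] m ℕ.< n × P m}
  ... | yes (m , m<n , pm) = rec m<n pm
  ... | no ¬∃              = n , pn , λ m m<n pm → ¬∃ (m , m<n , pm)

module AlgebraicElements (em : Classical) {c ℓ : Level} (Ω : Field c ℓ) (closed : AlgebraicallyClosed Ω)
                         (K : Subfield Ω) (algebraic : ∀ x → Algebraic K x) where
  open Field Ω hiding (zero)
  open ClassicalField em Ω
  open LinearAlgebra em Ω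
  open ClosedField em Ω closed
  open Polynomials commutativeRing
  open PolynomialProperties commutativeRing
  open Exp semiring using (_^_)
  open SetoidReasoning setoid

  -- Zero constant terms of an algebraic relation are dropped by cancelling u. Once the constant
  -- term a is nonzero, a + u p(u) = 0 shows that -p(u)/a is the inverse.
  invertible-in-K[u] : ∀ {u} → u ≉0 → ∃[ h ] h ∈ K [X] × u * eval h u ≈ 1#
  invertible-in-K[u] {u} u≉0 = let p , p∈ , p≉0 , root = algebraic u in from-relation p p∈ p≉0 root
    where
    from-relation : ∀ p → p ∈ K [X] → ¬ p ≐ [] → Root p u → ∃[ h ] h ∈ K [X] × u * eval h u ≈ 1#
    from-relation []      _         p≉0 _    = ⊥-elim (p≉0 λ _ → refl)
    from-relation (a ∷ p) (a∈ ∷ p∈) p≉0 root with a ≟ 0#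
    ... | yes a≈0 = from-relation p p∈ (λ p≐0 → p≉0 λ { zero → a≈0 ; (suc n) → p≐0 n })
                      (*-cancel-0ˡ u≉0 (trans (sym (trans (+-congʳ a≈0) (+-identityˡ _))) root))
    ... | no a≉0 = (- b) ·ₚ p , ·ₚ-closed (subfield-isSubring K) (Subfield.neg-closed K (⁻¹-closed K a≉0 a∈)) p∈ , (begin
      u * eval ((- b) ·ₚ p) u            ≈⟨ *-congˡ (eval-·ₚ (- b) p u) ⟩
      u * (- b * eval p u)               ≈⟨ solve 4 (λ a b u p → u :* ((:- b) :* p) := b :* a :- b :* (a :+ u :* p)) refl a b u _ ⟩
      b * a - b * (a + u * eval p u)     ≈⟨ +-cong (inverseˡ a≉0) (-‿cong (trans (*-congˡ root) (zeroʳ b))) ⟩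
      1# - 0#                            ≈⟨ trans (+-congˡ -0#≈0#) (+-identityʳ 1#) ⟩
      1#                                 ∎)
      where b = a ⁻¹[ a≉0 ]

  invertible⇒≉0 : ∀ {u w} → u * w ≈ 1# → u ≉0
  invertible⇒≉0 uw≈1 u≈0 = 0≉1 (trans (sym (trans (*-congʳ u≈0) (zeroˡ _))) uw≈1)

  inverse-unique : ∀ {u v w} → u * v ≈ 1# → u * w ≈ 1# → v ≈ w
  inverse-unique {u} {v} {w} uv≈1 uw≈1 = x-y≈0⇒x≈y (*-cancel-0ˡ (invertible⇒≉0 uv≈1) (begin
    u * (v - w)    ≈⟨ solve 3 (λ u v w → u :* (v :- w) := u :* v :- u :* w) refl u v w ⟩
    u * v - u * w  ≈⟨ x≈y⇒x-y≈0 (trans uv≈1 (sym uw≈1)) ⟩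
    0#             ∎))

  -- Inverses are polynomials over `K` in the element itself, since Ω is algebraic over `K`. Hence
  -- F[x] already serves as F(x), and domains and images of embeddings are fields.
  subring⇒subfield : ∀ {S : Carrier → Set (c ⊔ ℓ)} → IsSubring S → (∀ {x} → x ∈ K → S x) → Subfield Ω
  subring⇒subfield {S} isSubring K⊆S = record
    { member     = S
    ; resp       = S.resp
    ; 0∈         = S.0∈
    ; 1∈         = S.1∈
    ; +-closed   = S.+-closed
    ; *-closed   = S.*-closed
    ; neg-closed = S.neg-closed
    ; inv-closed = λ xy≈1 x∈ → let h , h∈ , xh≈1 = invertible-in-K[u] (invertible⇒≉0 xy≈1) in
        S.resp (inverse-unique xh≈1 xy≈1) (eval-closed isSubring (All.map K⊆S h∈) x∈)
    }
    where module S = IsSubring isSubring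

  module OverField (F : Subfield Ω) (K⊆F : K ⊆ F) where
    open Subfield F
    private
      F-subring = subfield-isSubring F

    infix 30 F⟨_⟩
    F⟨_⟩ : Carrier → Subfield Ω
    F⟨ x ⟩ = subring⇒subfield (adjoin-isSubring F-subring x) (adjoin-⊇ F-subring ∘ K⊆F)

    F⊆F⟨_⟩ : ∀ x → F ⊆ F⟨ x ⟩
    F⊆F⟨ x ⟩ = adjoin-⊇ F-subring

    x∈F⟨_⟩ : ∀ x → x ∈ F⟨ x ⟩
    x∈F⟨ x ⟩ = adjoin-∋ F-subring x

    F⟨⟩-least : ∀ {E : Subfield Ω} {x} → F ⊆ E → x ∈ E → F⟨ x ⟩ ⊆ E
    F⟨⟩-least {E} F⊆E x∈ (p , p∈ , e) = Subfield.resp E e (eval-closed (subfield-isSubring E) (All.map F⊆E p∈) x∈)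

    MonicRoot : Carrier → ℕ → Set (c ⊔ ℓ)
    MonicRoot x d = ∃[ f ] f ∈ F [X] × length f ≡ d × Root (f ∷ʳ 1#) x

    -- The top entry is dropped when it is zero and divided out otherwise. Applied below the least
    -- degree of a monic relation, only the first outcome remains.
    zero-or-monicRoot : ∀ {x} n g → length g ≡ n → g ∈ F [X] → Root g x → g ≐ [] ⊎ ∃[ d ] d ℕ.< n × MonicRoot x d
    zero-or-monicRoot {x} zero    []      _   _  _    = inj₁ λ _ → refl
    zero-or-monicRoot {x} (suc n) (a ∷ g) len g∈ root with unsnoc a g
    ... | f , b , a∷g≡ = leading (b ≟ 0#)
      where
      len′ : length f ≡ n
      len′ = ℕ.suc-injective (≡.trans (≡.sym (length-∷ʳ f b)) (≡.trans (≡.cong length (≡.sym a∷g≡)) len))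
      f∷ʳb∈ = ≡.subst (_∈ F [X]) a∷g≡ g∈
      f∈ = proj₁ (All.∷ʳ⁻ f∷ʳb∈)
      b∈ = proj₂ (All.∷ʳ⁻ f∷ʳb∈)
      root′ : eval f x + b * x ^ length f ≈ 0#
      root′ = trans (sym (eval-∷ʳ f b x)) (trans (reflexive (≡.cong (λ p → eval p x) (≡.sym a∷g≡))) root)
      leading : Dec (b ≈ 0#) → a ∷ g ≐ [] ⊎ ∃[ d ] d ℕ.< suc n × MonicRoot x d
      leading (yes b≈0) with zero-or-monicRoot n f len′ f∈ (trans (sym (trans (+-congˡ (trans (*-congʳ b≈0) (zeroˡ _))) (+-identityʳ _))) root′)
      ... | inj₂ (d , d<n , mr) = inj₂ (d , ℕ.m<n⇒m<1+n d<n , mr)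
      ... | inj₁ f≐0 = inj₁ (≡.subst (_≐ []) (≡.sym a∷g≡) (≐-ext (f ∷ʳ b) [] λ y →
        trans (eval-∷ʳ f b y) (trans (+-cong (≐-zero-eval f f≐0 y) (trans (*-congʳ b≈0) (zeroˡ _))) (+-identityˡ 0#))))
      leading (no b≉0) = inj₂ (n , ℕ.n<1+n n , b⁻¹ ·ₚ f , ·ₚ-closed F-subring (⁻¹-closed F b≉0 b∈) f∈ ,
        ≡.trans (List.length-map _ f) len′ , (begin
          eval ((b⁻¹ ·ₚ f) ∷ʳ 1#) x                       ≈⟨ eval-∷ʳ (b⁻¹ ·ₚ f) 1# x ⟩
          eval (b⁻¹ ·ₚ f) x + 1# * x ^ length (b⁻¹ ·ₚ f)  ≈⟨ +-cong (eval-·ₚ b⁻¹ f x) (*-cong (sym (inverseˡ b≉0)) (reflexive (≡.cong (x ^_) (List.length-map _ f)))) ⟩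
          b⁻¹ * eval f x + (b⁻¹ * b) * x ^ length f       ≈⟨ solve 4 (λ b⁻¹ f b xⁿ → b⁻¹ :* f :+ (b⁻¹ :* b) :* xⁿ := b⁻¹ :* (f :+ b :* xⁿ)) refl b⁻¹ _ b _ ⟩
          b⁻¹ * (eval f x + b * x ^ length f)             ≈⟨ trans (*-congˡ root′) (zeroʳ b⁻¹) ⟩
          0#                                              ∎))
        where b⁻¹ = b ⁻¹[ b≉0 ]

    -- f ∷ʳ 1# is the minimal polynomial of x.
    record Minimal (x : Carrier) : Set (c ⊔ ℓ) where
      field
        f       : Poly
        over    : f ∈ F [X]
        root    : Root (f ∷ʳ 1#) x
        minimal : ∀ {g} → g ∈ F [X] → length g ≡ length f → Root g x → g ≐ []

      m : Poly
      m = f ∷ʳ 1#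

      m-over : m ∈ F [X]
      m-over = All.∷ʳ⁺ over 1∈

      m-top : HasTop m (length f)
      m-top = reflexive (coeff-∷ʳ f 1#) , λ n len<n → reflexive (coeff-≥ m (≡.subst (ℕ._≤ n) (≡.sym (length-∷ʳ f 1#)) len<n))

      minimal′ : ∀ {g} → g ∈ F [X] → (∀ k → length f ℕ.≤ k → coeff g k ≈ 0#) → Root g x → g ≐ []
      minimal′ {g} g∈ above g-root k = trans (sym (t≐g k)) (minimal (truncate-closed F-subring (length f) g∈) (length-truncate _ g)
        (trans (eval-cong (truncate (length f) g) g t≐g x) g-root) k)
        where
        t≐g : truncate (length f) g ≐ g
        t≐g = truncate-≐ (length f) g above

      m-divides : ∀ {g} → g ∈ F [X] → Root g x → ∃[ q ] q ∈ F [X] × (∀ y → eval g y ≈ eval q y * eval m y)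
      m-divides {g} g∈ g-root with divide F-subring f over g g∈
      ... | q , r , q∈ , r∈ , len , eq = q , q∈ , λ y → trans (eq y) (trans (+-congˡ (≐-zero-eval r r≐0 y)) (+-identityʳ _))
        where
        r≐0 : r ≐ []
        r≐0 = minimal r∈ len (begin
          eval r x                               ≈⟨ +-identityˡ _ ⟨
          0# + eval r x                          ≈⟨ +-congʳ (trans (*-congˡ root) (zeroʳ _)) ⟨
          eval q x * eval m x + eval r x         ≈⟨ eq x ⟨
          eval g x                               ≈⟨ g-root ⟩
          0#                                     ∎)

      nonconstant : ¬ Constant m
      nonconstant with f | m-top | root
      ... | []    | _       | root′ = λ _ → 1≉0 (trans (sym (trans (+-congˡ (zeroʳ x)) (+-identityʳ 1#))) root′)
      ... | _ ∷ p | top , _ | _     = λ const → 1≉0 (trans (sym top) (const (length p)))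

      length>0 : 0 ℕ.< length f
      length>0 with f | nonconstant
      ... | []    | ¬const = contradiction (λ _ → refl) ¬const
      ... | _ ∷ _ | _      = s≤s z≤n

      -- From m = g h and g = q m follows m (1 - q h) = 0, so q h = 1. Then `h` has no root, and
      -- over a closed field it must be constant.
      cofactor-constant : ∀ {g} h → g ∈ F [X] → Root g x → (∀ y → eval m y ≈ eval g y * eval h y) → Constant h
      cofactor-constant {g} h g∈ g-root m≗gh = stable λ ¬const →
        let y , h-root = closed h ¬const in 1≉0 (begin
          1#                                        ≈⟨ trans (+-congˡ -0#≈0#) (+-identityʳ 1#) ⟨
          1# - 0#                                   ≈⟨ +-cong (sym (eval-∏X-[] y)) (-‿cong (sym (trans (*-congˡ h-root) (zeroʳ _)))) ⟩
          eval (∏X- []) y - eval q y * eval h y     ≈⟨ trans (eval-sub (∏X- []) (q *ₚ h) y) (+-congˡ (-‿cong (eval-*ₚ q h y))) ⟨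
          eval (∏X- [] +ₚ (- 1# ·ₚ (q *ₚ h))) y     ≈⟨ ≐-zero-eval (∏X- [] +ₚ (- 1# ·ₚ (q *ₚ h))) 1-qh≐0 y ⟩
          0#                                        ∎)
        where
        q = proj₁ (m-divides g∈ g-root)
        g≗qm = proj₂ (proj₂ (m-divides g∈ g-root))
        1-qh≐0 : (∏X- [] +ₚ (- 1# ·ₚ (q *ₚ h))) ≐ []
        1-qh≐0 = *ₚ-cancel-0ˡ m (∏X- [] +ₚ (- 1# ·ₚ (q *ₚ h))) (nonconstant⇒≉[] {m} nonconstant) λ y → begin
          eval m y * eval (∏X- [] +ₚ (- 1# ·ₚ (q *ₚ h))) y   ≈⟨ *-congˡ (trans (eval-sub (∏X- []) (q *ₚ h) y) (+-cong (eval-∏X-[] y) (-‿cong (eval-*ₚ q h y)))) ⟩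
          eval m y * (1# - eval q y * eval h y)              ≈⟨ solve 3 (λ m q h → m :* (con (+ 1) :- q :* h) := m :- (q :* m) :* h) refl _ _ _ ⟩
          eval m y - (eval q y * eval m y) * eval h y        ≈⟨ x≈y⇒x-y≈0 (trans (m≗gh y) (*-congʳ (g≗qm y))) ⟩
          0#                                                 ∎

      irreducible : Irreducible F m
      irreducible = record { over = m-over ; nonconstant = nonconstant ; no-factors = λ g h g∈ h∈ m≐gh → factors g h g∈ h∈
        (λ y → trans (eval-cong m (g *ₚ h) m≐gh y) (eval-*ₚ g h y)) (eval g x ≟ 0#) }
        where
        factors : ∀ g h → g ∈ F [X] → h ∈ F [X] → (∀ y → eval m y ≈ eval g y * eval h y) → Dec (Root g x) → Constant g ⊎ Constant h
        factors g h g∈ h∈ m≗gh (yes g-root) = inj₂ (cofactor-constant h g∈ g-root m≗gh)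
        factors g h g∈ h∈ m≗gh (no ¬g-root) = inj₁ (cofactor-constant g h∈ (*-cancel-0ˡ ¬g-root (trans (sym (m≗gh x)) root)) λ y → trans (m≗gh y) (*-comm _ _))

      isMinimalPolynomial : IsMinimalPolynomial F x m
      isMinimalPolynomial = record { irreducible = irreducible ; monic = length f , m-top ; root = root }

    minimal-polynomial : ∀ x → Minimal x
    minimal-polynomial x with algebraic x
    ... | p , p∈ , p≉0 , p-root with zero-or-monicRoot (length p) p ≡.refl (All.map K⊆F p∈) p-root
    ... | inj₁ p≐0 = contradiction p≐0 p≉0
    ... | inj₂ (d , _ , mr) with least em {P = MonicRoot x} (d , mr)
    ... | d′ , (f , f∈ , ≡.refl , f-root) , below = record
      { f = f ; over = f∈ ; root = f-root ; minimal = λ {g} g∈ len g-root → vanishes {g} (zero-or-monicRoot _ _ len g∈ g-root) }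
      where
      vanishes : ∀ {g} → g ≐ [] ⊎ ∃[ d ] d ℕ.< length f × MonicRoot x d → g ≐ []
      vanishes (inj₁ g≐0)            = g≐0
      vanishes (inj₂ (d , d< , mr)) = contradiction mr (below d d<)

    module _ {f x} (irr : Irreducible F f) (f-root : Root f x) where
      private
        module Irr = Irreducible irr
        module Min = Minimal (minimal-polynomial x)

      irreducible-associate : ∃[ k ] k ∈ F × k ≉0 × (∀ y → eval f y ≈ k * eval Min.m y)
      irreducible-associate with Min.m-divides Irr.over f-root
      ... | q , q∈ , f≗qm with Irr.no-factors q Min.m q∈ Min.m-over (≐-ext f (q *ₚ Min.m) λ y → trans (f≗qm y) (sym (eval-*ₚ q Min.m y)))
      ... | inj₂ m-const = contradiction m-const Min.nonconstant
      ... | inj₁ q-const = coeff q 0 , coeff-closed F-subring q∈ 0 , q₀≉0 , λ y → trans (f≗qm y) (*-congʳ (eval-constant q q-const y))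
        where
        q₀≉0 : coeff q 0 ≉0
        q₀≉0 q₀≈0 = Irr.nonconstant (≐-ext f [] (λ y → trans (f≗qm y) (trans (*-congʳ (trans (eval-constant q q-const y) q₀≈0)) (zeroˡ _))) ∘ suc)

      -- The minimal polynomial of `x` divides `g` and is associate to `f`. This is what makes the
      -- assignment x ↦ y respect all relations over `F`.
      conjugate-root : ∀ {y g} → Root f y → g ∈ F [X] → Root g x → Root g y
      conjugate-root {y} y-root g∈ g-root =
        let k , _ , k≉0 , f≗km = irreducible-associate
            q , _ , g≗qm = Min.m-divides g∈ g-root
        in trans (g≗qm y) (trans (*-congˡ (*-cancel-0ˡ k≉0 (trans (sym (f≗km y)) y-root))) (zeroʳ _))

-- Homomorphisms from a subfield into the ambient field.

module FieldHomomorphisms (em : Classical) {c ℓ : Level} (Ω : Field c ℓ) where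
  open Field Ω hiding (zero)
  open ClassicalField em Ω
  open LinearAlgebra em Ω
  open Polynomials commutativeRing
  open PolynomialProperties commutativeRing
  open Exp semiring using (_^_)
  open SemiringSum semiring using (sum)
  open SetoidReasoning setoid

  -- The laws are stated up to ≈ in the argument, so that they apply whatever
  -- the membership proofs are.
  record Hom (E : Subfield Ω) : Set (c ⊔ ℓ) where
    field
      ⟦_⟧    : Element E → Carrier
      ⟦⟧-cong : ∀ x y → proj₁ x ≈ proj₁ y → ⟦ x ⟧ ≈ ⟦ y ⟧
      +-homo : ∀ x y z → proj₁ z ≈ proj₁ x + proj₁ y → ⟦ z ⟧ ≈ ⟦ x ⟧ + ⟦ y ⟧
      *-homo : ∀ x y z → proj₁ z ≈ proj₁ x * proj₁ y → ⟦ z ⟧ ≈ ⟦ x ⟧ * ⟦ y ⟧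
      1-homo : ∀ z → proj₁ z ≈ 1# → ⟦ z ⟧ ≈ 1#

    private
      module E = Subfield E

    0-homo : ∀ z → proj₁ z ≈ 0# → ⟦ z ⟧ ≈ 0#
    0-homo z z≈0 = begin
      ⟦ z ⟧                    ≈⟨ solve 1 (λ z → z := (z :+ z) :- z) refl ⟦ z ⟧ ⟩
      (⟦ z ⟧ + ⟦ z ⟧) - ⟦ z ⟧  ≈⟨ x≈y⇒x-y≈0 (sym (+-homo z z z (trans (sym (+-identityʳ _)) (+-congˡ (sym z≈0))))) ⟩
      0#                       ∎

    sub-homo : ∀ x y z → proj₁ z ≈ proj₁ x - proj₁ y → ⟦ z ⟧ ≈ ⟦ x ⟧ - ⟦ y ⟧
    sub-homo x y z e = begin
      ⟦ z ⟧                    ≈⟨ solve 2 (λ y z → z := (z :+ y) :- y) refl ⟦ y ⟧ ⟦ z ⟧ ⟩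
      (⟦ z ⟧ + ⟦ y ⟧) - ⟦ y ⟧  ≈⟨ +-congʳ (sym (+-homo z y x (sym (trans (+-congʳ e) (solve 2 (λ x y → (x :- y) :+ y := x) refl _ _))))) ⟩
      ⟦ x ⟧ - ⟦ y ⟧            ∎

    injective : ∀ x y → ⟦ x ⟧ ≈ ⟦ y ⟧ → proj₁ x ≈ proj₁ y
    injective x y e = x-y≈0⇒x≈y (stable λ d≉0 →
      let d = proj₁ x - proj₁ y , sub-closed E (proj₂ x) (proj₂ y)
          d⁻¹ = proj₁ d ⁻¹[ d≉0 ] , ⁻¹-closed E d≉0 (proj₂ d)
      in 1≉0 (begin
        1#             ≈⟨ 1-homo (1# , E.1∈) refl ⟨
        ⟦ 1# , E.1∈ ⟧  ≈⟨ *-homo d⁻¹ d (1# , E.1∈) (sym (inverseˡ d≉0)) ⟩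
        ⟦ d⁻¹ ⟧ * ⟦ d ⟧ ≈⟨ *-congˡ (trans (sub-homo x y d refl) (x≈y⇒x-y≈0 e)) ⟩
        ⟦ d⁻¹ ⟧ * 0#   ≈⟨ zeroʳ _ ⟩
        0#             ∎))

    sum-homo : ∀ {n} (f : Fin n → Element E) z → proj₁ z ≈ sum (proj₁ ∘ f) → ⟦ z ⟧ ≈ sum (⟦_⟧ ∘ f)
    sum-homo {zero}  f z e = 0-homo z e
    sum-homo {suc n} f z e = trans (+-homo (f zero) rest z e) (+-congˡ (sum-homo (f ∘ suc) rest refl))
      where
      rest : Element E
      rest = sum (proj₁ ∘ f ∘ suc) , sum-closed E (proj₂ ∘ f ∘ suc)

    ^-homo : ∀ n x z → proj₁ z ≈ proj₁ x ^ n → ⟦ z ⟧ ≈ ⟦ x ⟧ ^ n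
    ^-homo zero    x z e = 1-homo z e
    ^-homo (suc n) x z e = trans (*-homo x rest z e) (*-congˡ (^-homo n x rest refl))
      where
      power-closed : ∀ n → proj₁ x ^ n ∈ E
      power-closed zero    = E.1∈
      power-closed (suc n) = E.*-closed (proj₂ x) (power-closed n)
      rest : Element E
      rest = proj₁ x ^ n , power-closed n

    Fixes : Subfield Ω → Set (c ⊔ ℓ)
    Fixes F = ∀ x → proj₁ x ∈ F → ⟦ x ⟧ ≈ proj₁ x

    eval-homo : ∀ {F} → F ⊆ E → Fixes F → ∀ p → p ∈ F [X] → ∀ x z → proj₁ z ≈ eval p (proj₁ x) → ⟦ z ⟧ ≈ eval p ⟦ x ⟧
    eval-homo F⊆E fixes []      []        x z e = 0-homo z e
    eval-homo {F} F⊆E fixes (a ∷ p) (a∈ ∷ p∈) x z e = begin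
      ⟦ z ⟧                         ≈⟨ +-homo aᴱ xp z e ⟩
      ⟦ aᴱ ⟧ + ⟦ xp ⟧               ≈⟨ +-cong (fixes aᴱ a∈) (*-homo x p[x] xp refl) ⟩
      a + ⟦ x ⟧ * ⟦ p[x] ⟧          ≈⟨ +-congˡ (*-congˡ (eval-homo {F} F⊆E fixes p p∈ x p[x] refl)) ⟩
      a + ⟦ x ⟧ * eval p ⟦ x ⟧      ∎
      where
      eval∈ : ∀ {p} → p ∈ F [X] → eval p (proj₁ x) ∈ E
      eval∈ []        = E.0∈
      eval∈ (a∈ ∷ p∈) = E.+-closed (F⊆E a∈) (E.*-closed (proj₂ x) (eval∈ p∈))
      aᴱ = a , F⊆E a∈
      p[x] = eval p (proj₁ x) , eval∈ p∈
      xp = proj₁ x * eval p (proj₁ x) , E.*-closed (proj₂ x) (eval∈ p∈)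

  open Hom

  restrict : ∀ {E E′ : Subfield Ω} → E′ ⊆ E → Hom E → Hom E′
  restrict E′⊆E h = record
    { ⟦_⟧     = λ x → ⟦ h ⟧ (proj₁ x , E′⊆E (proj₂ x))
    ; ⟦⟧-cong = λ _ _ → ⟦⟧-cong h _ _
    ; +-homo  = λ _ _ _ → +-homo h _ _ _
    ; *-homo  = λ _ _ _ → *-homo h _ _ _
    ; 1-homo  = λ _ → 1-homo h _
    }

  module _ {F E M : Subfield Ω} where
    hom : Isomorphism F E M → Hom E
    hom σ = record
      { ⟦_⟧     = λ x → proj₁ (σ.⟦_⟧ x)
      ; ⟦⟧-cong = λ _ _ → σ.⟦⟧-cong
      ; +-homo  = λ x y z e → trans (σ.⟦⟧-cong e) (σ.+-homo x y)
      ; *-homo  = λ x y z e → trans (σ.⟦⟧-cong e) (σ.*-homo x y)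
      ; 1-homo  = λ z e → trans (σ.⟦⟧-cong e) σ.1#-homo
      }
      where module σ = Isomorphism σ

    isomorphism : (h : Hom E) → (∀ x → ⟦ h ⟧ x ∈ M) → (∀ {y} → y ∈ M → ∃[ x ] ⟦ h ⟧ x ≈ y) → Fixes h F → Isomorphism F E M
    isomorphism h into onto fixes = record
      { ⟦_⟧ = λ x → ⟦ h ⟧ x , into x
      ; isRingIsomorphism = record
        { isRingMonomorphism = record
          { isRingHomomorphism = record
            { isSemiringHomomorphism = record
              { isNearSemiringHomomorphism = record
                { +-isMonoidHomomorphism = record
                  { isMagmaHomomorphism = record
                    { isRelHomomorphism = record { cong = λ {x} {y} → ⟦⟧-cong h x y }
                    ; homo = λ x y → +-homo h x y _ refl
                    }
                  ; ε-homo = 0-homo h _ refl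
                  }
                ; *-homo = λ x y → *-homo h x y _ refl
                }
              ; 1#-homo = 1-homo h _ refl
              }
            ; -‿homo = λ x → trans (sub-homo h (0# , Subfield.0∈ E) x _ (sym (+-identityˡ _)))
                (trans (+-congʳ (0-homo h _ refl)) (+-identityˡ _))
            }
          ; injective = λ {x} {y} → injective h x y
          }
        ; surjective = λ (y , y∈) → let x , hx≈y = onto y∈ in x , λ {z} z≈x → trans (⟦⟧-cong h z x z≈x) hx≈y
        }
      ; fixes = fixes
      }

    preimage : (σ : Isomorphism F E M) → ∀ {y} → y ∈ M → ∃[ x ] ⟦ hom σ ⟧ x ≈ y
    preimage σ y∈ = let x , eq = Isomorphism.surjective σ (_ , y∈) in x , eq refl

  identity-isomorphism : ∀ {F} E → Isomorphism F E E
  identity-isomorphism E = isomorphism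
    (record { ⟦_⟧ = proj₁ ; ⟦⟧-cong = λ _ _ e → e ; +-homo = λ _ _ _ e → e ; *-homo = λ _ _ _ e → e ; 1-homo = λ _ e → e })
    proj₂ (λ y∈ → (_ , y∈) , refl) (λ _ _ → refl)

-- Extension of embeddings and conjugate fields.

module Embeddings (em : Classical) {c ℓ : Level} (Ω : Field c ℓ) (closed : AlgebraicallyClosed Ω)
                  (K : Subfield Ω) (algebraic : ∀ x → Algebraic K x) where
  open Field Ω hiding (zero)
  open ClassicalField em Ω
  open LinearAlgebra em Ω
  open ClosedField em Ω closed
  open AlgebraicElements em Ω closed K algebraic
  open FieldHomomorphisms em Ω
  open Polynomials commutativeRing
  open PolynomialProperties commutativeRing
  open SetoidReasoning setoid

  private
    Ω² = DirectProduct.commutativeRing commutativeRing commutativeRing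
    module P² = Polynomials Ω²
    module PP² = PolynomialProperties Ω²

  eval-proj₁ : ∀ p z → proj₁ (P².eval p z) ≡ eval (map proj₁ p) (proj₁ z)
  eval-proj₁ []      z = ≡.refl
  eval-proj₁ (a ∷ p) z = ≡.cong (λ u → proj₁ a + proj₁ z * u) (eval-proj₁ p z)

  eval-proj₂ : ∀ p z → proj₂ (P².eval p z) ≡ eval (map proj₂ p) (proj₂ z)
  eval-proj₂ []      z = ≡.refl
  eval-proj₂ (a ∷ p) z = ≡.cong (λ u → proj₂ a + proj₂ z * u) (eval-proj₂ p z)

  -- The graph of a K-embedding into Ω of a subfield of Ω.
  record PartialEmbedding : Set (lsuc (c ⊔ ℓ)) where
    field
      Γ            : Carrier × Carrier → Set (c ⊔ ℓ)
      isSubring    : PP².IsSubring Γ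
      diagonal     : ∀ {k} → k ∈ K → Γ (k , k)
      well-defined : ∀ {u v} → Γ (u , v) → u ≈ 0# → v ≈ 0#

    open PP².IsSubring isSubring

    domain : Subfield Ω
    domain = subring⇒subfield {S = λ u → ∃[ v ] Γ (u , v)} (record
      { resp       = λ { u≈u′ (v , γ) → v , resp (u≈u′ , refl) γ }
      ; 0∈         = 0# , 0∈
      ; 1∈         = 1# , 1∈
      ; +-closed   = λ { (v , γ) (v′ , γ′) → v + v′ , +-closed γ γ′ }
      ; *-closed   = λ { (v , γ) (v′ , γ′) → v * v′ , *-closed γ γ′ }
      ; neg-closed = λ { (v , γ) → - v , neg-closed γ }
      }) (λ k∈ → _ , diagonal k∈)

    K⊆domain : K ⊆ domain
    K⊆domain k∈ = _ , diagonal k∈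

    functional : ∀ {u v u′ v′} → Γ (u , v) → Γ (u′ , v′) → u ≈ u′ → v ≈ v′
    functional γ γ′ u≈u′ = x-y≈0⇒x≈y (well-defined (+-closed γ (neg-closed γ′)) (x≈y⇒x-y≈0 u≈u′))

    map-proj₁∈ : ∀ {p} → All Γ p → map proj₁ p ∈ domain [X]
    map-proj₁∈ []       = []
    map-proj₁∈ (γ ∷ γs) = (_ , γ) ∷ map-proj₁∈ γs

    lift : ∀ {p} → p ∈ domain [X] → ∃[ q ] All Γ q × map proj₁ q ≡ p
    lift []             = [] , [] , ≡.refl
    lift ((v , γ) ∷ p∈) = let q , q∈ , eq = lift p∈ in _ ∷ q , γ ∷ q∈ , ≡.cong (_ ∷_) eq

    proj₂-≐-[] : ∀ {p} → All Γ p → map proj₁ p ≐ [] → map proj₂ p ≐ []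
    proj₂-≐-[] []       _   n       = refl
    proj₂-≐-[] (γ ∷ γs) p≐0 zero    = well-defined γ (p≐0 0)
    proj₂-≐-[] (γ ∷ γs) p≐0 (suc n) = proj₂-≐-[] γs (p≐0 ∘ suc) n

    -- The new graph consists of the pairs (p₁(x), p₂(y)), where p₂ is the transported copy of p₁.
    -- It is the graph of a function because every relation of `x` becomes a relation of `y`.
    adjoin : ∀ x y → (∀ p → All Γ p → Root (map proj₁ p) x → Root (map proj₂ p) y) → PartialEmbedding
    adjoin x y roots = record
      { Γ            = PP².Adjoin isSubring (x , y)
      ; isSubring    = PP².adjoin-isSubring isSubring (x , y)
      ; diagonal     = λ k∈ → PP².adjoin-⊇ isSubring (diagonal k∈)
      ; well-defined = λ { {u} {v} (p , p∈ , e₁ , e₂) u≈0 → begin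
          v                             ≈⟨ e₂ ⟨
          proj₂ (P².eval p (x , y))     ≡⟨ eval-proj₂ p (x , y) ⟩
          eval (map proj₂ p) y          ≈⟨ roots p p∈ (trans (reflexive (≡.sym (eval-proj₁ p (x , y)))) (trans e₁ u≈0)) ⟩
          0#                            ∎ }
      }

  open PartialEmbedding

  infix 4 _≤ₑ_
  _≤ₑ_ : PartialEmbedding → PartialEmbedding → Set (c ⊔ ℓ)
  φ ≤ₑ ψ = ∀ {z} → Γ φ z → Γ ψ z

  -- The image of `x` is any root of the transported minimal polynomial of `x` over the domain of φ.
  extend-to : ∀ φ x → ∃[ ψ ] φ ≤ₑ ψ × x ∈ domain ψ
  extend-to φ x = adjoin φ x y roots , PP².adjoin-⊇ (isSubring φ) , y , PP².adjoin-∋ (isSubring φ) (x , y)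
    where
    module Min = OverField.Minimal (OverField.minimal-polynomial (domain φ) (K⊆domain φ) x)
    1² = 1# , 1#
    lifted = lift φ Min.over
    f̃ = proj₁ lifted
    f̃∈ = proj₁ (proj₂ lifted)
    map-f̃ : map proj₁ (f̃ ∷ʳ 1²) ≡ Min.m
    map-f̃ = ≡.trans (List.map-++ proj₁ f̃ (1² ∷ [])) (≡.cong (_∷ʳ 1#) (proj₂ (proj₂ lifted)))
    nonconstant : ∀ g → map proj₁ (g ∷ʳ 1²) ≡ Min.m → ¬ Constant (map proj₂ (g ∷ʳ 1²))
    nonconstant []      eq _     = Min.nonconstant (≡.subst Constant eq λ _ → refl)
    nonconstant (_ ∷ g) _  const = 1≉0 (trans (sym (top g)) (const (length g)))
      where
      top : ∀ g → coeff (map proj₂ (g ∷ʳ 1²)) (length g) ≈ 1#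
      top []      = refl
      top (_ ∷ g) = top g
    y-root = closed (map proj₂ (f̃ ∷ʳ 1²)) (nonconstant f̃ map-f̃)
    y = proj₁ y-root
    roots : ∀ p → All (Γ φ) p → Root (map proj₁ p) x → Root (map proj₂ p) y
    -- Division in Ω × Ω by the minimal polynomial paired with its transport. In the first component
    -- the remainder vanishes at `x`, hence is zero by minimality; its transport in the second
    -- component is then zero too.
    roots p p∈ p-root with PP².divide (isSubring φ) f̃ f̃∈ p p∈
    ... | q , r , q∈ , r∈ , len , eq = begin
      eval (map proj₂ p) y                                                        ≡⟨ eval-proj₂ p (x , y) ⟨
      proj₂ (P².eval p (x , y))                                                   ≈⟨ proj₂ (eq (x , y)) ⟩
      proj₂ (P².eval q (x , y)) * proj₂ (P².eval (f̃ ∷ʳ 1²) (x , y)) + proj₂ (P².eval r (x , y))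
        ≈⟨ +-cong (trans (*-congˡ (trans (reflexive (eval-proj₂ (f̃ ∷ʳ 1²) (x , y))) (proj₂ y-root))) (zeroʳ _)) (reflexive (eval-proj₂ r (x , y))) ⟩
      0# + eval (map proj₂ r) y                                                   ≈⟨ +-identityˡ _ ⟩
      eval (map proj₂ r) y                                                        ≈⟨ ≐-zero-eval (map proj₂ r) (proj₂-≐-[] φ r∈ r₁≐0) y ⟩
      0#                                                                          ∎
      where
      r₁≐0 : map proj₁ r ≐ []
      r₁≐0 = Min.minimal (map-proj₁∈ φ r∈)
        (≡.trans (List.length-map proj₁ r) (≡.trans len (≡.trans (≡.sym (List.length-map proj₁ f̃)) (≡.cong length (proj₂ (proj₂ lifted)))))) (begin
        eval (map proj₁ r) x                                                      ≈⟨ +-identityˡ _ ⟨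
        0# + eval (map proj₁ r) x
          ≈⟨ +-cong (trans (*-congˡ (trans (reflexive (≡.trans (eval-proj₁ (f̃ ∷ʳ 1²) (x , y)) (≡.cong (λ p → eval p x) map-f̃))) Min.root)) (zeroʳ _)) (reflexive (eval-proj₁ r (x , y))) ⟨
        proj₁ (P².eval q (x , y)) * proj₁ (P².eval (f̃ ∷ʳ 1²) (x , y)) + proj₁ (P².eval r (x , y))
          ≈⟨ proj₁ (eq (x , y)) ⟨
        proj₁ (P².eval p (x , y))                                                 ≡⟨ eval-proj₁ p (x , y) ⟩
        eval (map proj₁ p) x                                                      ≈⟨ p-root ⟩
        0#                                                                        ∎)

  -- Finitely many one-element extensions reach all of a finite extension, since a domain containing
  -- a basis contains its span.
  extend-to-all : ∀ {n} φ (b : Vector Carrier n) → ∃[ ψ ] φ ≤ₑ ψ × (∀ i → b i ∈ domain ψ)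
  extend-to-all {zero}  φ b = φ , (λ γ → γ) , λ ()
  extend-to-all {suc n} φ b = χ , (λ {z} γ → proj₁ (proj₂ rest) {z} (φ≤ψ {z} γ)) ,
    λ { zero → proj₁ b₀∈ , proj₁ (proj₂ rest) {b zero , proj₁ b₀∈} (proj₂ b₀∈) ; (suc i) → proj₂ (proj₂ rest) i }
    where
    ψ : PartialEmbedding
    ψ = proj₁ (extend-to φ (b zero))
    φ≤ψ : φ ≤ₑ ψ
    φ≤ψ {z} = proj₁ (proj₂ (extend-to φ (b zero))) {z}
    b₀∈ : b zero ∈ domain ψ
    b₀∈ = proj₂ (proj₂ (extend-to φ (b zero)))
    rest : ∃[ χ ] ψ ≤ₑ χ × (∀ i → b (suc i) ∈ domain χ)
    rest = extend-to-all ψ (b ∘ suc)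
    χ : PartialEmbedding
    χ = proj₁ rest

  diagonal-embedding : PartialEmbedding
  diagonal-embedding = record
    { Γ            = λ { (u , v) → u ∈ K × u ≈ v }
    ; isSubring    = record
      { resp       = λ { (e , e′) (u∈ , u≈v) → resp e u∈ , trans (sym e) (trans u≈v e′) }
      ; 0∈         = 0∈ , refl
      ; 1∈         = 1∈ , refl
      ; +-closed   = λ { (u∈ , e) (u′∈ , e′) → +-closed u∈ u′∈ , +-cong e e′ }
      ; *-closed   = λ { (u∈ , e) (u′∈ , e′) → *-closed u∈ u′∈ , *-cong e e′ }
      ; neg-closed = λ { (u∈ , e) → neg-closed u∈ , -‿cong e }
      }
    ; diagonal     = λ k∈ → k∈ , refl
    ; well-defined = λ { (_ , u≈v) u≈0 → trans (sym u≈v) u≈0 }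
    }
    where open Subfield K

  module _ (φ : PartialEmbedding) {L : Subfield Ω} (L⊆ : L ⊆ domain φ) where
    open PP².IsSubring (isSubring φ)

    embedding : Hom L
    embedding = record
      { ⟦_⟧     = λ x → proj₁ (L⊆ (proj₂ x))
      ; ⟦⟧-cong = λ x y e → functional φ (γ x) (γ y) e
      ; +-homo  = λ x y z e → functional φ (γ z) (+-closed (γ x) (γ y)) e
      ; *-homo  = λ x y z e → functional φ (γ z) (*-closed (γ x) (γ y)) e
      ; 1-homo  = λ z e → functional φ (γ z) 1∈ e
      }
      where
      γ : ∀ x → Γ φ (proj₁ x , proj₁ (L⊆ (proj₂ x)))
      γ x = proj₂ (L⊆ (proj₂ x))

    embedding-graph : ∀ x {v} → Γ φ (proj₁ x , v) → Hom.⟦_⟧ embedding x ≈ v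
    embedding-graph x γ = functional φ (proj₂ (L⊆ (proj₂ x))) γ refl

  module _ {L : Subfield Ω} (K⊆L : K ⊆ L) (h : Hom L) (fixes : Hom.Fixes h K) where
    private
      module h = Hom h
      module L = Subfield L

    image-subfield : Subfield Ω
    image-subfield = subring⇒subfield {S = λ v → ∃[ x ] h.⟦ x ⟧ ≈ v} (record
      { resp       = λ { v≈v′ (x , e) → x , trans e v≈v′ }
      ; 0∈         = (0# , L.0∈) , h.0-homo _ refl
      ; 1∈         = (1# , L.1∈) , h.1-homo _ refl
      ; +-closed   = λ { (x , e) (x′ , e′) → (_ , L.+-closed (proj₂ x) (proj₂ x′)) , trans (h.+-homo x x′ _ refl) (+-cong e e′) }
      ; *-closed   = λ { (x , e) (x′ , e′) → (_ , L.*-closed (proj₂ x) (proj₂ x′)) , trans (h.*-homo x x′ _ refl) (*-cong e e′) }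
      ; neg-closed = λ { (x , e) → (_ , L.neg-closed (proj₂ x)) , trans (h.sub-homo (0# , L.0∈) x _ (sym (+-identityˡ _)))
                         (trans (+-cong (h.0-homo _ refl) (-‿cong e)) (+-identityˡ _)) }
      }) (λ k∈ → (_ , K⊆L k∈) , fixes _ k∈)

    image-isomorphism : Isomorphism K L image-subfield
    image-isomorphism = isomorphism h (λ x → x , refl) (λ y∈ → y∈) fixes

  -- The identity of `K` is extended by x ↦ y, which `conjugate-root` permits, and then along a
  -- basis of `L`; `M` is the image.
  conjugate-isomorphism : ∀ {L n} → K ⊆ L → HasDegree K L n → ∀ {f x y} → Irreducible K f → Root f x → Root f y → (x∈ : x ∈ L) →
                          ∃[ M ] Σ (Isomorphism K L M) λ σ → Hom.⟦_⟧ (hom σ) (x , x∈) ≈ y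
  conjugate-isomorphism {L} K⊆L (b , B) {f} {x} {y} irr x-root y-root x∈ =
    image-subfield K⊆L h fixes , image-isomorphism K⊆L h fixes , embedding-graph ψ {L} L⊆ _ (φ≤ψ (PP².adjoin-∋ (isSubring diagonal-embedding) (x , y)))
    where
    diagonal-≐ : ∀ {p} → All (Γ diagonal-embedding) p → ∀ z → eval (map proj₁ p) z ≈ eval (map proj₂ p) z
    diagonal-≐ []             z = refl
    diagonal-≐ ((_ , e) ∷ p∈) z = +-cong e (*-congˡ (diagonal-≐ p∈ z))

    coefficients∈ : ∀ {p} → All (Γ diagonal-embedding) p → map proj₁ p ∈ K [X]
    coefficients∈ []              = []
    coefficients∈ ((k∈ , _) ∷ p∈) = k∈ ∷ coefficients∈ p∈

    φ = adjoin diagonal-embedding x y λ p p∈ root →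
      trans (sym (diagonal-≐ p∈ y)) (OverField.conjugate-root K (λ k∈ → k∈) irr x-root {g = map proj₁ p} y-root (coefficients∈ p∈) root)

    extended = extend-to-all φ b
    ψ = proj₁ extended
    φ≤ψ = proj₁ (proj₂ extended)

    L⊆ : L ⊆ domain ψ
    L⊆ z∈ = span⊆ {K} {domain ψ} {L} (K⊆domain ψ) (proj₂ (proj₂ extended)) (IsBasis.spanning B z∈)

    h = embedding ψ {L} L⊆

    fixes : Hom.Fixes h K
    fixes z k∈ = embedding-graph ψ {L} L⊆ z (diagonal ψ k∈)

-- Binomial coefficients modulo a prime and the Frobenius map.

absorption : ∀ n k → suc k ℕ.* (suc n C suc k) ≡ suc n ℕ.* (n C k)
absorption zero    zero    = ≡.refl
absorption zero    (suc k) = ≡.trans (≡.cong (suc (suc k) ℕ.*_) (k>n⇒nCk≡0 {1} {suc (suc k)} (s≤s (s≤s z≤n)))) (≡.trans (ℕ.*-zeroʳ (suc (suc k))) (≡.sym (≡.cong (1 ℕ.*_) (k>n⇒nCk≡0 {0} {suc k} (s≤s z≤n)))))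
absorption (suc n) zero    = ≡.trans (ℕ.*-identityˡ _) (≡.trans (nC1≡n (suc (suc n))) (≡.sym (ℕ.*-identityʳ _)))
absorption (suc n) (suc k) = begin
  suc (suc k) ℕ.* (suc (suc n) C suc (suc k))
    ≡⟨ ≡.cong (suc (suc k) ℕ.*_) (nCk+nC[k+1]≡[n+1]C[k+1] (suc n) (suc k)) ⟨
  suc (suc k) ℕ.* (A ℕ.+ (suc n C suc (suc k)))
    ≡⟨ ℕ.*-distribˡ-+ (suc (suc k)) A _ ⟩
  (A ℕ.+ suc k ℕ.* A) ℕ.+ suc (suc k) ℕ.* (suc n C suc (suc k))
    ≡⟨ ≡.cong₂ (λ u v → (A ℕ.+ u) ℕ.+ v) (absorption n k) (absorption n (suc k)) ⟩
  (A ℕ.+ suc n ℕ.* (n C k)) ℕ.+ suc n ℕ.* (n C suc k)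
    ≡⟨ ℕ.+-assoc A _ _ ⟩
  A ℕ.+ (suc n ℕ.* (n C k) ℕ.+ suc n ℕ.* (n C suc k))
    ≡⟨ ≡.cong (A ℕ.+_) (ℕ.*-distribˡ-+ (suc n) (n C k) (n C suc k)) ⟨
  A ℕ.+ suc n ℕ.* ((n C k) ℕ.+ (n C suc k))
    ≡⟨ ≡.cong (λ u → A ℕ.+ suc n ℕ.* u) (nCk+nC[k+1]≡[n+1]C[k+1] n k) ⟩
  suc (suc n) ℕ.* A ∎
  where
  open ≡.≡-Reasoning
  A = suc n C suc k

-- By `absorption` the prime divides the product of k + 1 and the binomial coefficient, and k + 1 is
-- too small to be divisible by it.
prime-∣-C : ∀ {n k} → Prime (suc n) → k ℕ.< n → suc n ∣ (suc n C suc k)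
prime-∣-C {n} {k} pr k<n with euclidsLemma (suc k) (suc n C suc k) pr (divides (n C k) (≡.trans (absorption n k) (ℕ.*-comm (suc n) _)))
... | inj₁ p∣k = contradiction (∣⇒≤ p∣k) (ℕ.<⇒≱ (s≤s k<n))
... | inj₂ p∣C = p∣C

module Frobenius (em : Classical) {c ℓ : Level} (Ω : Field c ℓ) where
  open Field Ω hiding (zero)
  open ClassicalField em Ω
  open Polynomials commutativeRing
  open PolynomialProperties commutativeRing
  open Exp semiring using (_^_; ^-congˡ)
  open CommutativeExp commutativeSemiring using (^-distrib-*)
  open Mult semiring using (×-congʳ; ×-assocˡ; ×-assoc-*; ×1-homo-*; ×-homo-1) renaming (_×_ to _×ₙ_)
  open SemiringSum semiring using (sum; sum-cong-≋; sum-replicate-zero; sum-init-last)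
  open SetoidReasoning setoid

  -- Positive characteristic only: in characteristic zero no p satisfies this.
  Characteristic : ℕ → Set ℓ
  Characteristic p = Prime p × p ×ₙ 1# ≈ 0#

  -- If n = q d is composite, one of the factors already vanishes in the field, and both are smaller
  -- than n.
  prime-characteristic : ∀ n → 0 ℕ.< n → n ×ₙ 1# ≈ 0# → ∃ Characteristic
  prime-characteristic = <-rec (λ n → 0 ℕ.< n → n ×ₙ 1# ≈ 0# → ∃ Characteristic) step
    where
    step : ∀ n → (∀ {m} → m ℕ.< n → 0 ℕ.< m → m ×ₙ 1# ≈ 0# → ∃ Characteristic) → 0 ℕ.< n → n ×ₙ 1# ≈ 0# → ∃ Characteristic
    step 1             rec _ eq = contradiction (trans (sym (×-homo-1 1#)) eq) 1≉0
    step n@(ℕ.2+ _) rec _ eq with prime? n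
    ... | yes pr = n , pr , eq
    ... | no ¬pr with ¬prime⇒composite ¬pr
    ... | record { divisor = d ; divisor-< = d<n ; divisor-∣ = divides q n≡qd } = factor (q ×ₙ 1# ≟ 0#)
      where
      qd≈0 : (q ×ₙ 1#) * (d ×ₙ 1#) ≈ 0#
      qd≈0 = trans (sym (×1-homo-* q d)) (trans (reflexive (≡.cong (_×ₙ 1#) (≡.sym n≡qd))) eq)
      0<q : 0 ℕ.< q
      0<q = ℕ.n≢0⇒n>0 λ { ≡.refl → ℕ.1+n≢0 n≡qd }
      0<d : 0 ℕ.< d
      0<d = ℕ.n≢0⇒n>0 λ { ≡.refl → ℕ.1+n≢0 (≡.trans n≡qd (ℕ.*-zeroʳ q)) }
      d≢1 : ¬ d ≡ 1
      d≢1 = ℕ.nonTrivial⇒≢1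
      q<n : q ℕ.< n
      q<n = ≡.subst (q ℕ.<_) (≡.sym n≡qd) (ℕ.m<m*n q d {{ℕ.>-nonZero 0<q}} (ℕ.≤∧≢⇒< 0<d (d≢1 ∘ ≡.sym)))
      factor : Dec (q ×ₙ 1# ≈ 0#) → ∃ Characteristic
      factor (yes q≈0) = rec q<n 0<q q≈0
      factor (no q≉0)  = rec d<n 0<d (*-cancel-0ˡ q≉0 qd≈0)

  -- The one property of the exponent that is used later. It holds for 1 and for powers of the
  -- characteristic, so both cases are treated alike.
  InjectivePower : ℕ → Set (c ⊔ ℓ)
  InjectivePower q = ∀ u v → u ^ q ≈ v ^ q → u ≈ v

  ^-≈0⇒≈0 : ∀ n {x} → x ^ n ≈ 0# → x ≈ 0#
  ^-≈0⇒≈0 zero        e = contradiction e 1≉0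
  ^-≈0⇒≈0 (suc n) {x} e with x ≟ 0#
  ... | yes x≈0 = x≈0
  ... | no  x≉0 = ^-≈0⇒≈0 n (*-cancel-0ˡ x≉0 e)

  module _ {p} (char : Characteristic p) where
    ∣⇒×≈0 : ∀ {n} z → p ∣ n → n ×ₙ z ≈ 0#
    ∣⇒×≈0 {n} z (divides k n≡kp) = begin
      n ×ₙ z                   ≡⟨ ≡.cong (_×ₙ z) (≡.trans n≡kp (ℕ.*-comm k p)) ⟩
      (p ℕ.* k) ×ₙ z           ≈⟨ ×-assocˡ z p k ⟨
      p ×ₙ (k ×ₙ z)            ≈⟨ ×-congʳ p (*-identityˡ _) ⟨
      p ×ₙ (1# * (k ×ₙ z))     ≈⟨ ×-assoc-* p 1# _ ⟨
      (p ×ₙ 1#) * (k ×ₙ z)     ≈⟨ trans (*-congʳ (proj₂ char)) (zeroˡ _) ⟩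
      0#                       ∎

  frobenius-+ : ∀ {p} → Characteristic p → ∀ x y → (x + y) ^ p ≈ x ^ p + y ^ p
  frobenius-+ {zero}  char x y = contradiction ≡.refl (ℕ.≢-nonZero⁻¹ 0 {{prime⇒nonZero (proj₁ char)}})
  frobenius-+ {suc n} char x y = begin
    (x + y) ^ suc n                             ≈⟨ theorem (suc n) x y ⟩
    term zero + sum (term ∘ suc)                ≈⟨ +-congˡ (sum-init-last (term ∘ suc)) ⟩
    term zero + (sum (λ i → term (suc (inject₁ i))) + term (suc (fromℕ n)))
      ≈⟨ +-cong first (+-cong (trans (sum-cong-≋ middle) (sum-replicate-zero n)) last) ⟩
    y ^ suc n + (0# + x ^ suc n)                ≈⟨ trans (+-congˡ (+-identityˡ _)) (+-comm _ _) ⟩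
    x ^ suc n + y ^ suc n                       ∎
    where
    open Binomial commutativeSemiring
    term = binomialTerm x y (suc n)
    first : term zero ≈ y ^ suc n
    first = trans (+-identityʳ _) (*-identityˡ _)
    last : term (suc (fromℕ n)) ≈ x ^ suc n
    last = begin
      (suc n C suc (toℕ (fromℕ n))) ×ₙ (x ^ suc (toℕ (fromℕ n)) * y ^ (n ℕ.∸ toℕ (fromℕ n)))
        ≡⟨ ≡.cong (λ k → (suc n C suc k) ×ₙ (x ^ suc k * y ^ (n ℕ.∸ k))) (Fin.toℕ-fromℕ n) ⟩
      (suc n C suc n) ×ₙ (x ^ suc n * y ^ (n ℕ.∸ n))
        ≡⟨ ≡.cong₂ (λ u v → u ×ₙ (x ^ suc n * y ^ v)) (nCn≡1 (suc n)) (ℕ.n∸n≡0 n) ⟩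
      1 ×ₙ (x ^ suc n * 1#)                     ≈⟨ trans (×-homo-1 _) (*-identityʳ _) ⟩
      x ^ suc n                                 ∎
    middle : ∀ i → term (suc (inject₁ i)) ≈ 0#
    middle i = ∣⇒×≈0 char _ (prime-∣-C (proj₁ char) (≡.subst (ℕ._< n) (≡.sym (Fin.toℕ-inject₁ i)) (Fin.toℕ<n i)))

  module _ {p} (char : Characteristic p) where
    frobenius-0 : 0# ^ p ≈ 0#
    frobenius-0 = begin
      0# ^ p                         ≈⟨ solve 1 (λ z → z := (z :+ z) :- z) refl _ ⟩
      (0# ^ p + 0# ^ p) - 0# ^ p     ≈⟨ x≈y⇒x-y≈0 (trans (sym (frobenius-+ char 0# 0#)) (^-congˡ p (+-identityˡ 0#))) ⟩
      0#                             ∎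

    frobenius-injective : InjectivePower p
    frobenius-injective u v e = x-y≈0⇒x≈y (^-≈0⇒≈0 p (begin
      (u - v) ^ p                        ≈⟨ solve 2 (λ z w → z := (z :+ w) :- w) refl _ (v ^ p) ⟩
      ((u - v) ^ p + v ^ p) - v ^ p      ≈⟨ +-congʳ (frobenius-+ char (u - v) v) ⟨
      ((u - v) + v) ^ p - v ^ p          ≈⟨ x≈y⇒x-y≈0 (trans (^-congˡ p (solve 2 (λ u v → (u :- v) :+ v := u) refl u v)) e) ⟩
      0#                                 ∎))

    frobenius-sum : ∀ {n} (f : Vector Carrier n) → sum f ^ p ≈ sum (λ i → f i ^ p)
    frobenius-sum {zero}  f = frobenius-0
    frobenius-sum {suc n} f = trans (frobenius-+ char _ _) (+-congˡ (frobenius-sum (f ∘ suc)))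

    frobenius-eval : ∀ h y → eval h y ^ p ≈ eval (map (_^ p) h) (y ^ p)
    frobenius-eval []      y = frobenius-0
    frobenius-eval (a ∷ h) y = trans (frobenius-+ char _ _)
      (+-congˡ (trans (^-distrib-* y _ p) (*-congˡ (frobenius-eval h y))))

  X^_ : ℕ → Poly
  X^ zero  = 1# ∷ []
  X^ suc n = 0# ∷ X^ n

  eval-X^ : ∀ n x → eval (X^ n) x ≈ x ^ n
  eval-X^ zero    x = trans (+-congˡ (zeroʳ x)) (+-identityʳ 1#)
  eval-X^ (suc n) x = trans (+-identityˡ _) (*-congˡ (eval-X^ n x))

  eval-derivative-constant : ∀ a x → eval (derivative (a ∷ [])) x ≈ 0#
  eval-derivative-constant a x = solve 1 (λ x → con (+ 0) :+ x :* con (+ 0) := con (+ 0)) refl x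

  eval-derivative-X^ : ∀ n x → eval (derivative (X^ suc n)) x ≈ suc n ×ₙ (x ^ n)
  eval-derivative-X^ zero    x = begin
    eval (derivative (0# ∷ X^ 0)) x                   ≈⟨ eval-derivative-∷ 0# (X^ 0) x ⟩
    eval (X^ 0) x + x * eval (derivative (X^ 0)) x    ≈⟨ +-cong (eval-X^ 0 x) (trans (*-congˡ (eval-derivative-constant 1# x)) (zeroʳ x)) ⟩
    1# + 0#                                           ∎
  eval-derivative-X^ (suc n) x = begin
    eval (derivative (0# ∷ X^ suc n)) x                      ≈⟨ eval-derivative-∷ 0# (X^ suc n) x ⟩
    eval (X^ suc n) x + x * eval (derivative (X^ suc n)) x   ≈⟨ +-cong (eval-X^ (suc n) x) (*-congˡ (eval-derivative-X^ n x)) ⟩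
    x ^ suc n + x * (suc n ×ₙ (x ^ n))                       ≈⟨ +-congˡ (Mult.×-comm-* semiring (suc n) x (x ^ n)) ⟩
    x ^ suc n + suc n ×ₙ (x ^ suc n)                         ∎

  _[X^_] : Poly → ℕ → Poly
  []      [X^ n ] = []
  (a ∷ h) [X^ n ] = (a ∷ []) +ₚ ((X^ n) *ₚ (h [X^ n ]))

  eval-[X^] : ∀ h n x → eval (h [X^ n ]) x ≈ eval h (x ^ n)
  eval-[X^] []      n x = refl
  eval-[X^] (a ∷ h) n x = trans (eval-+ₚ (a ∷ []) ((X^ n) *ₚ (h [X^ n ])) x)
    (+-cong (trans (+-congˡ (zeroʳ x)) (+-identityʳ a)) (trans (eval-*ₚ (X^ n) (h [X^ n ]) x) (*-cong (eval-X^ n x) (eval-[X^] h n x))))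

  -- Each Horner step multiplies by Xᵖ, whose derivative p Xᵖ⁻¹ is zero.
  eval-derivative-[X^p] : ∀ {p} → Characteristic p → ∀ h x → eval (derivative (h [X^ p ])) x ≈ 0#
  eval-derivative-[X^p] {zero}  char h x = contradiction ≡.refl (ℕ.≢-nonZero⁻¹ 0 {{prime⇒nonZero (proj₁ char)}})
  eval-derivative-[X^p] {suc n} char []      x = refl
  eval-derivative-[X^p] {suc n} char (a ∷ h) x = begin
    eval (derivative ((a ∷ []) +ₚ ((X^ suc n) *ₚ H))) x
      ≈⟨ eval-derivative-+ₚ (a ∷ []) ((X^ suc n) *ₚ H) x ⟩
    eval (derivative (a ∷ [])) x + eval (derivative ((X^ suc n) *ₚ H)) x
      ≈⟨ +-cong (eval-derivative-constant a x) (eval-derivative-*ₚ (X^ suc n) H x) ⟩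
    0# + (eval (derivative (X^ suc n)) x * eval H x + eval (X^ suc n) x * eval (derivative H) x)
      ≈⟨ +-congˡ (+-cong (*-congʳ (trans (eval-derivative-X^ n x) (∣⇒×≈0 char (x ^ n) ℕ.∣-refl))) (*-congˡ (eval-derivative-[X^p] char h x))) ⟩
    0# + (0# * eval H x + eval (X^ suc n) x * 0#)
      ≈⟨ solve 2 (λ u v → con (+ 0) :+ (con (+ 0) :* u :+ v :* con (+ 0)) := con (+ 0)) refl _ _ ⟩
    0# ∎
    where H = h [X^ suc n ]

-- Separable elements in terms of p-th powers.

module Separability (em : Classical) {c ℓ : Level} (Ω : Field c ℓ) (closed : AlgebraicallyClosed Ω)
                    (K : Subfield Ω) (algebraic : ∀ x → Algebraic K x) where
  open Field Ω hiding (zero)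
  open ClassicalField em Ω
  open LinearAlgebra em Ω
  open ClosedField em Ω closed
  open AlgebraicElements em Ω closed K algebraic
  open Frobenius em Ω
  open Polynomials commutativeRing
  open PolynomialProperties commutativeRing
  open Exp semiring using (_^_; ^-congˡ; ^-assocʳ)
  open CommutativeExp commutativeSemiring using (^-distrib-*)
  open Mult semiring using () renaming (_×_ to _×ₙ_)
  open SemiringSum semiring using (sum; sum-cong-≋)
  open SetoidReasoning setoid

  module _ {F : Subfield Ω} {K⊆F : K ⊆ F} {x} (min : OverField.Minimal F K⊆F x) where
    open OverField F K⊆F hiding (Minimal)
    private
      module Min = OverField.Minimal min
      F-subring = subfield-isSubring F

    -- A multiple root a is shared by m and m′. Since a is conjugate to x, also m′(x) = 0, and m′
    -- has degree below that of m.
    multiple-root⇒derivative≐[] : ∀ {a} → (X- a) *ₚ (X- a) ∣ₚ Min.m → derivative Min.m ≐ []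
    multiple-root⇒derivative≐[] {a} (q , m≐) = Min.minimal′ (derivative-closed F-subring Min.m-over) above
      (conjugate-root Min.irreducible m-root Min.root (derivative-closed F-subring Min.m-over) m′-root)
      where
      s² = (X- a) *ₚ (X- a)
      X-a-root : Root (X- a) a
      X-a-root = trans (eval-X- a a) (-‿inverseʳ a)
      s²-root : Root s² a
      s²-root = trans (eval-*ₚ (X- a) (X- a) a) (trans (*-congʳ X-a-root) (zeroˡ _))
      s²′-root : Root (derivative s²) a
      s²′-root = trans (eval-derivative-*ₚ (X- a) (X- a) a) (trans (+-cong (trans (*-congˡ X-a-root) (zeroʳ _)) (trans (*-congʳ X-a-root) (zeroˡ _))) (+-identityˡ 0#))
      m-root : Root Min.m a
      m-root = trans (eval-cong Min.m (s² *ₚ q) m≐ a) (trans (eval-*ₚ s² q a) (trans (*-congʳ s²-root) (zeroˡ _)))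
      m′-root : Root (derivative Min.m) a
      m′-root = begin
        eval (derivative Min.m) a                                             ≈⟨ eval-cong (derivative Min.m) (derivative (s² *ₚ q)) (derivative-cong Min.m (s² *ₚ q) m≐) a ⟩
        eval (derivative (s² *ₚ q)) a                                         ≈⟨ eval-derivative-*ₚ s² q a ⟩
        eval (derivative s²) a * eval q a + eval s² a * eval (derivative q) a ≈⟨ +-cong (trans (*-congʳ s²′-root) (zeroˡ _)) (trans (*-congʳ s²-root) (zeroˡ _)) ⟩
        0# + 0#                                                               ≈⟨ +-identityˡ 0# ⟩
        0#                                                                    ∎
      above : ∀ k → length Min.f ℕ.≤ k → coeff (derivative Min.m) k ≈ 0#
      above k len≤k = trans (coeff-derivative Min.m k) (trans (Mult.×-congʳ semiring (suc k) (proj₂ Min.m-top (suc k) (s≤s len≤k)))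
        (trans (Mult.×-congʳ semiring (suc k) (sym (zeroˡ 0#))) (trans (sym (Mult.×-assoc-* semiring (suc k) 0# 0#)) (zeroʳ _))))

    -- The coefficient of m′ just below the degree of m is that degree times 1, because m is monic.
    derivative≐[]⇒characteristic : derivative Min.m ≐ [] → ∃ Characteristic
    derivative≐[]⇒characteristic m′≐0 = from-length (length Min.f) ≡.refl Min.length>0
      where
      from-length : ∀ n → length Min.f ≡ n → 0 ℕ.< n → ∃ Characteristic
      from-length (suc n) len≡ 0<n = prime-characteristic (suc n) 0<n (begin
        suc n ×ₙ 1#                     ≈⟨ Mult.×-congʳ semiring (suc n) (proj₁ Min.m-top) ⟨
        suc n ×ₙ coeff Min.m (length Min.f) ≡⟨ ≡.cong (λ k → suc n ×ₙ coeff Min.m k) len≡ ⟩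
        suc n ×ₙ coeff Min.m (suc n)    ≈⟨ coeff-derivative Min.m n ⟨
        coeff (derivative Min.m) n      ≈⟨ m′≐0 n ⟩
        0#                              ∎)

    -- If x = h(xᵖ), then the minimal polynomial divides X - h(Xᵖ), whose derivative is 1.
    derivative≐[]⇒x∉F⟨xᵖ⟩ : derivative Min.m ≐ [] → ∀ {p} → Characteristic p → ¬ x ∈ F⟨ x ^ p ⟩
    derivative≐[]⇒x∉F⟨xᵖ⟩ m′≐0 {p} char (h , h∈ , e) = 1≉0 (begin
      1#                                                           ≈⟨ P′≈1 ⟨
      eval (derivative P) x                                        ≈⟨ eval-cong (derivative P) (derivative (q *ₚ Min.m)) (derivative-cong P (q *ₚ Min.m) P≐qm) x ⟩
      eval (derivative (q *ₚ Min.m)) x                             ≈⟨ eval-derivative-*ₚ q Min.m x ⟩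
      eval (derivative q) x * eval Min.m x + eval q x * eval (derivative Min.m) x
        ≈⟨ +-cong (trans (*-congˡ Min.root) (zeroʳ _)) (trans (*-congˡ (≐-zero-eval (derivative Min.m) m′≐0 x)) (zeroʳ _)) ⟩
      0# + 0#                                                      ≈⟨ +-identityˡ 0# ⟩
      0#                                                           ∎)
      where
      open Subfield F
      H = - 1# ·ₚ (h [X^ p ])
      P = (X^ 1) +ₚ H
      X^∈ : ∀ n → X^ n ∈ F [X]
      X^∈ zero    = 1∈ ∷ []
      X^∈ (suc n) = 0∈ ∷ X^∈ n
      [X^p]∈ : ∀ {h} → h ∈ F [X] → h [X^ p ] ∈ F [X]
      [X^p]∈ []        = []
      [X^p]∈ (a∈ ∷ h∈) = +ₚ-closed F-subring (a∈ ∷ []) (*ₚ-closed F-subring (X^∈ p) ([X^p]∈ h∈))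
      P∈ : P ∈ F [X]
      P∈ = +ₚ-closed F-subring (X^∈ 1) (·ₚ-closed F-subring (neg-closed 1∈) ([X^p]∈ h∈))
      P-root : Root P x
      P-root = begin
        eval P x                                ≈⟨ eval-+ₚ (X^ 1) H x ⟩
        eval (X^ 1) x + eval H x                ≈⟨ +-cong (trans (eval-X^ 1 x) (*-identityʳ x)) (trans (eval-·ₚ (- 1#) (h [X^ p ]) x) (-1*x≈-x _)) ⟩
        x - eval (h [X^ p ]) x                  ≈⟨ x≈y⇒x-y≈0 (sym (trans (eval-[X^] h p x) e)) ⟩
        0#                                      ∎
      P′≈1 : eval (derivative P) x ≈ 1#
      P′≈1 = begin
        eval (derivative P) x                                ≈⟨ eval-derivative-+ₚ (X^ 1) H x ⟩
        eval (derivative (X^ 1)) x + eval (derivative H) x   ≈⟨ +-cong (eval-derivative-X^ 0 x) (trans (eval-derivative-·ₚ (- 1#) (h [X^ p ]) x) (trans (*-congˡ (eval-derivative-[X^p] char h x)) (zeroʳ _))) ⟩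
        (1# + 0#) + 0#                                       ≈⟨ trans (+-identityʳ _) (+-identityʳ 1#) ⟩
        1#                                                   ∎
      q = proj₁ (Min.m-divides P∈ P-root)
      P≐qm : P ≐ q *ₚ Min.m
      P≐qm = ≐-ext P (q *ₚ Min.m) λ y → trans (proj₂ (proj₂ (Min.m-divides P∈ P-root)) y) (sym (eval-*ₚ q Min.m y))

  separable-resp : ∀ {F : Subfield Ω} {x y} → x ≈ y → SeparableElement F x → SeparableElement F y
  separable-resp x≈y (f , min , simple) = f , record
    { irreducible = irreducible ; monic = monic ; root = trans (sym (eval-congʳ f x≈y)) root } , simple
    where open IsMinimalPolynomial min

  module _ (F : Subfield Ω) (K⊆F : K ⊆ F) where
    open OverField F K⊆F
    private
      F-subring = subfield-isSubring F

    inseparable⇒characteristic : ∀ {x} → ¬ SeparableElement F x → ∃[ p ] Characteristic p × ¬ x ∈ F⟨ x ^ p ⟩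
    inseparable⇒characteristic {x} ¬sep = proj₁ char , proj₂ char , derivative≐[]⇒x∉F⟨xᵖ⟩ min m′≐0 (proj₂ char)
      where
      min = minimal-polynomial x
      module Min = Minimal min
      multiple : ∃[ a ] ¬ ¬ ((X- a) *ₚ (X- a) ∣ₚ Min.m)
      multiple = counterexample λ simple → ¬sep (Min.m , Min.isMinimalPolynomial , simple)
      m′≐0 : derivative Min.m ≐ []
      m′≐0 = multiple-root⇒derivative≐[] min (stable (proj₂ multiple))
      char : ∃ Characteristic
      char = derivative≐[]⇒characteristic min m′≐0

    -- Write f = (X - x) g. A root of `g` would equal x and make it a double root of `f`; so `g` is
    -- constant and `f` is linear.
    sole-root∈ : ∀ {f x} → f ∈ F [X] → ¬ Constant f → NoMultipleRoot f → Root f x → (∀ {y} → Root f y → y ≈ x) → x ∈ F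
    sole-root∈ {f} {x} f∈ ¬const simple root sole = conclude (em ℓ {Constant g})
      where
      g = proj₁ (linear-factor f x root)
      f≐ : f ≐ (X- x) *ₚ g
      f≐ = proj₁ (proj₂ (linear-factor f x root))
      f≗ : ∀ y → eval f y ≈ (y - x) * eval g y
      f≗ y = trans (eval-cong f ((X- x) *ₚ g) f≐ y) (trans (eval-*ₚ (X- x) g y) (*-congʳ (eval-X- x y)))
      conclude : Dec (Constant g) → x ∈ F
      -- Here f = c X - c x with c = `lead`, and x = -c⁻¹ f₀ is computed from coefficients in `F`.
      conclude (yes g-const) = Subfield.resp F -c⁻¹f₀≈x
        (Subfield.*-closed F (Subfield.neg-closed F (⁻¹-closed F c≉0 (Subfield.resp F (f≐linear 1) (coeff-closed F-subring f∈ 1)))) (coeff-closed F-subring f∈ 0))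
        where
        lead = coeff g 0
        f≐linear : f ≐ - (x * lead) ∷ lead ∷ []
        f≐linear = ≐-ext f (- (x * lead) ∷ lead ∷ []) λ y → trans (f≗ y) (trans (*-congˡ (eval-constant g g-const y))
          (solve 3 (λ x y k → (y :- x) :* k := (:- (x :* k)) :+ y :* (k :+ y :* con (+ 0))) refl x y lead))
        c≉0 : lead ≉0
        c≉0 c≈0 = ¬const (λ { zero → trans (f≐linear 1) c≈0 ; (suc n) → f≐linear (suc (suc n)) })
        -c⁻¹f₀≈x : - (lead ⁻¹[ c≉0 ]) * coeff f 0 ≈ x
        -c⁻¹f₀≈x = begin
          - (lead ⁻¹[ c≉0 ]) * coeff f 0       ≈⟨ *-congˡ (f≐linear 0) ⟩
          - (lead ⁻¹[ c≉0 ]) * - (x * lead)    ≈⟨ solve 3 (λ i x k → (:- i) :* (:- (x :* k)) := x :* (i :* k)) refl _ x lead ⟩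
          x * (lead ⁻¹[ c≉0 ] * lead)          ≈⟨ trans (*-congˡ (inverseˡ c≉0)) (*-identityʳ x) ⟩
          x                                    ∎
      conclude (no g-nonconst) = ⊥-elim (simple x (g′ , f≐s²g′))
        where
        y = proj₁ (closed g g-nonconst)
        g-root-y = proj₂ (closed g g-nonconst)
        y≈x : y ≈ x
        y≈x = sole (trans (f≗ y) (trans (*-congˡ g-root-y) (zeroʳ _)))
        g-root-x : Root g x
        g-root-x = trans (sym (eval-congʳ g y≈x)) g-root-y
        g′ = proj₁ (linear-factor g x g-root-x)
        f≐s²g′ : f ≐ ((X- x) *ₚ (X- x)) *ₚ g′
        f≐s²g′ = ≐-ext f (((X- x) *ₚ (X- x)) *ₚ g′) λ z → begin
          eval f z                                            ≈⟨ trans (eval-cong f ((X- x) *ₚ g) f≐ z) (eval-*ₚ (X- x) g z) ⟩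
          eval (X- x) z * eval g z                            ≈⟨ *-congˡ (trans (eval-cong g ((X- x) *ₚ g′) (proj₁ (proj₂ (linear-factor g x g-root-x))) z) (eval-*ₚ (X- x) g′ z)) ⟩
          eval (X- x) z * (eval (X- x) z * eval g′ z)         ≈⟨ *-assoc _ _ _ ⟨
          eval (X- x) z * eval (X- x) z * eval g′ z           ≈⟨ trans (eval-*ₚ ((X- x) *ₚ (X- x)) g′ z) (*-congʳ (eval-*ₚ (X- x) (X- x) z)) ⟨
          eval (((X- x) *ₚ (X- x)) *ₚ g′) z                   ∎

  open OverField K (λ k∈ → k∈) using () renaming (F⟨_⟩ to K⟨_⟩; F⊆F⟨_⟩ to K⊆K⟨_⟩; x∈F⟨_⟩ to x∈K⟨_⟩; F⟨⟩-least to K⟨⟩-least)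

  -- The minimal polynomial of x over K(xᵖ) divides the one over K, so its roots are simple. It also
  -- divides Xᵖ - xᵖ, whose only root is x.
  separable⇒x∈K⟨xᵖ⟩ : ∀ {x} → SeparableElement K x → ∀ {p} → Characteristic p → x ∈ K⟨ x ^ p ⟩
  separable⇒x∈K⟨xᵖ⟩ {x} (f , f-min , simple) {p} char = sole-root∈ F K⊆F Min.m-over Min.nonconstant m-simple Min.root sole
    where
    F = K⟨ x ^ p ⟩
    K⊆F : K ⊆ F
    K⊆F = K⊆K⟨ x ^ p ⟩
    module Min = OverField.Minimal (OverField.minimal-polynomial F K⊆F x)
    open IsMinimalPolynomial f-min
    open Irreducible irreducible
    m∣f = Min.m-divides (All.map K⊆F over) root
    q = proj₁ m∣f
    m-simple : NoMultipleRoot Min.m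
    m-simple a (g , m≐) = simple a (q *ₚ g , ≐-ext f (s² *ₚ (q *ₚ g)) λ y → begin
      eval f y                                  ≈⟨ proj₂ (proj₂ m∣f) y ⟩
      eval q y * eval Min.m y                   ≈⟨ *-congˡ (trans (eval-cong Min.m (s² *ₚ g) m≐ y) (eval-*ₚ s² g y)) ⟩
      eval q y * (eval s² y * eval g y)         ≈⟨ solve 3 (λ q s g → q :* (s :* g) := s :* (q :* g)) refl _ _ _ ⟩
      eval s² y * (eval q y * eval g y)         ≈⟨ trans (eval-*ₚ s² (q *ₚ g) y) (*-congˡ (eval-*ₚ q g y)) ⟨
      eval (s² *ₚ (q *ₚ g)) y                   ∎)
      where s² = (X- a) *ₚ (X- a)
    P = (X^ p) +ₚ (- (x ^ p) ∷ [])
    eval-P : ∀ y → eval P y ≈ y ^ p - x ^ p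
    eval-P y = trans (eval-+ₚ (X^ p) _ y) (+-cong (eval-X^ p y) (trans (+-congˡ (zeroʳ y)) (+-identityʳ _)))
    X^∈ : ∀ n → X^ n ∈ F [X]
    X^∈ zero    = Subfield.1∈ F ∷ []
    X^∈ (suc n) = Subfield.0∈ F ∷ X^∈ n
    P∈ : P ∈ F [X]
    P∈ = +ₚ-closed (subfield-isSubring F) (X^∈ p) (Subfield.neg-closed F x∈K⟨ x ^ p ⟩ ∷ [])
    m∣P = Min.m-divides P∈ (trans (eval-P x) (-‿inverseʳ _))
    sole : ∀ {y} → Root Min.m y → y ≈ x
    sole {y} y-root = frobenius-injective char y x (x-y≈0⇒x≈y (begin
      y ^ p - x ^ p                   ≈⟨ eval-P y ⟨
      eval P y                        ≈⟨ proj₂ (proj₂ m∣P) y ⟩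
      eval (proj₁ m∣P) y * eval Min.m y ≈⟨ trans (*-congˡ y-root) (zeroʳ _) ⟩
      0#                              ∎))

  degree-refl : ∀ (F : Subfield Ω) → HasDegree F F 1
  degree-refl F = (λ _ → 1#) , record
    { members     = λ _ → Subfield.1∈ F
    ; spanning    = λ {x} x∈ → (λ _ → x) , (λ _ → x∈) , sym (trans (+-identityʳ _) (*-identityʳ x))
    ; independent = λ k _ e → λ { zero → trans (sym (trans (+-identityʳ _) (*-identityʳ _))) e }
    }

  module _ {L : Subfield Ω} {n} (K⊆L : K ⊆ L) (degree-L : HasDegree K L n) where

    -- E = K(x) is spanned over K by p-th powers, so the p-th powers of a basis of E over K(y)
    -- span E over K(yᵖ); hence [E : K(yᵖ)] ≤ [E : K(y)].
    y∈K⟨yᵖ⟩ : ∀ {x} → x ∈ L → SeparableElement K x → ∀ {p} → Characteristic p → ∀ {y} → y ∈ K⟨ x ⟩ → y ∈ K⟨ y ^ p ⟩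
    y∈K⟨yᵖ⟩ {x} x∈ x-sep {p} char {y} y∈ =
      -- A degree [A : B] of at most 1 collapses K(y) onto K(yᵖ).
      degree-≤⇒⊆ {B} {B} {A} (λ b∈ → b∈) B⊆A (degree-refl B) degree-A-B s≤1 x∈K⟨ y ⟩
      where
      A = K⟨ y ⟩
      B = K⟨ y ^ p ⟩
      E = K⟨ x ⟩
      module A = Subfield A
      module B = Subfield B
      module E = Subfield E
      E⊆L : E ⊆ L
      E⊆L = K⟨⟩-least {L} K⊆L x∈
      A⊆E : A ⊆ E
      A⊆E = K⟨⟩-least {E} K⊆K⟨ x ⟩ y∈
      B⊆A : B ⊆ A
      B⊆A = K⟨⟩-least {A} K⊆K⟨ y ⟩ (^-closed (subfield-isSubring A) x∈K⟨ y ⟩ p)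
      basis-E : ∃ (HasDegree A E)
      basis-E = subextension-degree {K} {A} {E} {L} K⊆K⟨ y ⟩ E⊆L degree-L
      t = proj₁ basis-E
      z = proj₁ (proj₂ basis-E)
      module Z = IsBasis (proj₂ (proj₂ basis-E))
      degree-B-A : ∃ (HasDegree B A)
      degree-B-A = subextension-degree {K} {B} {A} {L} K⊆K⟨ y ^ p ⟩ (λ a∈ → E⊆L (A⊆E a∈)) degree-L
      s′ = proj₁ degree-B-A
      degree-A-B : HasDegree B A s′
      degree-A-B = proj₂ degree-B-A
      degree-B-E : HasDegree B E (s′ ℕ.* t)
      degree-B-E = tower {B} {A} {E} B⊆A A⊆E degree-A-B (proj₂ basis-E)
      zᵖ : Vector Carrier t
      zᵖ i = z i ^ p
      pth-powers : ∀ {h} → h ∈ K [X] → map (_^ p) h ∈ K [X]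
      pth-powers []        = []
      pth-powers (a∈ ∷ h∈) = ^-closed (subfield-isSubring K) a∈ p ∷ pth-powers h∈
      A^p⊆B : ∀ {a} → a ∈ A → a ^ p ∈ B
      A^p⊆B (h , h∈ , e) = map (_^ p) h , pth-powers h∈ , trans (sym (frobenius-eval char h y)) (^-congˡ p e)
      span-resp : ∀ {u v} → u ≈ v → Span B zᵖ u → Span B zᵖ v
      span-resp u≈v (k , k∈ , e) = k , k∈ , trans (sym u≈v) e
      span-p : ∀ {u} → u ∈ E → Span B zᵖ (u ^ p)
      span-p {u} u∈ = (λ i → k i ^ p) , (λ i → A^p⊆B (proj₁ (proj₂ (Z.spanning u∈)) i)) , (begin
        u ^ p                          ≈⟨ ^-congˡ p (proj₂ (proj₂ (Z.spanning u∈))) ⟩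
        sum (λ i → k i * z i) ^ p      ≈⟨ frobenius-sum char (λ i → k i * z i) ⟩
        sum (λ i → (k i * z i) ^ p)    ≈⟨ sum-cong-≋ (λ i → ^-distrib-* (k i) (z i) p) ⟩
        sum (λ i → k i ^ p * z i ^ p)  ∎)
        where k = proj₁ (Z.spanning u∈)
      -- The factor `u ^ p` is carried along to absorb powers of x: xᵖ uᵖ = (x u)ᵖ is again a p-th
      -- power from `E`, so only scalars from `K` remain.
      span-h : ∀ {h} → h ∈ K [X] → ∀ {u} → u ∈ E → Span B zᵖ (eval h (x ^ p) * u ^ p)
      span-h []        u∈ = span-* B B.0∈ (span-p u∈)
      span-h {a ∷ h} (a∈ ∷ h∈) {u} u∈ = span-resp
        (trans (+-congˡ (*-congˡ (^-distrib-* x u p))) (solve 4 (λ a u H xp → a :* u :+ H :* (xp :* u) := (a :+ xp :* H) :* u) refl a (u ^ p) (eval h (x ^ p)) (x ^ p)))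
        (span-+ B (span-* B (K⊆K⟨ y ^ p ⟩ a∈) (span-p u∈)) (span-h h∈ (E.*-closed x∈K⟨ x ⟩ u∈)))
      1^n≈1 : ∀ n → 1# ^ n ≈ 1#
      1^n≈1 zero    = refl
      1^n≈1 (suc n) = trans (*-identityˡ _) (1^n≈1 n)
      spans : ∀ {u} → u ∈ E → Span B zᵖ u
      -- As K(x) = K(xᵖ), an element of `E` is h(xᵖ) = h(xᵖ) 1ᵖ.
      spans u∈ = let h , h∈ , e = K⟨⟩-least {K⟨ x ^ p ⟩} K⊆K⟨ x ^ p ⟩ (separable⇒x∈K⟨xᵖ⟩ x-sep char) u∈
        in span-resp (trans (*-cong e (1^n≈1 p)) (*-identityʳ _)) (span-h h∈ E.1∈)
      s≤1 : s′ ℕ.≤ 1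
      -- The t vectors `zᵖ` span `E` over `B`, and [E : B] = s′ t; hence s′ t ≤ t.
      s≤1 = ℕ.*-cancelʳ-≤ s′ 1 t {{ℕ.>-nonZero (degree>0 {A} {E} (proj₂ basis-E))}}
        (≡.subst (s′ ℕ.* t ℕ.≤_) (≡.sym (ℕ.*-identityˡ t))
          (degree≤spanning {B} {E} degree-B-E zᵖ spans))

    separable-K⟨_⟩ : ∀ {x} → x ∈ L → SeparableElement K x → SeparableExtension K K⟨ x ⟩
    separable-K⟨_⟩ {x} x∈ x-sep = K⊆K⟨ x ⟩ , λ y∈ → stable λ ¬y-sep →
      let p , char , y∉ = inseparable⇒characteristic K (λ k∈ → k∈) ¬y-sep in y∉ (y∈K⟨yᵖ⟩ x∈ x-sep char y∈)

    separable∈maximal : ∀ {S} → IsMaximalSeparable K L S → ∀ {x} → x ∈ L → SeparableElement K x → x ∈ S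
    separable∈maximal max {x} x∈ x-sep = IsMaximalSeparable.maximal max K⟨ x ⟩ (separable-K⟨ x∈ ⟩ x-sep) (K⟨⟩-least {L} K⊆L x∈) x∈K⟨ x ⟩

    -- Descent on [K(x) : K]. If x is separable the exponent is 1. Otherwise x ∉ K(xᵖ), so xᵖ
    -- generates a strictly smaller field, and the exponent found for xᵖ is multiplied by p.
    separable-power : ∀ {x} → x ∈ L → ∃[ q ] InjectivePower q × SeparableElement K (x ^ q)
    separable-power {x} x∈ = by-degree (proj₁ (degree-K⟨ x∈ ⟩)) x∈ (proj₂ (degree-K⟨ x∈ ⟩))
      where
      degree-K⟨_⟩ : ∀ {x} → x ∈ L → ∃ (HasDegree K K⟨ x ⟩)
      degree-K⟨_⟩ {x} x∈ = subextension-degree {K} {K} {K⟨ x ⟩} {L} (λ k∈ → k∈) (K⟨⟩-least {L} K⊆L x∈) degree-L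
      Goal : ℕ → Set _
      Goal d = ∀ {x} → x ∈ L → HasDegree K K⟨ x ⟩ d → ∃[ q ] InjectivePower q × SeparableElement K (x ^ q)
      step : ∀ d → (∀ {d′} → d′ ℕ.< d → Goal d′) → Goal d
      step d rec {x} x∈ deg = decide (em _ {SeparableElement K x})
        where
        decide : Dec (SeparableElement K x) → ∃[ q ] InjectivePower q × SeparableElement K (x ^ q)
        decide (yes sep) = 1 , (λ u v e → trans (sym (*-identityʳ u)) (trans e (*-identityʳ v))) , separable-resp {K} (sym (*-identityʳ x)) sep
        decide (no ¬sep) = p ℕ.* q , (λ u v e → frobenius-injective char u v (inj _ _ (trans (^-assocʳ u p q) (trans e (sym (^-assocʳ v p q)))))) ,
                           separable-resp {K} (^-assocʳ x p q) sep
          where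
          insep = inseparable⇒characteristic K (λ k∈ → k∈) ¬sep
          p = proj₁ insep
          char : Characteristic p
          char = proj₁ (proj₂ insep)
          x∉ : ¬ x ∈ K⟨ x ^ p ⟩
          x∉ = proj₂ (proj₂ insep)
          xᵖ∈ : x ^ p ∈ L
          xᵖ∈ = ^-closed (subfield-isSubring L) x∈ p
          d′ = proj₁ degree-K⟨ xᵖ∈ ⟩
          deg′ : HasDegree K K⟨ x ^ p ⟩ d′
          deg′ = proj₂ degree-K⟨ xᵖ∈ ⟩
          d′<d : d′ ℕ.< d
          d′<d = ℕ.≰⇒> λ d≤d′ → x∉ (degree-≤⇒⊆ {K} {K⟨ x ^ p ⟩} {K⟨ x ⟩} K⊆K⟨ x ^ p ⟩
            (K⟨⟩-least {K⟨ x ⟩} K⊆K⟨ x ⟩ (^-closed (subfield-isSubring K⟨ x ⟩) x∈K⟨ x ⟩ p)) deg′ deg d≤d′ x∈K⟨ x ⟩)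
          r′ = rec d′<d xᵖ∈ deg′
          q = proj₁ r′
          inj = proj₁ (proj₂ r′)
          sep = proj₂ (proj₂ r′)
      by-degree : ∀ d → Goal d
      by-degree = <-rec Goal step

-- Finite cardinalities of setoids.

module Cardinality (em : Classical) {a ℓ : Level} (S : Setoid a ℓ) where
  open Setoid S

  Distinct : ∀ {n} → (Fin n → Carrier) → Set ℓ
  Distinct f = ∀ i j → f i ≈ f j → i ≡ j

  -- Greedy enumeration with the same countdown `g` as in the construction of a basis; it stops when
  -- every element is equal to a listed one.
  incomplete⇒extend : ∀ N → (∀ (f : Fin (suc N) → Carrier) → ¬ Distinct f) →
                      ∀ g {n} (f : Fin n → Carrier) → Distinct f → n ℕ.+ g ≡ suc N → ∃ (HasCardinality S)
  incomplete⇒extend N bound zero {n} f distinct n+0≡ with ≡.trans (≡.sym (ℕ.+-identityʳ n)) n+0≡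
  ... | ≡.refl = contradiction distinct (bound f)
  incomplete⇒extend N bound (suc g) {n} f distinct n+g≡ with em (a ⊔ ℓ) {∃[ x ] ∀ i → ¬ x ≈ f i}
  ... | yes (x , x∉) = incomplete⇒extend N bound g (x ∷ᵛ f)
    (λ { zero zero _ → ≡.refl ; zero (suc j) e → ⊥-elim (x∉ j e) ; (suc i) zero e → ⊥-elim (x∉ i (sym e)) ; (suc i) (suc j) e → ≡.cong suc (distinct i j e) })
    (≡.trans (≡.sym (ℕ.+-suc n g)) n+g≡)
  ... | no ¬∃ = n , record
    { to        = index
    ; cong      = λ {x} {y} x≈y → distinct _ _ (trans (sym (index-≈ x)) (trans x≈y (index-≈ y)))
    ; bijective = (λ {x} {y} e → trans (index-≈ x) (trans (reflexive (≡.cong f e)) (sym (index-≈ y)))) ,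
                  λ i → f i , λ {z} z≈ → distinct _ _ (trans (sym (index-≈ z)) z≈)
    }
    where
    indexed : ∀ x → ∃[ i ] x ≈ f i
    indexed x with em ℓ {∃[ i ] x ≈ f i}
    ... | yes p = p
    ... | no ¬p = ⊥-elim (¬∃ (x , λ i e → ¬p (i , e)))
    index : Carrier → Fin n
    index x = proj₁ (indexed x)
    index-≈ : ∀ x → x ≈ f (index x)
    index-≈ x = proj₂ (indexed x)

  bounded⇒cardinality : ∀ N → (∀ (f : Fin (suc N) → Carrier) → ¬ Distinct f) → ∃ (HasCardinality S)
  bounded⇒cardinality N bound = incomplete⇒extend N bound (suc N) {0} (λ ()) (λ ()) ≡.refl

  module Enumeration {n} (b : HasCardinality S n) where
    open Bijection b

    enum : Fin n → Carrier
    enum i = proj₁ (surjective i)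

    enum-to : ∀ i → to (enum i) ≡ i
    enum-to i = proj₂ (surjective i) refl

    enum-distinct : Distinct enum
    enum-distinct i j e = ≡.trans (≡.sym (enum-to i)) (≡.trans (cong e) (enum-to j))

    enum-complete : ∀ x → ∃[ i ] x ≈ enum i
    enum-complete x = to x , injective (≡.sym (enum-to (to x)))

  cardinality-≤ : ∀ {m n} → HasCardinality S m → HasCardinality S n → m ℕ.≤ n
  cardinality-≤ b b′ = Fin.injective⇒≤ {f = λ i → Bijection.to b′ (enum i)} λ e → enum-distinct _ _ (Bijection.injective b′ e)
    where open Enumeration b

  cardinality-unique : ∀ {m n} → HasCardinality S m → HasCardinality S n → m ≡ n
  cardinality-unique b b′ = ℕ.≤-antisym (cardinality-≤ b b′) (cardinality-≤ b′ b)

  hasCardinality-card : ∃ (HasCardinality S) → HasCardinality S (card em S)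
  hasCardinality-card = numberOr0-satisfies (em (a ⊔ ℓ))

  card-≡ : ∀ {n} → HasCardinality S n → card em S ≡ n
  card-≡ b = cardinality-unique (hasCardinality-card (_ , b)) b

  -- The default value of `card` is 0, so a positive value certifies a genuine cardinality. This
  -- matters when finiteness is not known beforehand.
  card≡suc⇒hasCardinality : ∀ {n} → card em S ≡ suc n → HasCardinality S (suc n)
  card≡suc⇒hasCardinality = numberOr0-suc (em (a ⊔ ℓ))
    where
    numberOr0-suc : ∀ {b n} {P : ℕ → Set b} (d : Dec (∃ P)) → numberOr0 d ≡ suc n → P (suc n)
    numberOr0-suc (yes (_ , p)) ≡.refl = p

-- Independence of homomorphisms and Artin's theorem.

module Artin (em : Classical) {c ℓ : Level} (Ω : Field c ℓ) where
  open Field Ω hiding (zero)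
  open ClassicalField em Ω
  open LinearAlgebra em Ω
  open FieldHomomorphisms em Ω
  open SemiringSum semiring
  open SetoidReasoning setoid

  -- Lets `homogeneous-solution` run with coefficients anywhere in Ω, as values of embeddings may
  -- leave the subfield.
  whole : Subfield Ω
  whole = record { member = λ _ → ⊤ ; resp = _ ; 0∈ = _ ; 1∈ = _ ; +-closed = _ ; *-closed = _ ; neg-closed = _ ; inv-closed = _ }

  module _ {E : Subfield Ω} where
    private
      module E = Subfield E
    open Hom using (⟦_⟧)

    Distinct : ∀ {r} → (Fin r → Hom E) → Set (c ⊔ ℓ)
    Distinct σ = ∀ i j → (∀ x → ⟦ σ i ⟧ x ≈ ⟦ σ j ⟧ x) → i ≡ j

    -- Dedekind's argument. With `a` separating σ₀ from τ j, the relation at a x minus σ₀(a) times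
    -- the relation at x loses its σ₀ term and keeps the coefficients k i (τ i (a) - σ₀(a)). By
    -- induction these vanish, which forces k j = 0.
    homs-independent : ∀ {r} (σ : Fin r → Hom E) → Distinct σ → ∀ (k : Vector Carrier r) →
                       (∀ x → sum (λ i → k i * ⟦ σ i ⟧ x) ≈ 0#) → ∀ i → k i ≈ 0#
    homs-independent {suc r} σ distinct k relation = λ { zero → k₀≈0 ; (suc j) → k≈0 j }
      where
      τ : Fin r → Hom E
      τ = σ ∘ suc
      k≈0 : ∀ j → k (suc j) ≈ 0#
      k≈0 j = stable λ kj≉0 → proj₂ separating (sym (x-y≈0⇒x≈y (*-cancel-0ˡ kj≉0
        (homs-independent τ (λ i i′ e → Fin.suc-injective (distinct _ _ e)) k′ relation′ j))))
        where
        separating : ∃[ a ] ¬ ⟦ σ zero ⟧ a ≈ ⟦ τ j ⟧ a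
        separating = counterexample λ e → Fin.0≢1+n (distinct zero (suc j) e)
        a = proj₁ separating
        σ₀a = ⟦ σ zero ⟧ a
        k′ : Vector Carrier r
        k′ i = k (suc i) * (⟦ τ i ⟧ a - σ₀a)
        relation′ : ∀ x → sum (λ i → k′ i * ⟦ τ i ⟧ x) ≈ 0#
        relation′ x = begin
          sum (λ i → k′ i * ⟦ τ i ⟧ x)
            ≈⟨ sum-cong-≋ (λ i → trans (solve 4 (λ k t s u → (k :* (t :- s)) :* u := k :* (t :* u) :+ (:- s) :* (k :* u)) refl (k (suc i)) (⟦ τ i ⟧ a) σ₀a (⟦ τ i ⟧ x))
                 (+-congʳ (*-congˡ (sym (Hom.*-homo (τ i) a x ax refl))))) ⟩
          sum (λ i → k (suc i) * ⟦ τ i ⟧ ax + - σ₀a * (k (suc i) * ⟦ τ i ⟧ x))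
            ≈⟨ sum-linear (- σ₀a) (λ i → k (suc i) * ⟦ τ i ⟧ ax) (λ i → k (suc i) * ⟦ τ i ⟧ x) ⟩
          S ax + - σ₀a * S x
            ≈⟨ solve 5 (λ k s u A X → A :+ (:- s) :* X := (k :* (s :* u) :+ A) :- s :* (k :* u :+ X)) refl (k zero) σ₀a (⟦ σ zero ⟧ x) (S ax) (S x) ⟩
          (k zero * (σ₀a * ⟦ σ zero ⟧ x) + S ax) - σ₀a * (k zero * ⟦ σ zero ⟧ x + S x)
            ≈⟨ +-cong (trans (+-congʳ (*-congˡ (sym (Hom.*-homo (σ zero) a x ax refl)))) (relation ax)) (-‿cong (trans (*-congˡ (relation x)) (zeroʳ _))) ⟩
          0# - 0#
            ≈⟨ -‿inverseʳ 0# ⟩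
          0# ∎
          where
          ax : Element E
          ax = proj₁ a * proj₁ x , E.*-closed (proj₂ a) (proj₂ x)
          S : Element E → Carrier
          S x = sum (λ i → k (suc i) * ⟦ τ i ⟧ x)
      one : Element E
      one = 1# , E.1∈
      k₀≈0 : k zero ≈ 0#
      k₀≈0 = begin
        k zero                                                         ≈⟨ trans (+-identityʳ _) (*-identityʳ _) ⟨
        k zero * 1# + 0#                                               ≈⟨ +-cong (*-congˡ (sym (Hom.1-homo (σ zero) one refl))) (sym (sum-≈0 λ i → trans (*-congʳ (k≈0 i)) (zeroˡ _))) ⟩
        k zero * ⟦ σ zero ⟧ one + sum (λ i → k (suc i) * ⟦ τ i ⟧ one)  ≈⟨ relation one ⟩
        0#                                                             ∎

    -- With more homomorphisms than basis elements, the matrix of values σ j (b i) has a nonzero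
    -- kernel vector. The homomorphisms are M-linear, so this relation spreads from the basis to all
    -- of `E`, against independence.
    homs-≤-degree : ∀ {M : Subfield Ω} {n r} → M ⊆ E → HasDegree M E n → (σ : Fin r → Hom E) → Distinct σ → (∀ i → Hom.Fixes (σ i) M) → r ℕ.≤ n
    homs-≤-degree {M} {n} {r} M⊆E (b , B) σ distinct fixes = ℕ.≮⇒≥ λ n<r →
      let k , _ , (i , ki≉0) , eqs = homogeneous-solution whole n A _ n<r
      in ki≉0 (homs-independent σ distinct k (relation k eqs) i)
      where
      open IsBasis B
      A : Fin n → Fin r → Carrier
      A i j = ⟦ σ j ⟧ (b i , members i)
      relation : ∀ k → (∀ i → sum (λ j → A i j * k j) ≈ 0#) → ∀ x → sum (λ j → k j * ⟦ σ j ⟧ x) ≈ 0#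
      relation k eqs x = begin
        sum (λ j → k j * ⟦ σ j ⟧ x)
          ≈⟨ sum-cong-≋ (λ j → *-congˡ (trans (Hom.sum-homo (σ j) term x (proj₂ (proj₂ span))) (sum-cong-≋ λ i →
               trans (Hom.*-homo (σ j) (scalar i) (b i , members i) (term i) refl) (trans (*-congʳ (fixes j (scalar i) (h∈ i))) (*-comm _ _))))) ⟩
        sum (λ j → k j * sum (λ i → A i j * h i))
          ≈⟨ sum-assoc k (λ j i → A i j) h ⟩
        sum (λ i → sum (λ j → k j * A i j) * h i)
          ≈⟨ sum-≈0 (λ i → trans (*-congʳ (trans (sum-cong-≋ λ j → *-comm (k j) (A i j)) (eqs i))) (zeroˡ _)) ⟩
        0# ∎
        where
        span = spanning (proj₂ x)
        h = proj₁ span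
        h∈ = proj₁ (proj₂ span)
        scalar : Fin n → Element E
        scalar i = h i , M⊆E (h∈ i)
        term : Fin n → Element E
        term i = h i * b i , E.*-closed (M⊆E (h∈ i)) (members i)

  module _ {M E : Subfield Ω} (M⊆E : M ⊆ E) {r} (σ : Fin r → Hom E)
           (into : ∀ i x → Hom.⟦_⟧ (σ i) x ∈ E)
           (fixes : ∀ i → Hom.Fixes (σ i) M)
           (fixed : ∀ x → (∀ i → Hom.⟦_⟧ (σ i) x ≈ proj₁ x) → proj₁ x ∈ M)
           where
    private
      module E = Subfield E
    open Hom using (⟦_⟧)

    apply : Fin r → Element E → Element E
    apply i x = ⟦ σ i ⟧ x , into i x

    -- An E-subspace of Eᵐ that every σ i maps into itself coordinatewise.
    record Stable {m} (W : (Fin m → Element E) → Set ℓ) : Set (c ⊔ ℓ) where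
      field
        W-resp  : ∀ v w → (∀ j → proj₁ (v j) ≈ proj₁ (w j)) → W v → W w
        W-scale : ∀ (a : Element E) v w → (∀ j → proj₁ (w j) ≈ proj₁ a * proj₁ (v j)) → W v → W w
        W-sub   : ∀ u v w → (∀ j → proj₁ (w j) ≈ proj₁ (u j) - proj₁ (v j)) → W u → W v → W w
        W-apply : ∀ i v → W v → W (apply i ∘ v)

    Nonzero : ∀ {m} → (Fin m → Element E) → Set ℓ
    Nonzero v = ∃[ j ] proj₁ (v j) ≉0

    0ᴱ : Element E
    0ᴱ = 0# , E.0∈

    stable-tail : ∀ {m W} → Stable {suc m} W → Stable (λ w → W (0ᴱ ∷ᵛ w))
    stable-tail st = record
      { W-resp  = λ v w e → W-resp (0ᴱ ∷ᵛ v) (0ᴱ ∷ᵛ w) λ { zero → refl ; (suc j) → e j }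
      ; W-scale = λ a v w e → W-scale a (0ᴱ ∷ᵛ v) (0ᴱ ∷ᵛ w) λ { zero → sym (zeroʳ (proj₁ a)) ; (suc j) → e j }
      ; W-sub   = λ u v w e → W-sub (0ᴱ ∷ᵛ u) (0ᴱ ∷ᵛ v) (0ᴱ ∷ᵛ w) λ { zero → sym (-‿inverseʳ 0#) ; (suc j) → e j }
      ; W-apply = λ i w Ww → W-resp (apply i ∘ (0ᴱ ∷ᵛ w)) (0ᴱ ∷ᵛ apply i ∘ w)
                               (λ { zero → Hom.0-homo (σ i) 0ᴱ refl ; (suc j) → refl }) (W-apply i (0ᴱ ∷ᵛ w) Ww)
      }
      where open Stable st

    -- Normalise a coordinate to 1: then σ v - v has fewer nonzero coordinates than v.
    fixed-vector : ∀ {m} (W : (Fin m → Element E) → Set ℓ) → Stable W → ∀ v → W v → Nonzero v →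
                   ∃[ u ] W u × Nonzero u × (∀ j → proj₁ (u j) ∈ M)
    fixed-vector {zero}  W st v Wv (() , _)
    fixed-vector {suc m} W st v Wv v≉0 = decide (em (c ⊔ ℓ) {∃[ w ] W (0ᴱ ∷ᵛ w) × Nonzero w})
      where
      open Stable st
      decide : Dec (∃[ w ] W (0ᴱ ∷ᵛ w) × Nonzero w) → ∃[ u ] W u × Nonzero u × (∀ j → proj₁ (u j) ∈ M)
      -- A nonzero vector of `W` with head 0 reduces the problem to shorter vectors.
      decide (yes (w , Ww , w≉0)) =
        let u , Wu , (j , uj≉0) , u∈ = fixed-vector (λ w → W (0ᴱ ∷ᵛ w)) (stable-tail st) w Ww w≉0
        in 0ᴱ ∷ᵛ u , Wu , (suc j , uj≉0) , λ { zero → Subfield.0∈ M ; (suc j) → u∈ j }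
      -- Now every vector of `W` with head 0 is zero. After scaling, `u` has head 1, so σ u - u has
      -- head 0 and vanishes: `u` is fixed.
      decide (no ¬∃) = u , Wu , (zero , λ u₀≈0 → 1≉0 (trans (sym u₀≈1) u₀≈0)) , λ j → fixed (u j) λ i → x-y≈0⇒x≈y (d≈0 i j)
        where
        head≈0⇒≈0 : ∀ w → W w → proj₁ (w zero) ≈ 0# → ∀ j → proj₁ (w j) ≈ 0#
        head≈0⇒≈0 w Ww w₀≈0 zero    = w₀≈0
        head≈0⇒≈0 w Ww w₀≈0 (suc j) = stable λ wj≉0 →
          ¬∃ (w ∘ suc , W-resp w (0ᴱ ∷ᵛ w ∘ suc) (λ { zero → w₀≈0 ; (suc j) → refl }) Ww , j , wj≉0)
        v₀≉0 : proj₁ (v zero) ≉0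
        v₀≉0 v₀≈0 = proj₂ v≉0 (head≈0⇒≈0 v Wv v₀≈0 (proj₁ v≉0))
        v₀⁻¹ : Element E
        v₀⁻¹ = proj₁ (v zero) ⁻¹[ v₀≉0 ] , ⁻¹-closed E v₀≉0 (proj₂ (v zero))
        u : Fin (suc m) → Element E
        u j = proj₁ v₀⁻¹ * proj₁ (v j) , E.*-closed (proj₂ v₀⁻¹) (proj₂ (v j))
        Wu : W u
        Wu = W-scale v₀⁻¹ v u (λ _ → refl) Wv
        u₀≈1 : proj₁ (u zero) ≈ 1#
        u₀≈1 = inverseˡ v₀≉0
        d : Fin r → Fin (suc m) → Element E
        d i j = ⟦ σ i ⟧ (u j) - proj₁ (u j) , sub-closed E (into i (u j)) (proj₂ (u j))
        d≈0 : ∀ i j → proj₁ (d i j) ≈ 0#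
        d≈0 i = head≈0⇒≈0 (d i) (W-sub (apply i ∘ u) u (d i) (λ _ → refl) (W-apply i u Wu) Wu)
          (x≈y⇒x-y≈0 (trans (Hom.1-homo (σ i) (u zero) u₀≈1) (sym u₀≈1)))

    module _ (translate : ∀ k i → ∃[ i′ ] ∀ x → ⟦ σ k ⟧ (apply i′ x) ≈ ⟦ σ i ⟧ x)
             (identity : ∃[ i ] ∀ x → ⟦ σ i ⟧ x ≈ proj₁ x) where

      -- The r equations ∑ σ i (x j) v j = 0 have a nonzero solution in Eᵐ, and by `translate` the
      -- solution space is stable under every σ k. A fixed vector in it has coordinates in `M`, and
      -- the equation of the identity is the desired relation among the x j.
      dependent-over-fixed : ∀ {m} → r ℕ.< m → ∀ (x : Vector Carrier m) → (∀ j → x j ∈ E) → Dependent M x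
      dependent-over-fixed {m} r<m x x∈ =
        let u , Wu , (j , uj≉0) , u∈ = fixed-vector W W-stable (λ j → k j , k∈ j) (proj₂ (proj₂ (proj₂ solution))) (proj₁ (proj₂ (proj₂ solution)))
        in proj₁ ∘ u , u∈ , (j , uj≉0) ,
           trans (sum-cong-≋ {m} λ j → trans (*-comm _ _) (*-congʳ (sym (proj₂ identity (x j , x∈ j))))) (Wu (proj₁ identity))
        where
        xᴱ : Fin m → Element E
        xᴱ j = x j , x∈ j
        solution = homogeneous-solution E r (λ i j → ⟦ σ i ⟧ (xᴱ j)) (λ i j → into i (xᴱ j)) r<m
        k = proj₁ solution
        k∈ = proj₁ (proj₂ solution)
        W : (Fin m → Element E) → Set ℓ
        W v = ∀ i → sum (λ j → ⟦ σ i ⟧ (xᴱ j) * proj₁ (v j)) ≈ 0#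
        W-stable : Stable W
        W-stable = record
          { W-resp  = λ v w v≈w Wv i → trans (sum-cong-≋ {m} λ j → *-congˡ (sym (v≈w j))) (Wv i)
          ; W-scale = λ a v w w≈av Wv i → begin
              sum (λ j → ⟦ σ i ⟧ (xᴱ j) * proj₁ (w j))
                ≈⟨ sum-cong-≋ {m} (λ j → trans (*-congˡ (w≈av j)) (solve 3 (λ s a v → s :* (a :* v) := a :* (s :* v)) refl (⟦ σ i ⟧ (xᴱ j)) (proj₁ a) (proj₁ (v j)))) ⟩
              sum (λ j → proj₁ a * (⟦ σ i ⟧ (xᴱ j) * proj₁ (v j)))
                ≈⟨ *-distribˡ-sum {m} (proj₁ a) (λ j → ⟦ σ i ⟧ (xᴱ j) * proj₁ (v j)) ⟨
              proj₁ a * sum (λ j → ⟦ σ i ⟧ (xᴱ j) * proj₁ (v j))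
                ≈⟨ trans (*-congˡ (Wv i)) (zeroʳ _) ⟩
              0# ∎
          ; W-sub   = λ u v w w≈ Wu Wv i → begin
              sum (λ j → ⟦ σ i ⟧ (xᴱ j) * proj₁ (w j))
                ≈⟨ sum-cong-≋ {m} (λ j → trans (*-congˡ (w≈ j)) (solve 3 (λ s u v → s :* (u :- v) := s :* u :+ (:- con (+ 1)) :* (s :* v)) refl (⟦ σ i ⟧ (xᴱ j)) (proj₁ (u j)) (proj₁ (v j)))) ⟩
              sum (λ j → ⟦ σ i ⟧ (xᴱ j) * proj₁ (u j) + - 1# * (⟦ σ i ⟧ (xᴱ j) * proj₁ (v j)))
                ≈⟨ sum-linear {m} (- 1#) (λ j → ⟦ σ i ⟧ (xᴱ j) * proj₁ (u j)) (λ j → ⟦ σ i ⟧ (xᴱ j) * proj₁ (v j)) ⟩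
              sum (λ j → ⟦ σ i ⟧ (xᴱ j) * proj₁ (u j)) + - 1# * sum (λ j → ⟦ σ i ⟧ (xᴱ j) * proj₁ (v j))
                ≈⟨ +-cong (Wu i) (trans (*-congˡ (Wv i)) (zeroʳ _)) ⟩
              0# + 0#
                ≈⟨ +-identityˡ 0# ⟩
              0# ∎
          -- Equation i for σ k (v) is σ k applied to equation i′ for v, where σ k ∘ σ i′ = σ i.
          ; W-apply = λ k v Wv i →
              let i′ , σkσi′≈σi = translate k i
                  term : Fin m → Element E
                  term j = ⟦ σ i′ ⟧ (xᴱ j) * proj₁ (v j) , E.*-closed (into i′ (xᴱ j)) (proj₂ (v j))
              in begin
              sum (λ j → ⟦ σ i ⟧ (xᴱ j) * ⟦ σ k ⟧ (v j))
                ≈⟨ sum-cong-≋ {m} (λ j → trans (*-congʳ (sym (σkσi′≈σi (xᴱ j)))) (sym (Hom.*-homo (σ k) (apply i′ (xᴱ j)) (v j) (term j) refl))) ⟩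
              sum (λ j → ⟦ σ k ⟧ (term j))
                ≈⟨ Hom.sum-homo (σ k) term 0ᴱ (sym (Wv i′)) ⟨
              ⟦ σ k ⟧ 0ᴱ
                ≈⟨ Hom.0-homo (σ k) 0ᴱ refl ⟩
              0# ∎
          }

      -- Dependence of more than r elements bounds the degree above by r; the r distinct
      -- homomorphisms bound it below.
      artin : Distinct σ → HasDegree M E r
      artin distinct = ≡.subst (HasDegree M E) (ℕ.≤-antisym n≤r (homs-≤-degree M⊆E degree-E σ distinct fixes)) degree-E
        where
        finite : ∃ (HasDegree M E)
        finite = bounded⇒degree r (dependent-over-fixed (ℕ.n<1+n r))
        n = proj₁ finite
        degree-E : HasDegree M E n
        degree-E = proj₂ finite
        n≤r : n ℕ.≤ r
        n≤r = ℕ.≮⇒≥ λ r<n → independent⇒¬dependent M {v = proj₁ degree-E} (IsBasis.independent (proj₂ degree-E))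
          (dependent-over-fixed r<n (proj₁ degree-E) (IsBasis.members (proj₂ degree-E)))

-- Normality of a finite extension.

module NormalExtensions (em : Classical) {c ℓ : Level} (Ω : Field c ℓ) (closed : AlgebraicallyClosed Ω)
                        (K : Subfield Ω) (algebraic : ∀ x → Algebraic K x)
                        (L Lₛ : Subfield Ω) (K⊆L : K ⊆ L) {n : ℕ} (degree-L : HasDegree K L n)
                        (maximalSeparable : IsMaximalSeparable K L Lₛ) where
  open Field Ω hiding (zero)
  open ClassicalField em Ω
  open LinearAlgebra em Ω
  open ClosedField em Ω closed
  open AlgebraicElements em Ω closed K algebraic
  open FieldHomomorphisms em Ω
  open Embeddings em Ω closed K algebraic
  open Separability em Ω closed K algebraic
  open Frobenius em Ω using (InjectivePower)
  open Artin em Ω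
  open Polynomials commutativeRing
  open PolynomialProperties commutativeRing
  open Exp semiring using (_^_)
  open SemiringSum semiring using (sum; sum-cong-≋)
  open IsMaximalSeparable maximalSeparable
  open Hom using (⟦_⟧; Fixes)
  open OverField K (λ k∈ → k∈) using (minimal-polynomial; module Minimal)

  K⊆Lₛ : K ⊆ Lₛ
  K⊆Lₛ = proj₁ separable

  abstract
    separable⇒∈Lₛ : ∀ {x} → x ∈ L → SeparableElement K x → x ∈ Lₛ
    separable⇒∈Lₛ = separable∈maximal {L} K⊆L degree-L maximalSeparable

  abstract
    conjugate : ∀ {f x y} → Irreducible K f → Root f x → Root f y → (x∈ : x ∈ L) →
                ∃[ M ] Σ (Isomorphism K L M) λ τ → Hom.⟦_⟧ (hom τ) (x , x∈) ≈ y
    conjugate = conjugate-isomorphism {L} K⊆L degree-L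

  Lᴬ : Subfield Ω
  Lᴬ = fixedField K L

  K⊆Lᴬ : K ⊆ Lᴬ
  K⊆Lᴬ k∈ = K⊆L k∈ , λ σ → Isomorphism.fixes σ _ k∈

  Lᴬ⊆L : Lᴬ ⊆ L
  Lᴬ⊆L = proj₁

  -- h(x)^q = h(x^q) = h′(x^q) = h′(x)^q, and q-th powers are injective on Ω.
  determined-on-Lₛ : (h h′ : Hom L) → (∀ (x : Element Lₛ) → ⟦ restrict {L} {Lₛ} inside h ⟧ x ≈ ⟦ restrict {L} {Lₛ} inside h′ ⟧ x) → ∀ x → ⟦ h ⟧ x ≈ ⟦ h′ ⟧ x
  determined-on-Lₛ h h′ agree x =
    let q , injective-power , separable-xq = separable-power {L} K⊆L degree-L (proj₂ x)
    in at-power q injective-power (separable⇒∈Lₛ (^-closed (subfield-isSubring L) (proj₂ x) q) separable-xq)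
    where
    at-power : ∀ q → InjectivePower q → proj₁ x ^ q ∈ Lₛ → ⟦ h ⟧ x ≈ ⟦ h′ ⟧ x
    at-power q injective-power xq∈ = injective-power (⟦ h ⟧ x) (⟦ h′ ⟧ x)
      (trans (sym (Hom.^-homo h q x xq refl)) (trans (agree (proj₁ x ^ q , xq∈)) (Hom.^-homo h′ q x xq refl)))
      where
      xq : Element L
      xq = proj₁ x ^ q , inside xq∈

  fixes-K : ∀ {M} (σ : Isomorphism K L M) → Fixes (hom σ) K
  fixes-K σ = Isomorphism.fixes σ

  preserves-root : (h : Hom L) → Fixes h K → ∀ {f} → f ∈ K [X] → ∀ x → Root f (proj₁ x) → Root f (⟦ h ⟧ x)
  preserves-root h fixes {f} f∈ x root = trans (sym (Hom.eval-homo h {K} K⊆L fixes f f∈ x (0# , Subfield.0∈ L) (sym root))) (Hom.0-homo h _ refl)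

  preserves-separable : (h : Hom L) → Fixes h K → ∀ x → SeparableElement K (proj₁ x) → SeparableElement K (⟦ h ⟧ x)
  preserves-separable h fixes x (f , min , simple) = f , record
    { irreducible = min.irreducible
    ; monic       = min.monic
    ; root        = preserves-root h fixes (Irreducible.over min.irreducible) x min.root
    } , simple
    where module min = IsMinimalPolynomial min

  module Automorphisms = Cardinality em (Aut K L)

  -- Ensures that r is the true number of automorphisms and not the default value 0.
  automorphisms-finite : ∃ (HasCardinality (Aut K L))
  automorphisms-finite = Automorphisms.bounded⇒cardinality n λ σ distinct →
    ℕ.<-irrefl ≡.refl (homs-≤-degree {L} {K} K⊆L degree-L (λ i → hom (σ i)) distinct (λ i → fixes-K (σ i)))

  automorphisms-r : HasCardinality (Aut K L) (r em K L)
  automorphisms-r = Automorphisms.hasCardinality-card automorphisms-finite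

  open Automorphisms.Enumeration automorphisms-r

  σ : Fin (r em K L) → Hom L
  σ i = hom (enum i)

  σ-into : ∀ i x → ⟦ σ i ⟧ x ∈ L
  σ-into i x = proj₂ (Isomorphism.⟦_⟧ (enum i) x)

  -- This is ρ⁻¹ τ. Preimages under ρ are chosen pointwise, and every law is checked after applying
  -- the injective ρ.
  quotient-automorphism : (ρ τ : Isomorphism K L L) → Σ (Isomorphism K L L) λ π →
                          ∀ x → ⟦ hom ρ ⟧ (Isomorphism.⟦_⟧ π x) ≈ ⟦ hom τ ⟧ x
  quotient-automorphism ρ τ = isomorphism h (λ x → proj₂ (h₀ x)) onto fixes , ρh≈τ
    where
    module ρ = Hom (hom ρ)
    module τ = Hom (hom τ)
    ρ-inverse : ∀ {y} → y ∈ L → ∃[ x ] ρ.⟦ x ⟧ ≈ y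
    ρ-inverse = preimage ρ
    h₀ : Element L → Element L
    h₀ x = proj₁ (ρ-inverse (proj₂ (Isomorphism.⟦_⟧ τ x)))
    ρh≈τ : ∀ x → ρ.⟦ h₀ x ⟧ ≈ τ.⟦ x ⟧
    ρh≈τ x = proj₂ (ρ-inverse (proj₂ (Isomorphism.⟦_⟧ τ x)))
    h : Hom L
    h = record
      { ⟦_⟧     = λ x → proj₁ (h₀ x)
      ; ⟦⟧-cong = λ x y e → ρ.injective (h₀ x) (h₀ y) (trans (ρh≈τ x) (trans (τ.⟦⟧-cong x y e) (sym (ρh≈τ y))))
      ; +-homo  = λ x y z e → ρ.injective (h₀ z) (_ , Subfield.+-closed L (proj₂ (h₀ x)) (proj₂ (h₀ y)))
          (trans (ρh≈τ z) (trans (τ.+-homo x y z e) (sym (trans (ρ.+-homo (h₀ x) (h₀ y) _ refl) (+-cong (ρh≈τ x) (ρh≈τ y))))))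
      ; *-homo  = λ x y z e → ρ.injective (h₀ z) (_ , Subfield.*-closed L (proj₂ (h₀ x)) (proj₂ (h₀ y)))
          (trans (ρh≈τ z) (trans (τ.*-homo x y z e) (sym (trans (ρ.*-homo (h₀ x) (h₀ y) _ refl) (*-cong (ρh≈τ x) (ρh≈τ y))))))
      ; 1-homo  = λ z e → ρ.injective (h₀ z) (1# , Subfield.1∈ L) (trans (ρh≈τ z) (trans (τ.1-homo z e) (sym (ρ.1-homo _ refl))))
      }
    onto : ∀ {y} → y ∈ L → ∃[ x ] ⟦ h ⟧ x ≈ y
    onto {y} y∈ =
      let x , τx≈ρy = preimage τ (proj₂ (Isomorphism.⟦_⟧ ρ (y , y∈)))
      in x , ρ.injective (h₀ x) (y , y∈) (trans (ρh≈τ x) τx≈ρy)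
    fixes : Fixes h K
    fixes x k∈ = ρ.injective (h₀ x) x (trans (ρh≈τ x) (trans (fixes-K τ x k∈) (sym (fixes-K ρ x k∈))))

  σ-translate : ∀ k i → ∃[ i′ ] ∀ x → ⟦ σ k ⟧ (⟦ σ i′ ⟧ x , σ-into i′ x) ≈ ⟦ σ i ⟧ x
  σ-translate k i =
    let π , ρπ≈τ = quotient-automorphism (enum k) (enum i)
        i′ , π≈σ = enum-complete π
    in i′ , λ x → trans (Hom.⟦⟧-cong (σ k) _ _ (sym (π≈σ x))) (ρπ≈τ x)

  σ-identity : ∃[ i ] ∀ x → ⟦ σ i ⟧ x ≈ proj₁ x
  σ-identity = let i , id≈σ = enum-complete (identity-isomorphism L) in i , λ x → sym (id≈σ x)

  fixed⇒∈Lᴬ : ∀ x → (∀ i → ⟦ σ i ⟧ x ≈ proj₁ x) → proj₁ x ∈ Lᴬ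
  fixed⇒∈Lᴬ x fixed = proj₂ x , λ τ → let i , τ≈σ = enum-complete τ in trans (τ≈σ x) (fixed i)

  ∈Lᴬ⇒fixed : ∀ (τ : Isomorphism K L L) x → proj₁ x ∈ Lᴬ → ⟦ hom τ ⟧ x ≈ proj₁ x
  ∈Lᴬ⇒fixed τ x (x∈ , fixed) = trans (Hom.⟦⟧-cong (hom τ) _ _ refl) (fixed τ)

  degree-Lᴬ-L : HasDegree Lᴬ L (r em K L)
  degree-Lᴬ-L = artin {Lᴬ} {L} Lᴬ⊆L σ σ-into (λ i → ∈Lᴬ⇒fixed (enum i)) fixed⇒∈Lᴬ σ-translate σ-identity enum-distinct

  σₛ : Fin (r em K L) → Hom Lₛ
  σₛ i = restrict inside (σ i)

  σₛ-distinct : Distinct σₛ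
  σₛ-distinct i j agree = enum-distinct i j (determined-on-Lₛ (σ i) (σ j) agree)

  -- An automorphism sends a separable element to a root of the same minimal polynomial, so the
  -- image is separable and lies in `Lₛ` again.
  σₛ-into : ∀ i x → ⟦ σₛ i ⟧ x ∈ Lₛ
  σₛ-into i x = separable⇒∈Lₛ (σ-into i _) (preserves-separable (σ i) (fixes-K (enum i)) _ (proj₂ separable (proj₂ x)))

  σₛ-fixes : ∀ i → Fixes (σₛ i) K
  σₛ-fixes i x k∈ = fixes-K (enum i) _ k∈

  purelyInseparable⇒degree-Lₛ : PurelyInseparable K Lᴬ → HasDegree K Lₛ (r em K L)
  purelyInseparable⇒degree-Lₛ (_ , separable∈K) = artin {K} {Lₛ} K⊆Lₛ σₛ σₛ-into σₛ-fixes
    (λ x fixed → separable∈K (fixed⇒∈Lᴬ (proj₁ x , inside (proj₂ x)) fixed) (proj₂ separable (proj₂ x)))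
    (λ k i → let i′ , eq = σ-translate k i in i′ , λ x → trans (Hom.⟦⟧-cong (σ k) _ _ refl) (eq _))
    (proj₁ σ-identity , λ x → proj₂ σ-identity _)
    σₛ-distinct

  degree-Lₛ : ∃ (HasDegree K Lₛ)
  degree-Lₛ = subextension-degree {K} {K} {Lₛ} {L} (λ k∈ → k∈) inside degree-L

  embedding-is-automorphism : HasDegree K Lₛ (r em K L) → ∀ {M} (τ : Isomorphism K L M) → ∃[ i ] ∀ x → ⟦ hom τ ⟧ x ≈ ⟦ σ i ⟧ x
  embedding-is-automorphism degree-Lₛ≡r τ = stable λ ¬∃ →
    ℕ.<-irrefl ≡.refl (homs-≤-degree {Lₛ} {K} K⊆Lₛ degree-Lₛ≡r (τₛ ∷ᵛ σₛ) (distinct ¬∃)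
      λ { zero x k∈ → fixes-K τ _ k∈ ; (suc i) → σₛ-fixes i })
    where
    τₛ : Hom Lₛ
    τₛ = restrict inside (hom τ)
    distinct : ¬ (∃[ i ] ∀ x → ⟦ hom τ ⟧ x ≈ ⟦ σ i ⟧ x) → Distinct (τₛ ∷ᵛ σₛ)
    distinct ¬∃ zero    zero    _ = ≡.refl
    -- Agreement on `Lₛ` already means agreement on `L`.
    distinct ¬∃ zero    (suc j) e = ⊥-elim (¬∃ (j , determined-on-Lₛ (hom τ) (σ j) e))
    distinct ¬∃ (suc i) zero    e = ⊥-elim (¬∃ (i , determined-on-Lₛ (hom τ) (σ i) (λ x → sym (e x))))
    distinct ¬∃ (suc i) (suc j) e = ≡.cong suc (σₛ-distinct i j e)

  conjugates-in-L⇒normal : (∀ {f x y} → Irreducible K f → Root f x → Root f y → x ∈ L → y ∈ L) → Normal K L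
  conjugates-in-L⇒normal conjugate∈ = K⊆L , (λ {x} _ → algebraic x) , λ f irr {x} x∈ x-root →
    splits-in {K} {L} {f} K⊆L (Irreducible.over irr) λ y-root → conjugate∈ irr x-root y-root x∈

  degree-Lₛ⇒normal : HasDegree K Lₛ (r em K L) → Normal K L
  degree-Lₛ⇒normal degree-Lₛ≡r = conjugates-in-L⇒normal λ irr x-root y-root x∈ →
    let M , τ , τx≈y = conjugate irr x-root y-root x∈
        i , τ≈σ = embedding-is-automorphism degree-Lₛ≡r τ
    in Subfield.resp L (trans (sym (τ≈σ _)) τx≈y) (σ-into i _)

  -- The image of u is a root of the minimal polynomial of u, which splits in `L`; hence M ⊆ L.
  -- Equality is by dimension: τ carries a basis of `L` to a K-independent family in `M`.
  normal⇒conjugate≅L : Normal K L → ∀ {M} → Isomorphism K L M → M ≅ₛ L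
  normal⇒conjugate≅L (_ , _ , splits) {M} τ = M⊆L , degree-≤⇒⊆ {K} {M} {L} K⊆M M⊆L degree-M degree-L n≤m
    where
    module τ = Hom (hom τ)
    M⊆L : M ⊆ L
    M⊆L v∈ = Subfield.resp L τu≈v (splits-in⇒root∈ {L} {Min.m} (nonconstant⇒≉[] {Min.m} Min.nonconstant) (splits Min.m Min.irreducible (proj₂ u) Min.root)
      (preserves-root (hom τ) (fixes-K τ) Min.m-over u Min.root))
      where
      u = proj₁ (preimage τ v∈)
      τu≈v = proj₂ (preimage τ v∈)
      module Min = Minimal (minimal-polynomial (proj₁ u))
    K⊆M : K ⊆ M
    K⊆M {k} k∈ = Subfield.resp M (fixes-K τ (k , K⊆L k∈) k∈) (proj₂ (Isomorphism.⟦_⟧ τ (k , K⊆L k∈)))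
    finite-M : ∃ (HasDegree K M)
    finite-M = subextension-degree {K} {K} {M} {L} (λ k∈ → k∈) M⊆L degree-L
    m = proj₁ finite-M
    degree-M : HasDegree K M m
    degree-M = proj₂ finite-M
    b = proj₁ degree-L
    module B = IsBasis (proj₂ degree-L)
    bᴸ : Fin n → Element L
    bᴸ i = b i , B.members i
    τb : Vector Carrier n
    τb i = τ.⟦ bᴸ i ⟧
    τb-independent : Independent K τb
    τb-independent k k∈ relation = B.independent k k∈
      (τ.injective total (0# , Subfield.0∈ L) (trans (τ.sum-homo term total refl)
        (trans (sum-cong-≋ λ i → trans (τ.*-homo (scalar i) (bᴸ i) (term i) refl) (*-congʳ (fixes-K τ (scalar i) (k∈ i))))
          (trans relation (sym (τ.0-homo _ refl))))))
      where
      scalar term : Fin n → Element L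
      scalar i = k i , K⊆L (k∈ i)
      term i = k i * b i , Subfield.*-closed L (K⊆L (k∈ i)) (B.members i)
      total : Element L
      total = sum (λ i → k i * b i) , sum-closed L (proj₂ ∘ term)
    n≤m : n ℕ.≤ m
    n≤m = independent≤spanning K (proj₁ degree-M) τb τb-independent λ i →
      IsBasis.spanning (proj₂ degree-M) (proj₂ (Isomorphism.⟦_⟧ τ (bᴸ i)))

  normal⇒automorphism : Normal K L → ∀ {M} (τ : Isomorphism K L M) → Isomorphism K L L
  normal⇒automorphism normal τ =
    let M⊆L , L⊆M = normal⇒conjugate≅L normal τ
    in isomorphism (hom τ) (λ x → M⊆L (proj₂ (Isomorphism.⟦_⟧ τ x))) (λ y∈ → preimage τ (L⊆M y∈)) (fixes-K τ)

  normal⇒purelyInseparable : Normal K L → PurelyInseparable K Lᴬ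
  normal⇒purelyInseparable normal = K⊆Lᴬ , in-K
    where
    in-K : ∀ {x} → x ∈ Lᴬ → SeparableElement K x → x ∈ K
    in-K {x} x∈ (f , min , simple) = sole-root∈ K (λ k∈ → k∈) (Irreducible.over irreducible) (Irreducible.nonconstant irreducible) simple root λ y-root →
      let M , τ , τx≈y = conjugate irreducible root y-root (Lᴬ⊆L x∈)
      in trans (sym τx≈y) (∈Lᴬ⇒fixed (normal⇒automorphism normal τ) (x , Lᴬ⊆L x∈) x∈)
      where open IsMinimalPolynomial min

  module Conjugates = Cardinality em (IsomorphicSubfields K L)

  normal⇔s≡1 : Normal K L ⇔ s em K L ≡ 1
  normal⇔s≡1 = mk⇔ to from
    where
    to : Normal K L → s em K L ≡ 1
    to normal = Conjugates.card-≡ record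
      { to        = λ _ → zero
      ; cong      = λ _ → ≡.refl
      ; bijective = (λ {M} {N} _ → let M⊆L , L⊆M = normal⇒conjugate≅L normal (proj₂ M)
                                       N⊆L , L⊆N = normal⇒conjugate≅L normal (proj₂ N)
                                   in (λ z → L⊆N (M⊆L z)) , (λ z → L⊆M (N⊆L z))) ,
                    λ { zero → (L , identity-isomorphism L) , λ _ → ≡.refl }
      }
    -- The value 1 is not the default of `card`, so there is a bijection with a one-element set; `M`
    -- and `L` have the same image and therefore coincide.
    unique-conjugate : s em K L ≡ 1 → ∀ {M} → Isomorphism K L M → M ⊆ L
    unique-conjugate s≡1 {M} τ = proj₁ (Bijection.injective one {M , τ} {L , identity-isomorphism L} (subsingleton _ _))
      where
      one : HasCardinality (IsomorphicSubfields K L) 1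
      one = Conjugates.card≡suc⇒hasCardinality s≡1
      subsingleton : ∀ (i j : Fin 1) → i ≡ j
      subsingleton zero zero = ≡.refl
    from : s em K L ≡ 1 → Normal K L
    from s≡1 = conjugates-in-L⇒normal λ irr x-root y-root x∈ →
      let M , τ , τx≈y = conjugate irr x-root y-root x∈
      in unique-conjugate s≡1 τ (Subfield.resp M τx≈y (proj₂ (Isomorphism.⟦_⟧ τ _)))

  normal⇔r≡[Lₛ:K] : Normal K L ⇔ r em K L ≡ degree em K Lₛ
  normal⇔r≡[Lₛ:K] = mk⇔
    (λ normal → ≡.sym (degree-≡ {K} {Lₛ} (purelyInseparable⇒degree-Lₛ (normal⇒purelyInseparable normal))))
    (λ r≡d → degree-Lₛ⇒normal (≡.subst (HasDegree K Lₛ) (≡.sym r≡d) (hasDegree-degree {K} {Lₛ} degree-Lₛ)))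

  normal⇔purelyInseparable : Normal K L ⇔ PurelyInseparable K Lᴬ
  normal⇔purelyInseparable = mk⇔ normal⇒purelyInseparable (degree-Lₛ⇒normal ∘ purelyInseparable⇒degree-Lₛ)

  -- Comparison of degrees.

  private
    d e h : ℕ
    d = degree em K Lₛ
    e = degree em Lₛ L
    h = degree em K Lᴬ

    [Lₛ:K] : HasDegree K Lₛ d
    [Lₛ:K] = hasDegree-degree {K} {Lₛ} degree-Lₛ

    [L:Lₛ] : HasDegree Lₛ L e
    [L:Lₛ] = hasDegree-degree {Lₛ} {L} (subextension-degree {K} {Lₛ} {L} {L} K⊆Lₛ (λ x∈ → x∈) degree-L)

    [Lᴬ:K] : HasDegree K Lᴬ h
    [Lᴬ:K] = hasDegree-degree {K} {Lᴬ} (subextension-degree {K} {K} {Lᴬ} {L} (λ k∈ → k∈) Lᴬ⊆L degree-L)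

    de≡n : d ℕ.* e ≡ n
    de≡n = degree-unique {K} {L} (tower {K} {Lₛ} {L} K⊆Lₛ inside [Lₛ:K] [L:Lₛ]) degree-L

    hr≡n : h ℕ.* r em K L ≡ n
    hr≡n = degree-unique {K} {L} (tower {K} {Lᴬ} {L} K⊆Lᴬ Lᴬ⊆L [Lᴬ:K] degree-Lᴬ-L) degree-L

    instance
      d-nonZero : ℕ.NonZero d
      d-nonZero = ℕ.>-nonZero (degree>0 {K} {Lₛ} [Lₛ:K])
      e-nonZero : ℕ.NonZero e
      e-nonZero = ℕ.>-nonZero (degree>0 {Lₛ} {L} [L:Lₛ])
      h-nonZero : ℕ.NonZero h
      h-nonZero = ℕ.>-nonZero (degree>0 {K} {Lᴬ} [Lᴬ:K])

  -- Both sides compare r with d, the second after multiplication by the nonzero e, since d e = n.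
  r≡[Lₛ:K]⇔l≡[L:K] : r em K L ≡ d ⇔ l em K L Lₛ ≡ degree em K L
  r≡[Lₛ:K]⇔l≡[L:K] = mk⇔
    (λ r≡d → ≡.trans (≡.cong (e ℕ.*_) r≡d) (≡.trans (ℕ.*-comm e d) (≡.trans de≡n (≡.sym [L:K]≡n))))
    (λ er≡n → ℕ.*-cancelˡ-≡ (r em K L) d e (≡.trans er≡n (≡.trans [L:K]≡n (≡.trans (≡.sym de≡n) (ℕ.*-comm d e)))))
    where
    [L:K]≡n : degree em K L ≡ n
    [L:K]≡n = degree-≡ {K} {L} degree-L

  -- In d e = n = h r equality of one pair of factors forces equality of the other, as d and h are
  -- nonzero.
  r≡[Lₛ:K]⇔[L:Lₛ]≡[Lᴬ:K] : r em K L ≡ d ⇔ e ≡ h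
  r≡[Lₛ:K]⇔[L:Lₛ]≡[Lᴬ:K] = mk⇔
    (λ r≡d → ℕ.*-cancelˡ-≡ e h d (≡.trans de≡n (≡.trans (≡.sym hr≡n) (≡.trans (≡.cong (h ℕ.*_) r≡d) (ℕ.*-comm h d)))))
    (λ e≡h → ℕ.*-cancelˡ-≡ (r em K L) d h (≡.trans hr≡n (≡.trans (≡.sym de≡n) (≡.trans (≡.cong (d ℕ.*_) e≡h) (ℕ.*-comm d h)))))

corollary2p8p1 :
    (em : Classical) →
    ∀ {c ℓ} (K₀ : Field c ℓ) (closure : AlgebraicClosure K₀) →
    let open AlgebraicClosure closure using (K̄) renaming (base to K) in
    (L Lₛ : Subfield K̄) → FiniteExtension K L → IsMaximalSeparable K L Lₛ →
    let Lᴬ = fixedField K L in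
    (Normal K L ⇔ s em K L ≡ 1) ×
    (Normal K L ⇔ r em K L ≡ degree em K Lₛ) ×
    (Normal K L ⇔ l em K L Lₛ ≡ degree em K L) ×
    (Normal K L ⇔ degree em Lₛ L ≡ degree em K Lᴬ) ×
    (Normal K L ⇔ PurelyInseparable K Lᴬ)
corollary2p8p1 em K₀ closure L Lₛ (K⊆L , n , degree-L) maximalSeparable =
  normal⇔s≡1 ,
  normal⇔r≡[Lₛ:K] ,
  (r≡[Lₛ:K]⇔l≡[L:K] ⇔-∘ normal⇔r≡[Lₛ:K]) ,
  (r≡[Lₛ:K]⇔[L:Lₛ]≡[Lᴬ:K] ⇔-∘ normal⇔r≡[Lₛ:K]) ,
  normal⇔purelyInseparable
  where
  open AlgebraicClosure closure
  open NormalExtensions em K̄ algebraicallyClosed base algebraic L Lₛ K⊆L degree-L maximalSeparable
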